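{- Let $c\geq 2$ be an odd integer and let $0\leq a<c$ be an integer. Then for all sufficiently large $n_1$ and $n_2$ with $n_1<n_2+1$, \[ \overline{N}_2(a,c,n_1)\,\overline{N}_2(a,c,n_2)>\overline{N}_2(a,c,n_1-1)\,\overline{N}_2(a,c,n_2+1). \]
   Context: An overpartition of a nonnegative integer $n$ is a partition of $n$ in which the first occurrence of each distinct part may be overlined. For an overpartition $\lambda$, let $l(\lambda)$ be its largest part, $n(\lambda)$ its number of parts, and $n(\lambda_o)$ its number of odd non-overlined parts; let $\chi(\lambda)=1$ if $l(\lambda)$ is odd and non-overlined, and $\chi(\lambda)=0$ otherwise. The $M_2$-rank of $\lambda$ is $\lceil l(\lambda)/2\rceil-n(\lambda)-n(\lambda_o)-\chi(\lambda)$. $\overline{N}_2(a,c,n)$ denotes the number of overpartitions of $n$ whose $M_2$-rank is congruent to $a$ modulo $c$. -}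

module Defs where

open import Data.Nat using (ℕ; zero; suc; _+_; _*_; _∸_; _/_; _%_; _≤?_; _≡ᵇ_)
open import Data.Nat.Divisibility using (_∣?_)
open import Data.Bool using (Bool; true; false; if_then_else_)
open import Data.Product using (_×_; _,_)
open import Data.List using (List; []; _∷_; _++_; replicate; concatMap; upTo; filter; length; map)
open import Data.Integer as ℤ using (ℤ; +_)
open import Relation.Nullary.Decidable using (does)

-- An overpartition is represented as a list of parts (value , overlined?),
-- listed in non-increasing order of value; among the copies of a value k,
-- the (at most one) overlined copy comes first (it is the "first occurrence"
-- of k), followed by the non-overlined copies.
Part : Set
Part = ℕ × Bool

OverPartition : Set
OverPartition = List Part

block : ℕ → Bool → ℕ → OverPartition
block k true  m = (k , true) ∷ replicate m (k , false)
block k false m = replicate m (k , false)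

bsize : Bool → ℕ → ℕ
bsize true  m = suc m
bsize false m = m

-- gen k n : all overpartitions of n with every part ≤ k (each listed once)
gen : ℕ → ℕ → List OverPartition
gen zero    n = if n ≡ᵇ 0 then [] ∷ [] else []
gen (suc k) n =
  concatMap (λ ov →
    concatMap (λ m →
      if does (bsize ov m * suc k ≤? n)
        then map (block (suc k) ov m ++_) (gen k (n ∸ bsize ov m * suc k))
        else [])
      (upTo (suc n)))
    (false ∷ true ∷ [])

overpartitions : ℕ → List OverPartition
overpartitions n = gen n n

isOdd : ℕ → Bool
isOdd k = k % 2 ≡ᵇ 1

largest : OverPartition → ℕ
largest []            = 0
largest ((k , _) ∷ _) = k

numParts : OverPartition → ℕ
numParts = length

numOddNonOver : OverPartition → ℕ
numOddNonOver []                 = 0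
numOddNonOver ((k , true)  ∷ ps) = numOddNonOver ps
numOddNonOver ((k , false) ∷ ps) = (if isOdd k then 1 else 0) + numOddNonOver ps

-- χ(λ): 1 if the largest part is odd and non-overlined
-- (the head of the list is the first occurrence of the largest value)
chi : OverPartition → ℕ
chi []                = 0
chi ((k , true)  ∷ _) = 0
chi ((k , false) ∷ _) = if isOdd k then 1 else 0

m2rank : OverPartition → ℤ
m2rank λ′ = + (suc (largest λ′) / 2) ℤ.- + (numParts λ′ + numOddNonOver λ′ + chi λ′)

N2bar : ℤ → ℕ → ℕ → ℕ
N2bar a c n = length (filter (λ λ′ → c ∣? ℤ.∣ m2rank λ′ ℤ.- a ∣) (overpartitions n))

{-# OPTIONS --safe #-}
-- Let f n be the number of overpartitions of n.  The statement follows from two facts, both proved without analysis: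
-- (A) f (k+1)² − f k f (k+2) ≥ f k² / (20 (k+2)²) for large k;  (B) n³ |c N̄₂(a,c,n) − f n| = O(f n).
--
-- (A) The logarithmic derivative of Σ f n qⁿ is Σ b m qᵐ with b m = Σ 2 m / d over the odd divisors d of m.  Splitting off
-- d = 1 gives f = ℓ * r, where ℓ is the coefficient sequence of exp (2 q / (1 − q)) and r ≥ 0.  Thus f is a mixture
-- of translates of ℓ, whose second differences satisfy (n+2) Δ²ℓ n = 2 ℓ n, so that the curvature of log ℓ is known precisely.
-- Mixing costs the variance of the slope of log ℓ; Cauchy–Schwarz, the size-bias identity n r n = Σ c m r (n−m) and
-- the log-concavity of ℓ bound it by a pointwise quantity X depending on ℓ and c = b − 2 m only.  Since
-- Σ 1/d² over odd d ≥ 3 is small, X is at most 9/10 of the curvature.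
--
-- (B) Replacing two parts p by one part 2 p (p even) changes the rank by one, so for each pair (p, 2 p) the rank is exactly
-- equidistributed modulo c outside the overpartitions with fewer than 2 c copies of p.  Those failing for 12 pairs are rare:
-- if H has logarithmic derivative at most b, then n H n ≤ O(√n) [H / (1 − q)²] n, and iterating gains a power of n.
module Submission where

open import Defs
open import Data.Bool using (Bool; true; false; if_then_else_)
open import Data.Empty using (⊥-elim)
open import Data.Integer as ℤ using (ℤ)
import Data.Integer.Divisibility.Signed as ℤ∣
import Data.Integer.Properties as ℤₚ
import Data.Integer.Tactic.RingSolver as ℤ-Solver
open import Data.List using (List; []; _∷_; _++_; map; concatMap; upTo; applyUpTo; filter; length; replicate)
open import Data.List.Properties using (length-++)
open import Data.Nat as ℕ using (ℕ; zero; suc; z≤n; s≤s; _∸_)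
open import Data.Nat.DivMod using (m*n%n≡0)
open import Data.Nat.Divisibility using (_∣_; _∣?_; ∣m+n∣m⇒∣n; ∣m∣n⇒∣m+n; ∣-refl; ∣⇒≤; _∣0)
import Data.Nat.Properties as ℕₚ
import Data.Nat.Tactic.RingSolver as ℕ-Solver
open import Data.Product using (∃; _×_; _,_; proj₁; proj₂)
open import Data.Rational as ℚ using (ℚ; 0ℚ; 1ℚ; _+_; _*_; _-_; -_; _≤_; _<_; _/_; 1/_; ↥_; toℚᵘ; nonNegative; positive)
open import Data.Rational.Properties
import Data.Rational.Unnormalised as ℚᵘ
import Data.Rational.Unnormalised.Properties as ℚᵘₚ
open import Data.Sum using (_⊎_; inj₁; inj₂)
open import Function using (_∘_; id)
open import Level using (0ℓ)
open import Relation.Binary.Definitions using (tri<; tri≈; tri>)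
open import Relation.Binary.PropositionalEquality using (_≡_; refl; sym; trans; cong; cong₂; subst; subst₂; _≗_; module ≡-Reasoning)
open import Relation.Nullary using (¬_; yes; no; Dec)
open import Relation.Nullary.Decidable using (does; dec-true; dec-false; dec⇒maybe)
open import Tactic.RingSolver using (solve-∀)
open import Tactic.RingSolver.Core.AlmostCommutativeRing using (AlmostCommutativeRing; fromCommutativeRing)

-- Mixtures do not inherit log-concavity, so in (A) the curvature of log ℓ must beat the variance of
-- its slope. Asymptotically the bound `X` on that loss is to the curvature as the sum of 1/d² over
-- odd d ≥ 3, that is π²/8 - 1 < 1/4, to 1; this leaves room for crude rational constants. The gap
-- in (A) has true relative order k^(-3/2), but is stated with k^(-2) to avoid square roots. The
-- errors in (B) must therefore be of smaller order than k^(-2), and n^(-3) is enough. This fixes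
-- the number 12. A part p that escapes equidistribution contributes a cut factor, and a product
-- with a cut factor can absorb one more 1/(1 - q) at bounded cost. Two such factors gain √n through
-- n H n ≤ O(√n) [H/(1 - q)²] n, so twelve gain n³. The same device shows that r n is O(f n / n³),
-- which disposes of the boundary terms r (k+1) and r (k+2).

ringℚ : AlmostCommutativeRing 0ℓ 0ℓ
ringℚ = fromCommutativeRing +-*-commutativeRing (λ x → dec⇒maybe (0ℚ ≟ x))

-- Ordered field arithmetic

0≤+ : ∀ {p q} → 0ℚ ≤ p → 0ℚ ≤ q → 0ℚ ≤ p + q
0≤+ = +-mono-≤

0≤* : ∀ {p q} → 0ℚ ≤ p → 0ℚ ≤ q → 0ℚ ≤ p * q
0≤* {p} {q} 0≤p 0≤q =
  subst (_≤ p * q) (*-zeroʳ p) (*-monoˡ-≤-nonNeg p {{nonNegative 0≤p}} 0≤q)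

0<* : ∀ {p q} → 0ℚ < p → 0ℚ < q → 0ℚ < p * q
0<* {p} {q} 0<p 0<q =
  subst (_< p * q) (*-zeroʳ p) (*-monoʳ-<-pos p {{positive 0<p}} 0<q)

0<+ : ∀ {p q} → 0ℚ < p → 0ℚ ≤ q → 0ℚ < p + q
0<+ = +-mono-<-≤

0≤□ : ∀ p → 0ℚ ≤ p * p
0≤□ p with ≤-total 0ℚ p
... | inj₁ 0≤p = 0≤* 0≤p 0≤p
... | inj₂ p≤0 = subst (0ℚ ≤_) (neg*neg p) (0≤* 0≤-p 0≤-p)
  where
  0≤-p : 0ℚ ≤ - p
  0≤-p = neg-antimono-≤ p≤0
  neg*neg : ∀ p → - p * - p ≡ p * p
  neg*neg = solve-∀ ringℚ

p≤q⇒0≤q-p : ∀ {p q} → p ≤ q → 0ℚ ≤ q - p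
p≤q⇒0≤q-p {p} {q} p≤q = subst (_≤ q - p) (+-inverseʳ p) (+-monoˡ-≤ (- p) p≤q)

0≤q-p⇒p≤q : ∀ {p q} → 0ℚ ≤ q - p → p ≤ q
0≤q-p⇒p≤q {p} {q} h = subst₂ _≤_ (+-identityʳ p) (eq p q) (+-monoʳ-≤ p h)
  where
  eq : ∀ p q → p + (q - p) ≡ q
  eq = solve-∀ ringℚ

p<q⇒0<q-p : ∀ {p q} → p < q → 0ℚ < q - p
p<q⇒0<q-p {p} {q} p<q = subst (_< q - p) (+-inverseʳ p) (+-monoˡ-< (- p) p<q)

0<q-p⇒p<q : ∀ {p q} → 0ℚ < q - p → p < q
0<q-p⇒p<q {p} {q} h = subst₂ _<_ (+-identityʳ p) (eq p q) (+-monoʳ-< p h)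
  where
  eq : ∀ p q → p + (q - p) ≡ q
  eq = solve-∀ ringℚ

-- Polynomial inequalities are proved by exhibiting q − p as a visibly nonnegative expression.
≤-by : ∀ {p q e} → q - p ≡ e → 0ℚ ≤ e → p ≤ q
≤-by eq 0≤e = 0≤q-p⇒p≤q (subst (0ℚ ≤_) (sym eq) 0≤e)

*-monoˡ : ∀ {r p q} → 0ℚ ≤ r → p ≤ q → r * p ≤ r * q
*-monoˡ {r} 0≤r = *-monoˡ-≤-nonNeg r {{nonNegative 0≤r}}

*-monoʳ : ∀ {r p q} → 0ℚ ≤ r → p ≤ q → p * r ≤ q * r
*-monoʳ {r} 0≤r = *-monoʳ-≤-nonNeg r {{nonNegative 0≤r}}

*-mono : ∀ {p q r s} → 0ℚ ≤ p → 0ℚ ≤ s → p ≤ q → r ≤ s → p * r ≤ q * s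
*-mono 0≤p 0≤s p≤q r≤s = ≤-trans (*-monoˡ 0≤p r≤s) (*-monoʳ 0≤s p≤q)

*-cancelˡ : ∀ {r p q} → 0ℚ < r → r * p ≤ r * q → p ≤ q
*-cancelˡ {r} 0<r = *-cancelˡ-≤-pos r {{positive 0<r}}

*-cancelˡ-≡ : ∀ {r p q} → 0ℚ < r → r * p ≡ r * q → p ≡ q
*-cancelˡ-≡ 0<r eq = ≤-antisym (*-cancelˡ 0<r (≤-reflexive eq)) (*-cancelˡ 0<r (≤-reflexive (sym eq)))

p≤p+q : ∀ {p q} → 0ℚ ≤ q → p ≤ p + q
p≤p+q {p} {q} 0≤q = subst (_≤ p + q) (+-identityʳ p) (+-monoʳ-≤ p 0≤q)

p≤q+p : ∀ {p q} → 0ℚ ≤ q → p ≤ q + p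
p≤q+p {p} {q} 0≤q = subst (_≤ q + p) (+-identityˡ p) (+-monoˡ-≤ p 0≤q)

sqrt-mono : ∀ {p q} → 0ℚ ≤ q → p * p ≤ q * q → p ≤ q
sqrt-mono {p} {q} 0≤q h with ≤-total p q
... | inj₁ p≤q = p≤q
... | inj₂ q≤p with <-cmp q p
...   | tri< q<p _ _ = ⊥-elim (<-irrefl refl (<-≤-trans q²<p² h))
  where
  0<p : 0ℚ < p
  0<p = ≤-<-trans 0≤q q<p
  q²<p² : q * q < p * p
  q²<p² = ≤-<-trans (*-monoˡ 0≤q q≤p) (*-monoˡ-<-pos p {{positive 0<p}} q<p)
...   | tri≈ _ q≡p _ = ≤-reflexive (sym q≡p)
...   | tri> _ _ p<q = <⇒≤ p<q

-- Total inverse, with inv 0 = 0.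
inv : ℚ → ℚ
inv p with p ≟ 0ℚ
... | yes _  = 0ℚ
... | no p≢0 = (1/ p) {{ℚ.≢-nonZero p≢0}}

*-inv : ∀ {p} → 0ℚ < p → p * inv p ≡ 1ℚ
*-inv {p} 0<p with p ≟ 0ℚ
... | yes p≡0 = ⊥-elim (<-irrefl (sym p≡0) 0<p)
... | no p≢0  = *-inverseʳ p {{ℚ.≢-nonZero p≢0}}

0<inv : ∀ {p} → 0ℚ < p → 0ℚ < inv p
0<inv {p} 0<p = *-cancelˡ-<-nonNeg p {{nonNegative (<⇒≤ 0<p)}}
  (subst₂ _<_ (sym (*-zeroʳ p)) (sym (*-inv 0<p)) (positive⁻¹ 1ℚ))

0≤inv : ∀ {p} → 0ℚ < p → 0ℚ ≤ inv p
0≤inv = <⇒≤ ∘ 0<inv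

0≤1 : 0ℚ ≤ 1ℚ
0≤1 = ≤ᵇ⇒≤ _

nat : ℕ → ℚ
nat n = ℤ.+ n / 1

0≤nat : ∀ n → 0ℚ ≤ nat n
0≤nat n = nonNegative⁻¹ (nat n) {{normalize-nonNeg n 1}}

2ℚ 3ℚ : ℚ
2ℚ = nat 2
3ℚ = nat 3

-- Unlike `nat`, which serves for literals, this embedding unfolds at `suc` on open terms, so
-- polynomial identities about `ι (2 ℕ.+ n)` are identities in the single variable `ι n`.
ι : ℕ → ℚ
ι zero    = 0ℚ
ι (suc n) = 1ℚ + ι n

0≤ι : ∀ n → 0ℚ ≤ ι n
0≤ι zero    = ≤-refl
0≤ι (suc n) = 0≤+ 0≤1 (0≤ι n)

0<ι : ∀ n → 0ℚ < ι (suc n)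
0<ι n = 0<+ (positive⁻¹ 1ℚ) (0≤ι n)

ι-+ : ∀ m n → ι (m ℕ.+ n) ≡ ι m + ι n
ι-+ zero    n = sym (+-identityˡ (ι n))
ι-+ (suc m) n = trans (cong (1ℚ +_) (ι-+ m n)) (sym (+-assoc 1ℚ (ι m) (ι n)))

ι-* : ∀ m n → ι (m ℕ.* n) ≡ ι m * ι n
ι-* zero    n = sym (*-zeroˡ (ι n))
ι-* (suc m) n = trans (ι-+ n (m ℕ.* n)) (trans (cong (ι n +_) (ι-* m n)) (eq (ι m) (ι n)))
  where
  eq : ∀ a b → b + a * b ≡ (1ℚ + a) * b
  eq = solve-∀ ringℚ

ι-mono : ∀ {m n} → m ℕ.≤ n → ι m ≤ ι n
ι-mono {n = n} z≤n = 0≤ι n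
ι-mono (s≤s h) = +-monoʳ-≤ 1ℚ (ι-mono h)

ι-mono-< : ∀ {m n} → m ℕ.< n → ι m < ι n
ι-mono-< {m} {suc n} (s≤s h) = ≤-<-trans (ι-mono h) (subst (_< 1ℚ + ι n) (+-identityˡ (ι n)) (+-monoˡ-< (ι n) (positive⁻¹ 1ℚ)))

ι-cancel-< : ∀ {m n} → ι m < ι n → m ℕ.< n
ι-cancel-< {m} {n} h with m ℕₚ.<? n
... | yes m<n = m<n
... | no  m≮n = ⊥-elim (<-irrefl refl (<-≤-trans h (ι-mono (ℕₚ.≮⇒≥ m≮n))))

1≤ι : ∀ n → 1ℚ ≤ ι (suc n)
1≤ι n = p≤p+q (0≤ι n)

Eventually : (ℕ → Set) → Set
Eventually P = ∃ λ N → ∀ n → N ℕ.≤ n → P n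

-- Finite sums

sum : ℕ → (ℕ → ℚ) → ℚ
sum zero    f = 0ℚ
sum (suc n) f = f 0 + sum n (f ∘ suc)

sum-cong : ∀ n {f g : ℕ → ℚ} → (∀ i → i ℕ.< n → f i ≡ g i) → sum n f ≡ sum n g
sum-cong zero    h = refl
sum-cong (suc n) h = cong₂ _+_ (h 0 (s≤s z≤n)) (sum-cong n (λ i i<n → h (suc i) (s≤s i<n)))

sum-congˡ : ∀ n {f g : ℕ → ℚ} → f ≗ g → sum n f ≡ sum n g
sum-congˡ n h = sum-cong n (λ i _ → h i)

sum-mono : ∀ n {f g : ℕ → ℚ} → (∀ i → i ℕ.< n → f i ≤ g i) → sum n f ≤ sum n g
sum-mono zero    h = ≤-refl
sum-mono (suc n) h = +-mono-≤ (h 0 (s≤s z≤n)) (sum-mono n (λ i i<n → h (suc i) (s≤s i<n)))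

sum-0 : ∀ n → sum n (λ _ → 0ℚ) ≡ 0ℚ
sum-0 zero    = refl
sum-0 (suc n) = trans (+-identityˡ _) (sum-0 n)

sum-zero : ∀ n {f : ℕ → ℚ} → (∀ i → i ℕ.< n → f i ≡ 0ℚ) → sum n f ≡ 0ℚ
sum-zero n h = trans (sum-cong n h) (sum-0 n)

0≤sum : ∀ n {f : ℕ → ℚ} → (∀ i → 0ℚ ≤ f i) → 0ℚ ≤ sum n f
0≤sum zero    h = ≤-refl
0≤sum (suc n) h = 0≤+ (h 0) (0≤sum n (h ∘ suc))

sum-+ : ∀ n (f g : ℕ → ℚ) → sum n (λ i → f i + g i) ≡ sum n f + sum n g
sum-+ zero    f g = refl
sum-+ (suc n) f g = trans (cong (f 0 + g 0 +_) (sum-+ n (f ∘ suc) (g ∘ suc)))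
                          (eq (f 0) (g 0) (sum n (f ∘ suc)) (sum n (g ∘ suc)))
  where
  eq : ∀ a b c d → a + b + (c + d) ≡ a + c + (b + d)
  eq = solve-∀ ringℚ

sum-* : ∀ n c (f : ℕ → ℚ) → sum n (λ i → c * f i) ≡ c * sum n f
sum-* zero    c f = sym (*-zeroʳ c)
sum-* (suc n) c f = trans (cong (c * f 0 +_) (sum-* n c (f ∘ suc))) (sym (*-distribˡ-+ c (f 0) _))

sum-*ʳ : ∀ n c (f : ℕ → ℚ) → sum n (λ i → f i * c) ≡ sum n f * c
sum-*ʳ n c f = trans (sum-congˡ n (λ i → *-comm (f i) c)) (trans (sum-* n c f) (*-comm c _))

sum-last : ∀ n (f : ℕ → ℚ) → sum (suc n) f ≡ sum n f + f n
sum-last zero    f = +-comm (f 0) 0ℚ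
sum-last (suc n) f = trans (cong (f 0 +_) (sum-last n (f ∘ suc))) (sym (+-assoc (f 0) _ _))

sum-split : ∀ m n (f : ℕ → ℚ) → sum (m ℕ.+ n) f ≡ sum m f + sum n (f ∘ (m ℕ.+_))
sum-split zero    n f = sym (+-identityˡ _)
sum-split (suc m) n f = trans (cong (f 0 +_) (sum-split m n (f ∘ suc))) (sym (+-assoc (f 0) _ _))

sum-swap : ∀ m n (f : ℕ → ℕ → ℚ) → sum m (λ i → sum n (f i)) ≡ sum n (λ j → sum m (λ i → f i j))
sum-swap zero    n f = sym (sum-0 n)
sum-swap (suc m) n f = trans (cong (sum n (f 0) +_) (sum-swap m n (f ∘ suc))) (sym (sum-+ n (f 0) _))

sum-mono-range : ∀ {m n} {f : ℕ → ℚ} → (∀ i → 0ℚ ≤ f i) → m ℕ.≤ n → sum m f ≤ sum n f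
sum-mono-range {m} {n} {f} 0≤f m≤n = subst (λ k → sum m f ≤ sum k f) (ℕₚ.m+[n∸m]≡n m≤n)
  (subst (sum m f ≤_) (sym (sum-split m (n ∸ m) f)) (p≤p+q (0≤sum (n ∸ m) (λ i → 0≤f (m ℕ.+ i)))))

term≤sum : ∀ {n} {f : ℕ → ℚ} i → (∀ j → 0ℚ ≤ f j) → i ℕ.< n → f i ≤ sum n f
term≤sum {n} {f} i 0≤f i<n = ≤-trans
  (subst (f i ≤_) (sym (sum-last i f)) (p≤q+p (0≤sum i 0≤f))) (sum-mono-range 0≤f i<n)

sum-rev : ∀ n (f : ℕ → ℚ) → sum (suc n) f ≡ sum (suc n) (λ i → f (n ∸ i))
sum-rev zero    f = refl
sum-rev (suc n) f = trans (sum-last (suc n) f)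
  (trans (+-comm (sum (suc n) f) (f (suc n))) (cong (f (suc n) +_) (sum-rev n f)))

-- Formal power series

Series : Set
Series = ℕ → ℚ

infixl 7 _⊛_
infixl 6 _⊞_
infix 4 _⊑_

_⊛_ : Series → Series → Series
(a ⊛ b) n = sum (suc n) (λ i → a i * b (n ∸ i))

_⊞_ : Series → Series → Series
(a ⊞ b) n = a n + b n

_·_ : ℚ → Series → Series
(c · a) n = c * a n

_⊑_ : Series → Series → Set
a ⊑ b = ∀ n → a n ≤ b n

0̂ one I : Series
0̂ _ = 0ℚ
one zero    = 1ℚ
one (suc _) = 0ℚ
I _ = 1ℚ

sum-I : ∀ n → sum n I ≡ ι n
sum-I zero    = refl
sum-I (suc n) = cong (1ℚ +_) (sum-I n)

Monotone : Series → Set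
Monotone a = ∀ n → a n ≤ a (suc n)

Monotone-≤ : ∀ {a} → Monotone a → ∀ {m n} → m ℕ.≤ n → a m ≤ a n
Monotone-≤ {a} h {m} {n} m≤n = subst (λ k → a m ≤ a k) (ℕₚ.m∸n+n≡m m≤n) (go (n ∸ m))
  where
  go : ∀ k → a m ≤ a (k ℕ.+ m)
  go zero    = ≤-refl
  go (suc k) = ≤-trans (go k) (h (k ℕ.+ m))

-- Multiplication by q ^ k.
sh : ℕ → Series → Series
sh zero    a n       = a n
sh (suc k) a zero    = 0ℚ
sh (suc k) a (suc n) = sh k a n

-- The derivation q d/dq.
θ : Series → Series
θ a n = ι n * a n

⊑-refl : ∀ {a} → a ⊑ a
⊑-refl n = ≤-refl

⊑-trans : ∀ {a b c} → a ⊑ b → b ⊑ c → a ⊑ c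
⊑-trans h k n = ≤-trans (h n) (k n)

⊑-reflexive : ∀ {a b} → a ≗ b → a ⊑ b
⊑-reflexive h n = ≤-reflexive (h n)

⊛-cong≤ : ∀ {a a′ b b′} n → (∀ i → i ℕ.≤ n → a i ≡ a′ i) → (∀ i → i ℕ.≤ n → b i ≡ b′ i) →
          (a ⊛ b) n ≡ (a′ ⊛ b′) n
⊛-cong≤ n h k = sum-cong (suc n) λ { i (s≤s i≤n) → cong₂ _*_ (h i i≤n) (k (n ∸ i) (ℕₚ.m∸n≤m n i)) }

⊛-cong : ∀ {a a′ b b′} → a ≗ a′ → b ≗ b′ → a ⊛ b ≗ a′ ⊛ b′
⊛-cong h k n = ⊛-cong≤ n (λ i _ → h i) (λ i _ → k i)

⊛-congˡ : ∀ a {b b′} → b ≗ b′ → a ⊛ b ≗ a ⊛ b′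
⊛-congˡ a = ⊛-cong {a} (λ _ → refl)

⊛-congʳ : ∀ {a a′} b → a ≗ a′ → a ⊛ b ≗ a′ ⊛ b
⊛-congʳ b h = ⊛-cong {b = b} h (λ _ → refl)

⊛-distribʳ : ∀ a b c → (a ⊞ b) ⊛ c ≗ a ⊛ c ⊞ b ⊛ c
⊛-distribʳ a b c n = trans (sum-congˡ (suc n) (λ i → *-distribʳ-+ (c (n ∸ i)) (a i) (b i)))
                           (sum-+ (suc n) (λ i → a i * c (n ∸ i)) (λ i → b i * c (n ∸ i)))

⊛-distribˡ : ∀ a b c → a ⊛ (b ⊞ c) ≗ a ⊛ b ⊞ a ⊛ c
⊛-distribˡ a b c n = trans (sum-congˡ (suc n) (λ i → *-distribˡ-+ (a i) (b (n ∸ i)) (c (n ∸ i))))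
                           (sum-+ (suc n) (λ i → a i * b (n ∸ i)) (λ i → a i * c (n ∸ i)))

·-⊛ : ∀ k a b → (k · a) ⊛ b ≗ k · (a ⊛ b)
·-⊛ k a b n = trans (sum-congˡ (suc n) (λ i → *-assoc k (a i) (b (n ∸ i)))) (sum-* (suc n) k (λ i → a i * b (n ∸ i)))

⊛-sucʳ : ∀ a b n → (a ⊛ b) (suc n) ≡ (a ⊛ (b ∘ suc)) n + a (suc n) * b 0
⊛-sucʳ a b zero    = eq (a 0 * b 1) (a 1 * b 0)
  where
  eq : ∀ x y → x + (y + 0ℚ) ≡ (x + 0ℚ) + y
  eq = solve-∀ ringℚ
⊛-sucʳ a b (suc n) = trans (cong (a 0 * b (2 ℕ.+ n) +_) (⊛-sucʳ (a ∘ suc) b n))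
  (sym (+-assoc (a 0 * b (2 ℕ.+ n)) (((a ∘ suc) ⊛ (b ∘ suc)) n) (a (2 ℕ.+ n) * b 0)))

⊛-comm : ∀ a b → a ⊛ b ≗ b ⊛ a
⊛-comm a b zero    = cong (_+ 0ℚ) (*-comm (a 0) (b 0))
⊛-comm a b (suc n) = begin
  a 0 * b (suc n) + ((a ∘ suc) ⊛ b) n  ≡⟨ cong₂ _+_ (*-comm (a 0) (b (suc n))) (⊛-comm (a ∘ suc) b n) ⟩
  b (suc n) * a 0 + (b ⊛ (a ∘ suc)) n  ≡⟨ +-comm (b (suc n) * a 0) _ ⟩
  (b ⊛ (a ∘ suc)) n + b (suc n) * a 0  ≡⟨ sym (⊛-sucʳ b a n) ⟩
  (b ⊛ a) (suc n)                      ∎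
  where open ≡-Reasoning

⊛-assoc : ∀ a b c → (a ⊛ b) ⊛ c ≗ a ⊛ (b ⊛ c)
⊛-assoc a b c zero    = eq (a 0) (b 0) (c 0)
  where
  eq : ∀ x y z → (x * y + 0ℚ) * z + 0ℚ ≡ x * (y * z + 0ℚ) + 0ℚ
  eq = solve-∀ ringℚ
⊛-assoc a b c (suc n) = begin
  (a ⊛ b) 0 * c (suc n) + (((a ⊛ b) ∘ suc) ⊛ c) n
    ≡⟨ cong ((a ⊛ b) 0 * c (suc n) +_) (⊛-distribʳ (a 0 · (b ∘ suc)) ((a ∘ suc) ⊛ b) c n) ⟩
  (a ⊛ b) 0 * c (suc n) + (((a 0 · (b ∘ suc)) ⊛ c) n + (((a ∘ suc) ⊛ b) ⊛ c) n)
    ≡⟨ cong ((a ⊛ b) 0 * c (suc n) +_) (cong₂ _+_ (·-⊛ (a 0) (b ∘ suc) c n) (⊛-assoc (a ∘ suc) b c n)) ⟩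
  (a 0 * b 0 + 0ℚ) * c (suc n) + (a 0 * ((b ∘ suc) ⊛ c) n + ((a ∘ suc) ⊛ (b ⊛ c)) n)
    ≡⟨ eq (a 0) (b 0) (c (suc n)) (((b ∘ suc) ⊛ c) n) (((a ∘ suc) ⊛ (b ⊛ c)) n) ⟩
  a 0 * (b 0 * c (suc n) + ((b ∘ suc) ⊛ c) n) + ((a ∘ suc) ⊛ (b ⊛ c)) n ∎
  where
  open ≡-Reasoning
  eq : ∀ x y z w v → (x * y + 0ℚ) * z + (x * w + v) ≡ x * (y * z + w) + v
  eq = solve-∀ ringℚ

⊛-swap : ∀ a b c → a ⊛ (b ⊛ c) ≗ b ⊛ (a ⊛ c)
⊛-swap a b c n = trans (sym (⊛-assoc a b c n)) (trans (⊛-congʳ c (⊛-comm a b) n) (⊛-assoc b a c n))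

⊛-zeroˡ : ∀ a → 0̂ ⊛ a ≗ 0̂
⊛-zeroˡ a n = sum-zero (suc n) (λ i _ → *-zeroˡ (a (n ∸ i)))

⊛-identityˡ : ∀ a → one ⊛ a ≗ a
⊛-identityˡ a zero    = trans (+-identityʳ _) (*-identityˡ (a 0))
⊛-identityˡ a (suc n) = trans (cong₂ _+_ (*-identityˡ (a (suc n))) (⊛-zeroˡ a n)) (+-identityʳ _)

0⊑⊛ : ∀ {a b} → 0̂ ⊑ a → 0̂ ⊑ b → 0̂ ⊑ a ⊛ b
0⊑⊛ h k n = 0≤sum (suc n) (λ i → 0≤* (h i) (k (n ∸ i)))

⊛-monoʳ : ∀ {a a′ b} → 0̂ ⊑ b → a ⊑ a′ → a ⊛ b ⊑ a′ ⊛ b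
⊛-monoʳ 0≤b h n = sum-mono (suc n) (λ i _ → *-monoʳ (0≤b (n ∸ i)) (h i))

⊛-monoˡ : ∀ {a b b′} → 0̂ ⊑ a → b ⊑ b′ → a ⊛ b ⊑ a ⊛ b′
⊛-monoˡ 0≤a h n = sum-mono (suc n) (λ i _ → *-monoˡ (0≤a i) (h (n ∸ i)))

sh-cong : ∀ k {a b} → a ≗ b → sh k a ≗ sh k b
sh-cong zero    h n       = h n
sh-cong (suc k) h zero    = refl
sh-cong (suc k) h (suc n) = sh-cong k h n

sh-mono : ∀ k {a b} → a ⊑ b → sh k a ⊑ sh k b
sh-mono zero    h n       = h n
sh-mono (suc k) h zero    = ≤-refl
sh-mono (suc k) h (suc n) = sh-mono k h n

0⊑sh : ∀ k {a} → 0̂ ⊑ a → 0̂ ⊑ sh k a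
0⊑sh zero    h n       = h n
0⊑sh (suc k) h zero    = ≤-refl
0⊑sh (suc k) h (suc n) = 0⊑sh k h n

sh-⊞ : ∀ k a b → sh k (a ⊞ b) ≗ sh k a ⊞ sh k b
sh-⊞ zero    a b n       = refl
sh-⊞ (suc k) a b zero    = refl
sh-⊞ (suc k) a b (suc n) = sh-⊞ k a b n

sh-· : ∀ k c a → sh k (c · a) ≗ c · sh k a
sh-· zero    c a n       = refl
sh-· (suc k) c a zero    = sym (*-zeroʳ c)
sh-· (suc k) c a (suc n) = sh-· k c a n

sh-sh : ∀ j k a → sh j (sh k a) ≗ sh (j ℕ.+ k) a
sh-sh zero    k a n       = refl
sh-sh (suc j) k a zero    = refl
sh-sh (suc j) k a (suc n) = sh-sh j k a n

sh-swap : ∀ j k a → sh j (sh k a) ≗ sh k (sh j a)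
sh-swap j k a n = trans (sh-sh j k a n) (trans (cong (λ i → sh i a n) (ℕₚ.+-comm j k)) (sym (sh-sh k j a n)))

sh-< : ∀ {k n} a → n ℕ.< k → sh k a n ≡ 0ℚ
sh-< {suc k} {zero}  a _       = refl
sh-< {suc k} {suc n} a (s≤s h) = sh-< a h

sh-≥ : ∀ {k n} a → k ℕ.≤ n → sh k a n ≡ a (n ∸ k)
sh-≥ a z≤n     = refl
sh-≥ a (s≤s h) = sh-≥ a h

sh-⊛ : ∀ k a b → sh k a ⊛ b ≗ sh k (a ⊛ b)
sh-⊛ zero    a b n       = refl
sh-⊛ (suc k) a b zero    = trans (+-identityʳ _) (*-zeroˡ (b 0))
sh-⊛ (suc k) a b (suc n) = trans (cong₂ _+_ (*-zeroˡ (b (suc n))) (sh-⊛ k a b n)) (+-identityˡ _)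

⊛-sh : ∀ k a b → a ⊛ sh k b ≗ sh k (a ⊛ b)
⊛-sh k a b n = trans (⊛-comm a (sh k b) n) (trans (sh-⊛ k b a n) (sh-cong k (⊛-comm b a) n))

-- The equation expresses each coefficient through strictly earlier ones. Identities between
-- geometric series are proved by checking that both sides solve the same equation; the bound `m`
-- carries the strong induction.
fixpoint-unique : ∀ k (w a b : Series) → a ≗ w ⊞ sh (suc k) a → b ≗ w ⊞ sh (suc k) b → a ≗ b
fixpoint-unique k w a b ha hb n = go n n ℕₚ.≤-refl
  where
  go : ∀ m n → n ℕ.≤ m → a n ≡ b n
  shift : ∀ m j n → n ℕ.≤ m → sh (suc j) a n ≡ sh (suc j) b n
  go m n n≤m = trans (ha n) (trans (cong (w n +_) (shift m k n n≤m)) (sym (hb n)))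
  shift m       j       zero    n≤m       = refl
  shift (suc m) zero    (suc n) (s≤s n≤m) = go m n n≤m
  shift (suc m) (suc j) (suc n) (s≤s n≤m) = shift m j n n≤m

θ-⊛ : ∀ a b → θ (a ⊛ b) ≗ θ a ⊛ b ⊞ a ⊛ θ b
θ-⊛ a b n = begin
  ι n * (a ⊛ b) n
    ≡⟨ sym (sum-* (suc n) (ι n) (λ i → a i * b (n ∸ i))) ⟩
  sum (suc n) (λ i → ι n * (a i * b (n ∸ i)))
    ≡⟨ sum-cong (suc n) (λ { i (s≤s i≤n) → term i i≤n }) ⟩
  sum (suc n) (λ i → θ a i * b (n ∸ i) + a i * θ b (n ∸ i))
    ≡⟨ sum-+ (suc n) (λ i → θ a i * b (n ∸ i)) (λ i → a i * θ b (n ∸ i)) ⟩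
  (θ a ⊛ b) n + (a ⊛ θ b) n ∎
  where
  open ≡-Reasoning
  eq : ∀ s t x y → (s + t) * (x * y) ≡ s * x * y + x * (t * y)
  eq = solve-∀ ringℚ
  term : ∀ i → i ℕ.≤ n → ι n * (a i * b (n ∸ i)) ≡ θ a i * b (n ∸ i) + a i * θ b (n ∸ i)
  term i i≤n = trans (cong (λ t → t * (a i * b (n ∸ i)))
                       (trans (cong ι (sym (ℕₚ.m+[n∸m]≡n i≤n))) (ι-+ i (n ∸ i))))
                     (eq (ι i) (ι (n ∸ i)) (a i) (b (n ∸ i)))

θ-sh : ∀ k a → θ (sh k a) ≗ ι k · sh k a ⊞ sh k (θ a)
θ-sh zero    a n       = eq (a n) (ι n * a n)
  where
  eq : ∀ x y → y ≡ 0ℚ * x + y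
  eq = solve-∀ ringℚ
θ-sh (suc k) a zero    = eq (ι (suc k))
  where
  eq : ∀ x → 0ℚ * 0ℚ ≡ x * 0ℚ + 0ℚ
  eq = solve-∀ ringℚ
θ-sh (suc k) a (suc n) = trans (eq (ι n) (sh k a n)) (trans (cong (sh k a n +_) (θ-sh k a n))
                               (eq₂ (ι k) (sh k a n) (sh k (θ a) n)))
  where
  eq : ∀ x y → (1ℚ + x) * y ≡ y + x * y
  eq = solve-∀ ringℚ
  eq₂ : ∀ x y z → y + (x * y + z) ≡ (1ℚ + x) * y + z
  eq₂ = solve-∀ ringℚ

-- As `β 0` vanishes, the equation at n + 1 involves only coefficients up to n on the right and can
-- be divided by n + 1.
logDeriv-unique : ∀ (β a b : Series) → β 0 ≡ 0ℚ → θ a ≗ β ⊛ a → θ b ≗ β ⊛ b → a 0 ≡ b 0 → a ≗ b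
logDeriv-unique β a b β₀ ha hb h₀ n = go n n ℕₚ.≤-refl
  where
  eq : ∀ x y → 0ℚ * x + y ≡ y
  eq = solve-∀ ringℚ
  tail : ∀ (c : Series) n → (β ⊛ c) (suc n) ≡ ((β ∘ suc) ⊛ c) n
  tail c n = trans (cong (λ t → t * c (suc n) + ((β ∘ suc) ⊛ c) n) β₀) (eq (c (suc n)) (((β ∘ suc) ⊛ c) n))
  go : ∀ m n → n ℕ.≤ m → a n ≡ b n
  go m       zero    _         = h₀
  go (suc m) (suc n) (s≤s n≤m) = *-cancelˡ-≡ (0<ι n) (trans (ha (suc n)) (trans (tail a n) (trans
    (⊛-cong≤ {a = β ∘ suc} n (λ _ _ → refl) (λ i i≤n → go m i (ℕₚ.≤-trans i≤n n≤m)))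
    (sym (trans (hb (suc n)) (tail b n))))))

-- Geometric series

sh-cong< : ∀ k {a b} n → (∀ i → i ℕ.< n → a i ≡ b i) → sh (suc k) a n ≡ sh (suc k) b n
sh-cong< k       zero    h = refl
sh-cong< zero    (suc n) h = h n ℕₚ.≤-refl
sh-cong< (suc k) (suc n) h = sh-cong< k n (λ i i<n → h i (ℕₚ.m≤n⇒m≤1+n i<n))

sh-sum : ∀ k N (t : ℕ → Series) n → sh k (λ n → sum N (λ m → t m n)) n ≡ sum N (λ m → sh k (t m) n)
sh-sum zero    N t n       = refl
sh-sum (suc k) N t zero    = sym (sum-0 N)
sh-sum (suc k) N t (suc n) = sh-sum k N t n

geoTerm : ℕ → ℕ → (ℕ → Series) → ℕ → ℕ → Series
geoTerm K e Φ s m = sh (m ℕ.* K) (Φ (s ℕ.+ m ℕ.* e))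

-- The family version of Φ / (1 − y ^ e q ^ K), where y shifts the index s.
Geo : ℕ → ℕ → (ℕ → Series) → ℕ → Series
Geo K e Φ s n = sum (suc n) (λ m → geoTerm K e Φ s m n)

sum-stable : ∀ {m n} {f : ℕ → ℚ} → m ℕ.≤ n → (∀ i → m ℕ.≤ i → f i ≡ 0ℚ) → sum n f ≡ sum m f
sum-stable {m} {n} {f} m≤n h = trans (cong (λ k → sum k f) (sym (ℕₚ.m+[n∸m]≡n m≤n)))
  (trans (sum-split m (n ∸ m) f)
    (trans (cong (sum m f +_) (sum-zero (n ∸ m) (λ i _ → h (m ℕ.+ i) (ℕₚ.m≤m+n m i)))) (+-identityʳ (sum m f))))

Geo-range : ∀ k e Φ s n N → n ℕ.< N → sum N (λ m → geoTerm (suc k) e Φ s m n) ≡ Geo (suc k) e Φ s n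
Geo-range k e Φ s n N n<N = sum-stable n<N
  (λ m n<m → sh-< (Φ (s ℕ.+ m ℕ.* e)) (ℕₚ.<-≤-trans n<m (ℕₚ.m≤m*n m (suc k))))

Geo-fix : ∀ k e Φ s → Geo (suc k) e Φ s ≗ Φ s ⊞ sh (suc k) (Geo (suc k) e Φ (s ℕ.+ e))
Geo-fix k e Φ s n = cong₂ _+_ (cong (λ t → Φ t n) (ℕₚ.+-identityʳ s)) (begin
  sum n (λ m → sh (suc k ℕ.+ m ℕ.* suc k) (Φ (s ℕ.+ (e ℕ.+ m ℕ.* e))) n)
    ≡⟨ sum-congˡ n (λ m → trans (sym (sh-sh (suc k) (m ℕ.* suc k) (Φ (s ℕ.+ (e ℕ.+ m ℕ.* e))) n))
         (cong (λ t → sh (suc k) (sh (m ℕ.* suc k) (Φ t)) n) (sym (ℕₚ.+-assoc s e (m ℕ.* e))))) ⟩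
  sum n (λ m → sh (suc k) (geoTerm (suc k) e Φ (s ℕ.+ e) m) n)
    ≡⟨ sym (sh-sum (suc k) n (geoTerm (suc k) e Φ (s ℕ.+ e)) n) ⟩
  sh (suc k) (λ i → sum n (λ m → geoTerm (suc k) e Φ (s ℕ.+ e) m i)) n
    ≡⟨ sh-cong< k n (λ i i<n → Geo-range k e Φ (s ℕ.+ e) i n i<n) ⟩
  sh (suc k) (Geo (suc k) e Φ (s ℕ.+ e)) n ∎)
  where open ≡-Reasoning

geo : ℕ → Series → Series
geo K a = Geo K 0 (λ _ → a) 0

g : ℕ → Series
g K = geo K one

geo-fix : ∀ k a → geo (suc k) a ≗ a ⊞ sh (suc k) (geo (suc k) a)
geo-fix k a = Geo-fix k 0 (λ _ → a) 0

geo-⊛ : ∀ k a → geo (suc k) a ≗ g (suc k) ⊛ a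
geo-⊛ k a = fixpoint-unique k a (geo (suc k) a) (g (suc k) ⊛ a) (geo-fix k a) λ n →
  trans (⊛-congʳ a (geo-fix k one) n)
    (trans (⊛-distribʳ one (sh (suc k) (g (suc k))) a n)
      (cong₂ _+_ (⊛-identityˡ a n) (sh-⊛ (suc k) (g (suc k)) a n)))

0⊑one : 0̂ ⊑ one
0⊑one zero    = 0≤1
0⊑one (suc n) = ≤-refl

0⊑geo : ∀ K {a} → 0̂ ⊑ a → 0̂ ⊑ geo K a
0⊑geo K h n = 0≤sum (suc n) (λ m → 0⊑sh (m ℕ.* K) h n)

g≤1 : ∀ k → g (suc k) ⊑ I
g≤1 k n = go n n ℕₚ.≤-refl
  where
  go : ∀ m n → n ℕ.≤ m → g (suc k) n ≤ 1ℚ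
  shift : ∀ m j n → n ℕ.≤ m → sh (suc j) (g (suc k)) n ≤ 1ℚ
  go m zero    n≤m = ≤-reflexive (geo-fix k one 0)
  go m (suc n) n≤m = ≤-trans (≤-reflexive (trans (geo-fix k one (suc n)) (+-identityˡ (sh (suc k) (g (suc k)) (suc n))))) (shift m k (suc n) n≤m)
  shift m       j       zero    n≤m       = 0≤1
  shift (suc m) zero    (suc n) (s≤s n≤m) = go m n n≤m
  shift (suc m) (suc j) (suc n) (s≤s n≤m) = shift m j n n≤m

g1≗I : g 1 ≗ I
g1≗I = fixpoint-unique 0 one (g 1) I (geo-fix 0 one) λ { zero → refl ; (suc n) → refl }

-- Logarithmic derivatives of the factors (1 + q ^ K) / (1 − q ^ K)

θ-one : θ one ≗ 0̂
θ-one zero    = *-zeroˡ 1ℚ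
θ-one (suc n) = *-zeroʳ (ι (suc n))

θg : ∀ k → θ (g (suc k)) ≗ ι (suc k) · sh (suc k) (g (suc k) ⊛ g (suc k))
θg k = fixpoint-unique k (ι K · sh K G) (θ G) (ι K · sh K (G ⊛ G)) hθ hX
  where
  K : ℕ
  K = suc k
  G : Series
  G = g K
  hθ : θ G ≗ ι K · sh K G ⊞ sh K (θ G)
  hθ n = trans (cong (ι n *_) (geo-fix k one n)) (trans (*-distribˡ-+ (ι n) (one n) (sh K G n))
    (trans (cong₂ _+_ (θ-one n) (θ-sh K G n)) (+-identityˡ (ι K * sh K G n + sh K (θ G) n))))
  GG : G ⊛ G ≗ G ⊞ sh K (G ⊛ G)
  GG n = trans (⊛-congʳ G (geo-fix k one) n) (trans (⊛-distribʳ one (sh K G) G n)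
    (cong₂ _+_ (⊛-identityˡ G n) (sh-⊛ K G G n)))
  hX : ι K · sh K (G ⊛ G) ≗ ι K · sh K G ⊞ sh K (ι K · sh K (G ⊛ G))
  hX n = trans (cong (ι K *_) (trans (sh-cong K GG n) (sh-⊞ K G (sh K (G ⊛ G)) n)))
    (trans (*-distribˡ-+ (ι K) (sh K G n) (sh K (sh K (G ⊛ G)) n))
      (cong (ι K * sh K G n +_) (sym (sh-· K (ι K) (sh K (G ⊛ G)) n))))

U : ℕ → Series
U K = g K ⊞ sh K (g K)

-- K q^K/(1 + q^K) + K q^K/(1 - q^K) = 2 K q^K/(1 - q^(2K)), the logarithmic derivative of `U K` =
-- (1 + q^K)/(1 - q^K).
lam : ℕ → Series
lam K = (2ℚ * ι K) · sh K (g (K ℕ.+ K))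

g-double : ∀ k → g (suc k) ≗ g (suc k ℕ.+ suc k) ⊞ sh (suc k) (g (suc k ℕ.+ suc k))
g-double k = fixpoint-unique k one (g K) (G₂ ⊞ sh K G₂) (geo-fix k one) λ n → begin
  G₂ n + sh K G₂ n                                  ≡⟨ cong (_+ sh K G₂ n) (geo-fix (k ℕ.+ K) one n) ⟩
  one n + sh (K ℕ.+ K) G₂ n + sh K G₂ n             ≡⟨ cong (λ t → one n + t + sh K G₂ n) (sym (sh-sh K K G₂ n)) ⟩
  one n + sh K (sh K G₂) n + sh K G₂ n              ≡⟨ eq (one n) (sh K (sh K G₂) n) (sh K G₂ n) ⟩
  one n + (sh K G₂ n + sh K (sh K G₂) n)            ≡⟨ cong (one n +_) (sym (sh-⊞ K G₂ (sh K G₂) n)) ⟩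
  one n + sh K (G₂ ⊞ sh K G₂) n                     ∎
  where
  open ≡-Reasoning
  K : ℕ
  K = suc k
  G₂ : Series
  G₂ = g (K ℕ.+ K)
  eq : ∀ x y z → x + y + z ≡ x + (z + y)
  eq = solve-∀ ringℚ

-- U = 2 G - 1, hence θ U = 2 θ G = 2 K q^K G², and G² = G₂ U because G = (1 + q^K) G₂.
θU : ∀ k → θ (U (suc k)) ≗ lam (suc k) ⊛ U (suc k)
θU k n = begin
  ι n * (G n + sh K G n)                     ≡⟨ eq (ι n) (G n) (one n) (sh K G n) ⟩
  ι n * (G n + (one n + sh K G n)) - ι n * one n  ≡⟨ cong₂ (λ s t → ι n * (G n + s) - t) (sym (geo-fix k one n)) (θ-one n) ⟩
  ι n * (G n + G n) - 0ℚ                     ≡⟨ eq₂ (ι n) (G n) ⟩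
  2ℚ * (ι n * G n)                           ≡⟨ cong (2ℚ *_) (θg k n) ⟩
  2ℚ * (ι K * sh K (G ⊛ G) n)                ≡⟨ sym (*-assoc 2ℚ (ι K) _) ⟩
  2ℚ * ι K * sh K (G ⊛ G) n                  ≡⟨ cong (2ℚ * ι K *_) (sh-cong K GG n) ⟩
  2ℚ * ι K * sh K (G₂ ⊛ U K) n               ≡⟨ cong (2ℚ * ι K *_) (sym (sh-⊛ K G₂ (U K) n)) ⟩
  2ℚ * ι K * (sh K G₂ ⊛ U K) n               ≡⟨ sym (·-⊛ (2ℚ * ι K) (sh K G₂) (U K) n) ⟩
  (lam K ⊛ U K) n                            ∎
  where
  open ≡-Reasoning
  K : ℕ
  K = suc k
  G G₂ : Series
  G = g K
  G₂ = g (K ℕ.+ K)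
  eq : ∀ t x y z → t * (x + z) ≡ t * (x + (y + z)) - t * y
  eq = solve-∀ ringℚ
  eq₂ : ∀ t x → t * (x + x) - 0ℚ ≡ 2ℚ * (t * x)
  eq₂ = solve-∀ ringℚ
  GG : G ⊛ G ≗ G₂ ⊛ U K
  GG m = trans (⊛-congʳ G (g-double k) m) (trans (⊛-distribʳ G₂ (sh K G₂) G m)
    (trans (cong ((G₂ ⊛ G) m +_) (trans (sh-⊛ K G₂ G m) (sym (⊛-sh K G₂ G m))))
      (sym (⊛-distribˡ G₂ G (sh K G) m))))

0⊑U : ∀ K → 0̂ ⊑ U K
0⊑U K n = 0≤+ (0⊑geo K 0⊑one n) (0⊑sh K (0⊑geo K 0⊑one) n)

-- SubLog β H: the logarithmic derivative of H is at most β.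
SubLog : Series → Series → Set
SubLog β H = θ H ⊑ β ⊛ H

SubLog-⊛ : ∀ {β γ a b} → 0̂ ⊑ a → 0̂ ⊑ b → SubLog β a → SubLog γ b → SubLog (β ⊞ γ) (a ⊛ b)
SubLog-⊛ {β} {γ} {a} {b} 0≤a 0≤b ha hb n = subst₂ _≤_ (sym (θ-⊛ a b n)) eq
  (+-mono-≤ (⊛-monoʳ 0≤b ha n) (⊛-monoˡ 0≤a hb n))
  where
  eq : ((β ⊛ a) ⊛ b) n + (a ⊛ (γ ⊛ b)) n ≡ ((β ⊞ γ) ⊛ (a ⊛ b)) n
  eq = trans (cong₂ _+_ (⊛-assoc β a b n) (⊛-swap a γ b n)) (sym (⊛-distribʳ β γ (a ⊛ b) n))

SubLog-mono : ∀ {β γ H} → 0̂ ⊑ H → β ⊑ γ → SubLog β H → SubLog γ H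
SubLog-mono 0≤H h k = ⊑-trans k (⊛-monoʳ 0≤H h)

-- Divisor sums for the logarithmic derivative

δ : ℕ → Series
δ m = sh m one

0⊑δ : ∀ m → 0̂ ⊑ δ m
0⊑δ m = 0⊑sh m 0⊑one

ι-δ : ∀ m n → ι m * δ m n ≡ ι n * δ m n
ι-δ m n = sym (trans (θ-sh m one n) (trans (cong (ι m * δ m n +_) (z m n)) (+-identityʳ (ι m * δ m n))))
  where
  z : ∀ m n → sh m (θ one) n ≡ 0ℚ
  z m n = trans (sh-cong m θ-one n) (0sh m n)
    where
    0sh : ∀ m n → sh m 0̂ n ≡ 0ℚ
    0sh zero    n       = refl
    0sh (suc m) zero    = refl
    0sh (suc m) (suc n) = 0sh m n

od : ℕ → ℕ
od i = suc (i ℕ.+ i)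

expo : ℕ → ℕ → ℕ
expo i j = suc j ℕ.* od i

-- The share of a factorisation n = K d with K = j + 1 and d = 2 i + 1. The indicator `δ` lets
-- divisor sums run over full rectangles, where they can be extended, truncated and interchanged
-- freely.
bTerm : ℕ → ℕ → Series
bTerm i j n = 2ℚ * ι (suc j) * δ (expo i j) n

i<expo : ∀ i j → i ℕ.< expo i j
i<expo i j = ℕₚ.≤-trans (s≤s (ℕₚ.m≤m+n i i)) (ℕₚ.m≤n*m (od i) (suc j))

j<expo : ∀ i j → j ℕ.< expo i j
j<expo i j = ℕₚ.m≤m*n (suc j) (od i)

bTerm-i : ∀ {n} i j → n ℕ.≤ i → bTerm i j n ≡ 0ℚ
bTerm-i {n} i j n≤i = trans (cong (2ℚ * ι (suc j) *_) (sh-< one (ℕₚ.≤-<-trans n≤i (i<expo i j)))) (*-zeroʳ (2ℚ * ι (suc j)))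

bTerm-j : ∀ {n} i j → n ℕ.≤ j → bTerm i j n ≡ 0ℚ
bTerm-j {n} i j n≤j = trans (cong (2ℚ * ι (suc j) *_) (sh-< one (ℕₚ.≤-<-trans n≤j (j<expo i j)))) (*-zeroʳ (2ℚ * ι (suc j)))

0≤bTerm : ∀ i j n → 0ℚ ≤ bTerm i j n
0≤bTerm i j n = 0≤* (0≤* (0≤nat 2) (0≤ι (suc j))) (0⊑δ (expo i j) n)

lam-δ : ∀ j n → lam (suc j) n ≡ sum n (λ i → bTerm i j n)
lam-δ j n = begin
  2ℚ * ι K * sh K (g (K ℕ.+ K)) n
    ≡⟨ cong (2ℚ * ι K *_) (sh-cong< j n (λ i i<n → sym (Geo-range (j ℕ.+ K) 0 (λ _ → one) 0 i n i<n))) ⟩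
  2ℚ * ι K * sh K (λ i → sum n (λ m → geoTerm (K ℕ.+ K) 0 (λ _ → one) 0 m i)) n
    ≡⟨ cong (2ℚ * ι K *_) (sh-sum K n (geoTerm (K ℕ.+ K) 0 (λ _ → one) 0) n) ⟩
  2ℚ * ι K * sum n (λ m → sh K (sh (m ℕ.* (K ℕ.+ K)) one) n)
    ≡⟨ sym (sum-* n (2ℚ * ι K) (λ m → sh K (sh (m ℕ.* (K ℕ.+ K)) one) n)) ⟩
  sum n (λ m → 2ℚ * ι K * sh K (sh (m ℕ.* (K ℕ.+ K)) one) n)
    ≡⟨ sum-congˡ n (λ m → cong (2ℚ * ι K *_) (trans (sh-sh K (m ℕ.* (K ℕ.+ K)) one n) (cong (λ t → δ t n) (arith m)))) ⟩
  sum n (λ m → bTerm m j n) ∎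
  where
  open ≡-Reasoning
  K : ℕ
  K = suc j
  arith : ∀ m → K ℕ.+ m ℕ.* (K ℕ.+ K) ≡ K ℕ.* od m
  arith m = trans (cong (K ℕ.+_) (trans (ℕₚ.*-distribˡ-+ m K K) (trans (cong₂ ℕ._+_ (ℕₚ.*-comm m K) (ℕₚ.*-comm m K))
    (sym (ℕₚ.*-distribˡ-+ K m m))))) (sym (ℕₚ.*-suc K (m ℕ.+ m)))

beta : ℕ → Series
beta zero    = 0̂
beta (suc k) = lam (suc k) ⊞ beta k

-- The logarithmic derivative of the overpartition generating function, Σ_{K (2 i + 1) = n} 2 K.
b : Series
b n = sum n (λ i → sum n (λ j → bTerm i j n))

beta-sum : ∀ k n → beta k n ≡ sum k (λ j → lam (suc j) n)
beta-sum zero    n = refl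
beta-sum (suc k) n = trans (cong (lam (suc k) n +_) (beta-sum k n))
  (trans (+-comm (lam (suc k) n) (sum k (λ j → lam (suc j) n))) (sym (sum-last k (λ j → lam (suc j) n))))

beta-double : ∀ k n → beta k n ≡ sum n (λ i → sum k (λ j → bTerm i j n))
beta-double k n = trans (beta-sum k n) (trans (sum-congˡ k (λ j → lam-δ j n)) (sum-swap k n (λ j i → bTerm i j n)))

beta≥ : ∀ {k n} → n ℕ.≤ k → beta k n ≡ b n
beta≥ {k} {n} n≤k = trans (beta-double k n) (sum-congˡ n (λ i → sum-stable n≤k (λ j n≤j → bTerm-j i j n≤j)))

beta≤b : ∀ k → beta k ⊑ b
beta≤b k n with ℕₚ.≤-total k n
... | inj₁ k≤n = ≤-trans (≤-reflexive (beta-double k n)) (sum-mono n (λ i _ → sum-mono-range (λ j → 0≤bTerm i j n) k≤n))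
... | inj₂ n≤k = ≤-reflexive (beta≥ n≤k)

-- A square-root bound for the divisor sums

harm : ℕ → ℚ
harm n = sum n (λ i → inv (ι (suc i)))

0≤harm : ∀ n → 0ℚ ≤ harm n
0≤harm n = 0≤sum n (λ i → 0≤inv (0<ι i))

harm-mono : ∀ {m n} → m ℕ.≤ n → harm m ≤ harm n
harm-mono = sum-mono-range (λ i → 0≤inv (0<ι i))

inv≤1 : ∀ i → inv (ι (suc i)) ≤ 1ℚ
inv≤1 i = *-cancelˡ (0<ι i) (subst₂ _≤_ (sym (*-inv (0<ι i))) (sym (*-identityʳ (ι (suc i)))) (1≤ι i))

-- Stands in for the logarithmic bound: all that is needed is growth slower than n. The square grows
-- by 2 h e + e² ≤ 3 per step, since h ≤ n + 1 and e = 1/(n + 1).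
harm² : ∀ n → harm n * harm n ≤ 3ℚ * ι n
harm² zero    = ≤ᵇ⇒≤ _
harm² (suc n) = subst (λ h → h * h ≤ 3ℚ * (1ℚ + ι n)) (sym (sum-last n (λ i → inv (ι (suc i))))) (begin
  (h + e) * (h + e)             ≡⟨ eq h e ⟩
  h * h + 2ℚ * (h * e) + e * e  ≤⟨ +-mono-≤ (+-mono-≤ (harm² n) (*-monoˡ (0≤nat 2) he≤1)) e²≤1 ⟩
  3ℚ * ι n + 2ℚ * 1ℚ + 1ℚ       ≡⟨ eq₂ (ι n) ⟩
  3ℚ * (1ℚ + ι n)               ∎)
  where
  open ≤-Reasoning
  h e : ℚ
  h = harm n
  e = inv (ι (suc n))
  0≤e : 0ℚ ≤ e
  0≤e = 0≤inv (0<ι n)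
  e²≤1 : e * e ≤ 1ℚ
  e²≤1 = *-mono {s = 1ℚ} 0≤e 0≤1 (inv≤1 n) (inv≤1 n)
  h≤ : h ≤ ι (suc n)
  h≤ = ≤-trans (≤-trans (sum-mono n {g = I} (λ i _ → inv≤1 i)) (≤-reflexive (sum-I n))) (p≤q+p 0≤1)
  he≤1 : h * e ≤ 1ℚ
  he≤1 = ≤-trans (*-monoʳ 0≤e h≤) (≤-reflexive (*-inv (0<ι n)))
  eq : ∀ x y → (x + y) * (x + y) ≡ x * x + 2ℚ * (x * y) + y * y
  eq = solve-∀ ringℚ
  eq₂ : ∀ x → 3ℚ * x + 2ℚ * 1ℚ + 1ℚ ≡ 3ℚ * (1ℚ + x)
  eq₂ = solve-∀ ringℚ

-- At most one multiple of the odd number equals n; here read off from the coefficients of 1/(1 -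
-- q^d).
δ-sum≤1 : ∀ N i n → sum N (λ j → δ (expo i j) n) ≤ 1ℚ
δ-sum≤1 N i n = begin
  sum N (λ j → δ (suc j ℕ.* od i) n)        ≤⟨ p≤q+p (0⊑one n) ⟩
  sum (suc N) (λ j → δ (j ℕ.* od i) n)      ≤⟨ sum-mono-range (λ j → 0⊑δ (j ℕ.* od i) n) (ℕₚ.m≤m+n (suc N) (suc n)) ⟩
  sum (suc N ℕ.+ suc n) (λ j → δ (j ℕ.* od i) n) ≡⟨ Geo-range (i ℕ.+ i) 0 (λ _ → one) 0 n (suc N ℕ.+ suc n) (ℕₚ.m≤n+m (suc n) (suc N)) ⟩
  g (od i) n                                ≤⟨ g≤1 (i ℕ.+ i) n ⟩
  1ℚ ∎
  where open ≤-Reasoning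

row≤ : ∀ N i n → sum N (λ j → bTerm i j n) ≤ 2ℚ * ι n * inv (ι (suc i))
row≤ N i n = *-cancelˡ (0<ι i) (begin
  ι (suc i) * sum N (λ j → bTerm i j n)     ≤⟨ *-monoʳ (0≤sum N (λ j → 0≤bTerm i j n)) (ι-mono (s≤s (ℕₚ.m≤m+n i i))) ⟩
  ι (od i) * sum N (λ j → bTerm i j n)      ≡⟨ sym (sum-* N (ι (od i)) (λ j → bTerm i j n)) ⟩
  sum N (λ j → ι (od i) * bTerm i j n)      ≡⟨ sum-congˡ N term ⟩
  sum N (λ j → 2ℚ * ι n * δ (expo i j) n)   ≡⟨ sum-* N (2ℚ * ι n) (λ j → δ (expo i j) n) ⟩
  2ℚ * ι n * sum N (λ j → δ (expo i j) n)   ≤⟨ *-monoˡ (0≤* (0≤nat 2) (0≤ι n)) (δ-sum≤1 N i n) ⟩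
  2ℚ * ι n * 1ℚ                             ≡⟨ cong (2ℚ * ι n *_) (sym (*-inv (0<ι i))) ⟩
  2ℚ * ι n * (ι (suc i) * inv (ι (suc i)))  ≡⟨ eq₂ (2ℚ * ι n) (ι (suc i)) (inv (ι (suc i))) ⟩
  ι (suc i) * (2ℚ * ι n * inv (ι (suc i)))  ∎)
  where
  open ≤-Reasoning
  eq : ∀ x y z → x * (2ℚ * y * z) ≡ 2ℚ * (y * x * z)
  eq = solve-∀ ringℚ
  eq₂ : ∀ x y z → x * (y * z) ≡ y * (x * z)
  eq₂ = solve-∀ ringℚ
  term : ∀ j → ι (od i) * bTerm i j n ≡ 2ℚ * ι n * δ (expo i j) n
  term j = trans (eq (ι (od i)) (ι (suc j)) (δ (expo i j) n))
    (trans (cong (2ℚ *_) (trans (cong (_* δ (expo i j) n) (sym (ι-* (suc j) (od i)))) (ι-δ (expo i j) n))) (sym (*-assoc 2ℚ (ι n) (δ (expo i j) n))))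

b≤harm : ∀ n → b n ≤ 2ℚ * ι n * harm n
b≤harm n = ≤-trans (sum-mono n (λ i _ → row≤ n i n)) (≤-reflexive (sum-* n (2ℚ * ι n) (λ i → inv (ι (suc i)))))

-- A series whose logarithmic derivative is at most b is small compared with its iterated partial sums.

0⊑I : 0̂ ⊑ I
0⊑I n = 0≤1

qI : Series
qI = sh 1 I

I⊛-suc : ∀ a n → (I ⊛ a) (suc n) ≡ a (suc n) + (I ⊛ a) n
I⊛-suc a n = cong (_+ (I ⊛ a) n) (*-identityˡ (a (suc n)))

I⊛-mono : ∀ {a} → 0̂ ⊑ a → ∀ {m n} → m ℕ.≤ n → (I ⊛ a) m ≤ (I ⊛ a) n
I⊛-mono {a} 0≤a = Monotone-≤ {I ⊛ a} λ n → ≤-trans (p≤q+p (0≤a (suc n))) (≤-reflexive (sym (I⊛-suc a n)))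

II : ∀ n → (I ⊛ I) n ≡ ι (suc n)
II zero    = refl
II (suc n) = trans (I⊛-suc I n) (cong (1ℚ +_) (II n))

ι≗ : ι ≗ sh 1 (I ⊛ I)
ι≗ zero    = refl
ι≗ (suc n) = sym (II n)

ι⊛ : ∀ a → ι ⊛ a ≗ sh 1 (I ⊛ (I ⊛ a))
ι⊛ a n = trans (⊛-congʳ a ι≗ n) (trans (sh-⊛ 1 (I ⊛ I) a n) (sh-cong 1 (⊛-assoc I I a) n))

θI : SubLog qI I
θI n = ≤-reflexive (trans (*-identityʳ (ι n)) (trans (ι≗ n) (sym (sh-⊛ 1 I I n))))

ι⊛≤ : ∀ {a} → 0̂ ⊑ a → ι ⊛ a ⊑ I ⊛ (I ⊛ a)
ι⊛≤ {a} 0≤a n = ≤-trans (≤-reflexive (ι⊛ a n)) (lem n)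
  where
  lem : sh 1 (I ⊛ (I ⊛ a)) ⊑ I ⊛ (I ⊛ a)
  lem zero    = 0⊑⊛ {I} {I ⊛ a} 0⊑I (0⊑⊛ {I} {a} 0⊑I 0≤a) 0
  lem (suc n) = I⊛-mono (0⊑⊛ {I} {a} 0⊑I 0≤a) (ℕₚ.n≤1+n n)

I^ : ℕ → Series → Series
I^ zero    a = a
I^ (suc s) a = I ⊛ I^ s a

0⊑I^ : ∀ s {a} → 0̂ ⊑ a → 0̂ ⊑ I^ s a
0⊑I^ zero    h = h
0⊑I^ (suc s) h = 0⊑⊛ {I} {I^ s _} 0⊑I (0⊑I^ s h)

SubLog-I^ : ∀ s {H} → 0̂ ⊑ H → SubLog b H → SubLog (b ⊞ ι s · qI) (I^ s H)
SubLog-I^ zero    {H} 0≤H h = SubLog-mono {b} {b ⊞ ι 0 · qI} {H} 0≤H (λ n → p≤p+q (≤-reflexive (sym (*-zeroˡ (qI n))))) h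
SubLog-I^ (suc s) {H} 0≤H h = SubLog-mono {qI ⊞ (b ⊞ ι s · qI)} {b ⊞ ι (suc s) · qI} {I ⊛ I^ s H}
  (0⊑I^ (suc s) 0≤H) (λ n → ≤-reflexive (eq (qI n) (b n) (ι s)))
  (SubLog-⊛ {qI} {b ⊞ ι s · qI} {I} {I^ s H} 0⊑I (0⊑I^ s 0≤H) θI (SubLog-I^ s 0≤H h))
  where
  eq : ∀ x y z → x + (y + z * x) ≡ y + (1ℚ + z) * x
  eq = solve-∀ ringℚ

-- Up to index n the logarithmic derivative is at most (2 `harm n` + s) times `ι`, and `ι` is the
-- series q/(1 - q)². A factor n is thus exchanged for two partial summations at a cost of O(√n).
smooth-step : ∀ s {H} → 0̂ ⊑ H → SubLog b H → ∀ n →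
              ι n * I^ s H n ≤ (2ℚ * harm n + ι s) * I^ (2 ℕ.+ s) H n
smooth-step s {H} 0≤H h n = begin
  ι n * J n                                       ≤⟨ SubLog-I^ s 0≤H h n ⟩
  ((b ⊞ ι s · qI) ⊛ J) n                          ≤⟨ sum-mono (suc n) (λ { i (s≤s i≤n) → *-monoʳ (0≤J (n ∸ i)) (coef i i≤n) }) ⟩
  (((2ℚ * harm n + ι s) · ι) ⊛ J) n               ≡⟨ ·-⊛ (2ℚ * harm n + ι s) ι J n ⟩
  (2ℚ * harm n + ι s) * (ι ⊛ J) n                 ≤⟨ *-monoˡ (0≤+ (0≤* (0≤nat 2) (0≤harm n)) (0≤ι s)) (ι⊛≤ 0≤J n) ⟩
  (2ℚ * harm n + ι s) * (I ⊛ (I ⊛ J)) n           ∎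
  where
  open ≤-Reasoning
  J : Series
  J = I^ s H
  0≤J : 0̂ ⊑ J
  0≤J = 0⊑I^ s 0≤H
  qI≤ : ∀ i → qI i ≤ ι i
  qI≤ zero    = ≤-refl
  qI≤ (suc i) = 1≤ι i
  eq : ∀ x y z → 2ℚ * x * y + z * x ≡ (2ℚ * y + z) * x
  eq = solve-∀ ringℚ
  coef : ∀ i → i ℕ.≤ n → b i + ι s * qI i ≤ (2ℚ * harm n + ι s) * ι i
  coef i i≤n = ≤-trans (+-mono-≤ (≤-trans (b≤harm i) (*-monoˡ (0≤* (0≤nat 2) (0≤ι i)) (harm-mono i≤n))) (*-monoˡ (0≤ι s) (qI≤ i)))
    (≤-reflexive (eq (ι i) (harm n) (ι s)))

cube : ℚ → ℚ
cube x = x * x * x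

0≤cube : ∀ {x} → 0ℚ ≤ x → 0ℚ ≤ cube x
0≤cube h = 0≤* (0≤* h h) h

cube-mono : ∀ {x y} → 0ℚ ≤ x → x ≤ y → cube x ≤ cube y
cube-mono 0≤x h = *-mono (0≤* 0≤x 0≤x) (≤-trans 0≤x h) (*-mono 0≤x (≤-trans 0≤x h) h h) h

12ℚ 312ℚ : ℚ
12ℚ = nat 12
312ℚ = nat 312

-- Six applications of `smooth-step` give n⁶ H ≤ L⁶ I¹² H, and L² ≤ 312 n turns L⁶ into a multiple
-- of n³.
smoothing : ∀ {H} → 0̂ ⊑ H → SubLog b H → ∀ n → cube (ι n) * H n ≤ cube 312ℚ * I^ 12 H n
smoothing {H} 0≤H h zero = ≤-trans (≤-reflexive (trans (cong (_* H 0) (refl {x = 0ℚ})) (*-zeroˡ (H 0))))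
  (0≤* (0≤cube (0≤nat 312)) (0⊑I^ 12 0≤H 0))
smoothing {H} 0≤H h n@(suc m) = *-cancelˡ (0<* (0<* 0<x 0<x) 0<x) (begin
  cube x * (cube x * H n)                                 ≡⟨ eq₁ x (H n) ⟩
  x * (x * (x * (x * (x * (x * J 0)))))                   ≤⟨ chain ⟩
  L * (L * (L * (L * (L * (L * J 12)))))                  ≡⟨ eq₂ L (J 12) ⟩
  cube (L * L) * J 12                                     ≤⟨ *-monoʳ (0≤J 12) (cube-mono (0≤* 0≤L 0≤L) L²≤) ⟩
  cube (312ℚ * x) * J 12                                  ≡⟨ eq₃ 312ℚ x (J 12) ⟩
  cube x * (cube 312ℚ * J 12)                             ∎)
  where
  open ≤-Reasoning
  x L : ℚ
  x = ι n
  L = 2ℚ * harm n + 12ℚ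
  J : ℕ → ℚ
  J s = I^ s H n
  0<x : 0ℚ < x
  0<x = 0<ι m
  0≤x : 0ℚ ≤ x
  0≤x = <⇒≤ 0<x
  0≤L : 0ℚ ≤ L
  0≤L = 0≤+ (0≤* (0≤nat 2) (0≤harm n)) (0≤nat 12)
  0≤J : ∀ s → 0ℚ ≤ J s
  0≤J s = 0⊑I^ s 0≤H n
  step : ∀ s → ι s ≤ 12ℚ → x * J s ≤ L * J (2 ℕ.+ s)
  step s s≤ = ≤-trans (smooth-step s 0≤H h n) (*-monoʳ (0≤J (2 ℕ.+ s)) (+-monoʳ-≤ (2ℚ * harm n) s≤))
  eq₁ : ∀ x h → x * x * x * (x * x * x * h) ≡ x * (x * (x * (x * (x * (x * h)))))
  eq₁ = solve-∀ ringℚ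
  eq₂ : ∀ x h → x * (x * (x * (x * (x * (x * h))))) ≡ (x * x) * (x * x) * (x * x) * h
  eq₂ = solve-∀ ringℚ
  eq₃ : ∀ c x h → c * x * (c * x) * (c * x) * h ≡ x * x * x * (c * c * c * h)
  eq₃ = solve-∀ ringℚ
  comm : ∀ x y z → x * (y * z) ≡ y * (x * z)
  comm = solve-∀ ringℚ
  ind : ∀ s → ι s ≤ 12ℚ → ∀ {P Q : ℚ} → P ≤ Q * J s → 0ℚ ≤ Q → x * P ≤ Q * L * J (2 ℕ.+ s)
  ind s s≤ {P} {Q} k 0≤Q = ≤-trans (*-monoˡ 0≤x k) (≤-trans (≤-reflexive (comm x Q (J s)))
    (≤-trans (*-monoˡ 0≤Q (step s s≤)) (≤-reflexive (sym (*-assoc Q L (J (2 ℕ.+ s)))))))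
  0≤L² = 0≤* 0≤L 0≤L
  0≤L³ = 0≤* 0≤L² 0≤L
  0≤L⁴ = 0≤* 0≤L³ 0≤L
  0≤L⁵ = 0≤* 0≤L⁴ 0≤L
  eq₄ : ∀ l j → l * l * l * l * l * l * j ≡ l * (l * (l * (l * (l * (l * j)))))
  eq₄ = solve-∀ ringℚ
  chain : x * (x * (x * (x * (x * (x * J 0))))) ≤ L * (L * (L * (L * (L * (L * J 12)))))
  chain = ≤-trans (ind 10 (≤ᵇ⇒≤ _) (ind 8 (≤ᵇ⇒≤ _) (ind 6 (≤ᵇ⇒≤ _) (ind 4 (≤ᵇ⇒≤ _) (ind 2 (≤ᵇ⇒≤ _) (step 0 (≤ᵇ⇒≤ _)) 0≤L) 0≤L²) 0≤L³) 0≤L⁴) 0≤L⁵)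
    (≤-reflexive (eq₄ L (J 12)))
  -- (2 h + 12)² ≤ 8 h² + 288 ≤ 24 n + 288 n.
  L²≤ : L * L ≤ 312ℚ * x
  L²≤ = ≤-by (eq₅ (harm n) x) (0≤+ (0≤+ (0≤□ (2ℚ * harm n - 12ℚ)) (0≤* (0≤nat 8) (p≤q⇒0≤q-p (harm² n)))) (0≤* (0≤nat 288) (p≤q⇒0≤q-p (1≤ι m))))
    where
    eq₅ : ∀ h x → 312ℚ * x - (2ℚ * h + 12ℚ) * (2ℚ * h + 12ℚ) ≡
          (2ℚ * h - 12ℚ) * (2ℚ * h - 12ℚ) + nat 8 * (3ℚ * x - h * h) + nat 288 * (x - 1ℚ)
    eq₅ = solve-∀ ringℚ

-- The coefficients of exp (2 q / (1 − q))

-- Computation modulo a relation: `c` is the cofactor of `p = q`, so that the identity left to the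
-- ring solver holds unconditionally.
modulo : ∀ {X Y c p q : ℚ} → X ≡ Y + c * (p - q) → p ≡ q → X ≡ Y
modulo {X} {Y} {c} {p} {q} h p≡q = trans h (trans (cong (λ t → Y + c * (t - q)) p≡q) (eq Y c q))
  where
  eq : ∀ Y c q → Y + c * (q - q) ≡ Y
  eq = solve-∀ ringℚ

-- `y` and `z` are the first and second differences of `ℓ`. For L = exp (2 q/(1 - q)) the equation
-- (1 - q)² L′ = 2 L reads (n + 2) z n = 2 ℓ n; starting from the differences makes positivity
-- immediate, and `θℓ` recovers the exponential.
ℓ y z : ℕ → ℚ
ℓ zero    = 1ℚ
ℓ (suc n) = ℓ n + y n
y zero    = 1ℚ
y (suc n) = y n + z n
z n       = 2ℚ * ℓ n * inv (ι (2 ℕ.+ n))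

pp : ℕ → ℚ
pp n = ι (2 ℕ.+ n)

0<pp : ∀ n → 0ℚ < pp n
0<pp n = 0<ι (suc n)

0≤pp : ∀ n → 0ℚ ≤ pp n
0≤pp n = <⇒≤ (0<pp n)

2≤pp : ∀ n → 2ℚ ≤ pp n
2≤pp n = ι-mono {2} {2 ℕ.+ n} (s≤s (s≤s z≤n))

pz : ∀ n → pp n * z n ≡ 2ℚ * ℓ n
pz n = trans (eq (pp n) (2ℚ * ℓ n) (inv (pp n))) (trans (cong (2ℚ * ℓ n *_) (*-inv (0<pp n))) (*-identityʳ (2ℚ * ℓ n)))
  where
  eq : ∀ x y z → x * (y * z) ≡ y * (x * z)
  eq = solve-∀ ringℚ

0<ℓ : ∀ n → 0ℚ < ℓ n
0<y : ∀ n → 0ℚ < y n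
0≤z : ∀ n → 0ℚ ≤ z n
0<ℓ zero    = positive⁻¹ 1ℚ
0<ℓ (suc n) = 0<+ (0<ℓ n) (<⇒≤ (0<y n))
0<y zero    = positive⁻¹ 1ℚ
0<y (suc n) = 0<+ (0<y n) (0≤z n)
0≤z n       = 0≤* (0≤* (0≤nat 2) (<⇒≤ (0<ℓ n))) (0≤inv (0<pp n))

0≤ℓ : ∀ n → 0ℚ ≤ ℓ n
0≤ℓ n = <⇒≤ (0<ℓ n)

0≤y : ∀ n → 0ℚ ≤ y n
0≤y n = <⇒≤ (0<y n)

y≤ℓ : ∀ n → y n ≤ ℓ n
y≤ℓ zero    = ≤-refl
y≤ℓ (suc n) = ≤-by (eq (ℓ n) (y n) (z n)) (p≤q⇒0≤q-p (*-cancelˡ (0<pp n)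
  (subst (_≤ pp n * ℓ n) (sym (pz n)) (*-monoʳ (0≤ℓ n) (2≤pp n)))))
  where
  eq : ∀ l y z → l + y - (y + z) ≡ l - z
  eq = solve-∀ ringℚ

-- The Turán determinant ℓ (n + 1)² − ℓ n ℓ (n + 2).
T : ℕ → ℚ
T n = y n * y n - ℓ n * z n

pT : ∀ n → pp n * T n ≡ pp n * (y n * y n) - 2ℚ * (ℓ n * ℓ n)
pT n = modulo {c = - ℓ n} (eq (pp n) (y n) (ℓ n) (z n)) (pz n)
  where
  eq : ∀ p y l z → p * (y * y - l * z) ≡ p * (y * y) - 2ℚ * (l * l) + (- l) * (p * z - 2ℚ * l)
  eq = solve-∀ ringℚ

-- The source of all estimates of the curvature: no term on the right is negative, so log-concavity
-- and the two-sided bounds on `T` follow by induction.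
T-rec : ∀ n → pp (suc n) * T (suc n) ≡ ι n * T n + y (suc n) * y (suc n)
T-rec n = trans (pT (suc n)) (modulo {c = 2ℚ * y n + z n + ℓ n} (eq (ι n) (ℓ n) (y n) (z n)) (pz n))
  where
  eq : ∀ n l y z → (1ℚ + (1ℚ + (1ℚ + n))) * ((y + z) * (y + z)) - 2ℚ * ((l + y) * (l + y)) ≡
       n * (y * y - l * z) + (y + z) * (y + z) + (2ℚ * y + z + l) * ((1ℚ + (1ℚ + n)) * z - 2ℚ * l)
  eq = solve-∀ ringℚ

0≤T : ∀ n → 0ℚ ≤ T n
0≤T n = *-cancelˡ (0<pp n) (subst (_≤ pp n * T n) (sym (*-zeroʳ (pp n))) (go n))
  where
  go : ∀ n → 0ℚ ≤ pp n * T n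
  go zero    = ≤ᵇ⇒≤ _
  go (suc n) = subst (0ℚ ≤_) (sym (T-rec n)) (0≤+ (0≤* (0≤ι n) (0≤T n)) (0≤□ (y (suc n))))

T-crude : ∀ n → pp n * T n ≤ y n * ℓ (suc n)
T-crude zero    = ≤ᵇ⇒≤ _
T-crude (suc n) = begin
  pp (suc n) * T (suc n)                       ≡⟨ T-rec n ⟩
  ι n * T n + y (suc n) * y (suc n)            ≤⟨ +-monoˡ-≤ (y (suc n) * y (suc n)) (*-monoʳ (0≤T n) (ι-mono (ℕₚ.m≤n+m n 2))) ⟩
  pp n * T n + y (suc n) * y (suc n)           ≤⟨ +-monoˡ-≤ (y (suc n) * y (suc n)) (T-crude n) ⟩
  y n * ℓ (suc n) + y (suc n) * y (suc n)      ≤⟨ +-monoˡ-≤ (y (suc n) * y (suc n)) (*-monoʳ (0≤ℓ (suc n)) (p≤p+q {y n} (0≤z n))) ⟩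
  y (suc n) * ℓ (suc n) + y (suc n) * y (suc n) ≡⟨ sym (*-distribˡ-+ (y (suc n)) (ℓ (suc n)) (y (suc n))) ⟩
  y (suc n) * ℓ (2 ℕ.+ n)                      ∎
  where open ≤-Reasoning

-- F n = 2 (n + 2) T n − y n ℓ n increases, because F (n + 1) − F n = z n (2 y (n + 1) + y n) − 3 T n.
T-lower : ∀ n → y (suc n) * ℓ (suc n) ≤ 2ℚ * (pp (suc n) * T (suc n))
T-lower zero    = ≤ᵇ⇒≤ _
T-lower (suc m) = ≤-by step (0≤+ (p≤q⇒0≤q-p (T-lower m)) (p≤q⇒0≤q-p 3T≤))
  where
  n : ℕ
  n = suc m
  poly : ∀ n t l y z → 2ℚ * (n * t + (y + z) * (y + z)) - (y + z) * (l + y) ≡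
         2ℚ * ((1ℚ + (1ℚ + n)) * t) - y * l + (z * (3ℚ * y + 2ℚ * z) - 3ℚ * t) + ((y * y - l * z) - t)
  poly = solve-∀ ringℚ
  step : 2ℚ * (pp (suc n) * T (suc n)) - y (suc n) * ℓ (suc n) ≡
         2ℚ * (pp n * T n) - y n * ℓ n + (z n * (3ℚ * y n + 2ℚ * z n) - 3ℚ * T n)
  step = trans (cong (λ t → 2ℚ * t - y (suc n) * ℓ (suc n)) (T-rec n))
    (trans (poly (ι n) (T n) (ℓ n) (y n) (z n)) (trans (cong (lhs +_) (+-inverseʳ (T n))) (+-identityʳ lhs)))
    where
    lhs : ℚ
    lhs = 2ℚ * (pp n * T n) - y n * ℓ n + (z n * (3ℚ * y n + 2ℚ * z n) - 3ℚ * T n)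
  p3T≤ : pp n * (3ℚ * T n) ≤ pp n * (z n * (3ℚ * y n + 2ℚ * z n))
  p3T≤ = begin
    pp n * (3ℚ * T n)                       ≡⟨ e₁ (pp n) (T n) ⟩
    3ℚ * (pp n * T n)                       ≤⟨ *-monoˡ (0≤nat 3) (T-crude n) ⟩
    3ℚ * (y n * (ℓ n + y n))                ≤⟨ *-monoˡ (0≤nat 3) (*-monoˡ (0≤y n) (+-monoʳ-≤ (ℓ n) (y≤ℓ n))) ⟩
    3ℚ * (y n * (ℓ n + ℓ n))                ≤⟨ ≤-by (e₂ (y n) (ℓ n) (z n)) (0≤* (0≤nat 4) (0≤* (0≤ℓ n) (0≤z n))) ⟩
    2ℚ * ℓ n * (3ℚ * y n + 2ℚ * z n)        ≡⟨ cong (_* (3ℚ * y n + 2ℚ * z n)) (sym (pz n)) ⟩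
    pp n * z n * (3ℚ * y n + 2ℚ * z n)      ≡⟨ *-assoc (pp n) (z n) (3ℚ * y n + 2ℚ * z n) ⟩
    pp n * (z n * (3ℚ * y n + 2ℚ * z n))    ∎
    where
    open ≤-Reasoning
    e₁ : ∀ p t → p * (3ℚ * t) ≡ 3ℚ * (p * t)
    e₁ = solve-∀ ringℚ
    e₂ : ∀ y l z → 2ℚ * l * (3ℚ * y + 2ℚ * z) - 3ℚ * (y * (l + l)) ≡ nat 4 * (l * z)
    e₂ = solve-∀ ringℚ
  3T≤ : 3ℚ * T n ≤ z n * (3ℚ * y n + 2ℚ * z n)
  3T≤ = *-cancelˡ (0<pp n) p3T≤

-- y/ℓ behaves like √(2/n). Both this bound and the next are kept squared, hence rational.
py²≥ : ∀ n → 2ℚ * (ℓ n * ℓ n) ≤ pp n * (y n * y n)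
py²≥ n = 0≤q-p⇒p≤q (subst (0ℚ ≤_) (pT n) (0≤* (0≤pp n) (0≤T n)))

py²≤ : ∀ n → pp n * (y n * y n) ≤ nat 4 * (ℓ n * ℓ n)
py²≤ n = ≤-by (modulo {c = 1ℚ} (eq (pp n * (y n * y n)) (ℓ n) (y n) (pp n * T n)) (pT n))
  (0≤+ (p≤q⇒0≤q-p (T-crude n)) (0≤+ (0≤* (0≤ℓ n) d) (0≤* (0≤+ (0≤ℓ n) (0≤y n)) d)))
  where
  d : 0ℚ ≤ ℓ n - y n
  d = p≤q⇒0≤q-p (y≤ℓ n)
  eq : ∀ w l y t → nat 4 * (l * l) - w ≡ y * (l + y) - t + (l * (l - y) + (l + y) * (l - y)) + 1ℚ * (t - (w - 2ℚ * (l * l)))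
  eq = solve-∀ ringℚ

py≥2ℓ : ∀ n → 2ℚ * ℓ n ≤ pp n * y n
py≥2ℓ n = sqrt-mono (0≤* (0≤pp n) (0≤y n)) (begin
  2ℚ * ℓ n * (2ℚ * ℓ n)          ≡⟨ e₁ (ℓ n) ⟩
  2ℚ * (2ℚ * (ℓ n * ℓ n))        ≤⟨ *-monoʳ (0≤* (0≤nat 2) (0≤□ (ℓ n))) (2≤pp n) ⟩
  pp n * (2ℚ * (ℓ n * ℓ n))      ≤⟨ *-monoˡ (0≤pp n) (py²≥ n) ⟩
  pp n * (pp n * (y n * y n))    ≡⟨ e₂ (pp n) (y n) ⟩
  pp n * y n * (pp n * y n)      ∎)
  where
  open ≤-Reasoning
  e₁ : ∀ l → 2ℚ * l * (2ℚ * l) ≡ 2ℚ * (2ℚ * (l * l))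
  e₁ = solve-∀ ringℚ
  e₂ : ∀ p y → p * (p * (y * y)) ≡ p * y * (p * y)
  e₂ = solve-∀ ringℚ

-- G n = 2 y n ℓ (n + 1) + y n ² − 4 (n + 2) T n satisfies G (n + 1) − G n = 6 T n − z n ².
T-upper : ∀ n → nat 4 * (pp n * T n) ≤ y n * (2ℚ * ℓ n + 3ℚ * y n)
T-upper zero          = ≤ᵇ⇒≤ _
T-upper (suc zero)    = ≤ᵇ⇒≤ _
T-upper (suc (suc m)) = ≤-by step (0≤+ (p≤q⇒0≤q-p (T-upper (suc m))) (p≤q⇒0≤q-p z²≤))
  where
  n : ℕ
  n = suc m
  poly : ∀ n t l y z → (y + z) * (2ℚ * (l + y) + 3ℚ * (y + z)) - nat 4 * (n * t + (y + z) * (y + z)) ≡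
         y * (2ℚ * l + 3ℚ * y) - nat 4 * ((1ℚ + (1ℚ + n)) * t) + (nat 6 * t - z * z) + 2ℚ * (t - (y * y - l * z))
  poly = solve-∀ ringℚ
  step : y (suc n) * (2ℚ * ℓ (suc n) + 3ℚ * y (suc n)) - nat 4 * (pp (suc n) * T (suc n)) ≡
         y n * (2ℚ * ℓ n + 3ℚ * y n) - nat 4 * (pp n * T n) + (nat 6 * T n - z n * z n)
  step = trans (cong (λ t → y (suc n) * (2ℚ * ℓ (suc n) + 3ℚ * y (suc n)) - nat 4 * t) (T-rec n))
    (modulo {c = 2ℚ} {T n} {T n} (poly (ι n) (T n) (ℓ n) (y n) (z n)) refl)
  p²z²≤ : pp n * (pp n * (z n * z n)) ≤ pp n * (pp n * (nat 6 * T n))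
  p²z²≤ = begin
    pp n * (pp n * (z n * z n))          ≡⟨ e₁ (pp n) (z n) ⟩
    pp n * z n * (pp n * z n)            ≡⟨ cong₂ _*_ (pz n) (pz n) ⟩
    2ℚ * ℓ n * (2ℚ * ℓ n)                ≤⟨ *-monoʳ (0≤* (0≤nat 2) (0≤ℓ n)) (py≥2ℓ n) ⟩
    pp n * y n * (2ℚ * ℓ n)              ≤⟨ ≤-by (e₂ (pp n) (y n) (ℓ n)) (0≤* (0≤pp n) (0≤* (0≤y n) (0≤ℓ n))) ⟩
    3ℚ * (pp n * (y n * ℓ n))            ≤⟨ *-monoˡ (0≤nat 3) (*-monoˡ (0≤pp n) (T-lower m)) ⟩
    3ℚ * (pp n * (2ℚ * (pp n * T n)))    ≡⟨ e₃ (pp n) (T n) ⟩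
    pp n * (pp n * (nat 6 * T n))        ∎
    where
    open ≤-Reasoning
    e₁ : ∀ p z → p * (p * (z * z)) ≡ p * z * (p * z)
    e₁ = solve-∀ ringℚ
    e₂ : ∀ p y l → 3ℚ * (p * (y * l)) - p * y * (2ℚ * l) ≡ p * (y * l)
    e₂ = solve-∀ ringℚ
    e₃ : ∀ p t → 3ℚ * (p * (2ℚ * (p * t))) ≡ p * (p * (nat 6 * t))
    e₃ = solve-∀ ringℚ
  z²≤ : z n * z n ≤ nat 6 * T n
  z²≤ = *-cancelˡ (0<pp n) (*-cancelˡ (0<pp n) p²z²≤)

-- 40000 = 4 · 100² is what `py²≤` needs to yield 100 y ≤ ℓ.
Large : ℕ → Set
Large n = nat 40000 ≤ pp n

100y≤ℓ : ∀ {n} → Large n → nat 100 * y n ≤ ℓ n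
100y≤ℓ {n} h = sqrt-mono (0≤ℓ n) (*-cancelˡ {nat 4} (positive⁻¹ (nat 4)) (begin
  nat 4 * (nat 100 * y n * (nat 100 * y n))  ≡⟨ e (y n) ⟩
  nat 40000 * (y n * y n)                    ≤⟨ *-monoʳ (0≤□ (y n)) h ⟩
  pp n * (y n * y n)                         ≤⟨ py²≤ n ⟩
  nat 4 * (ℓ n * ℓ n)                        ∎))
  where
  open ≤-Reasoning
  e : ∀ y → nat 4 * (nat 100 * y * (nat 100 * y)) ≡ nat 40000 * (y * y)
  e = solve-∀ ringℚ

100ℓ≤py : ∀ {n} → Large n → nat 100 * ℓ n ≤ pp n * y n
100ℓ≤py {n} h = sqrt-mono (0≤* (0≤pp n) (0≤y n)) (begin
  nat 100 * ℓ n * (nat 100 * ℓ n)      ≡⟨ e₁ (ℓ n) ⟩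
  nat 5000 * (2ℚ * (ℓ n * ℓ n))        ≤⟨ *-monoʳ (0≤* (0≤nat 2) (0≤□ (ℓ n))) (≤-trans {nat 5000} (≤ᵇ⇒≤ _) h) ⟩
  pp n * (2ℚ * (ℓ n * ℓ n))            ≤⟨ *-monoˡ (0≤pp n) (py²≥ n) ⟩
  pp n * (pp n * (y n * y n))          ≡⟨ e₂ (pp n) (y n) ⟩
  pp n * y n * (pp n * y n)            ∎)
  where
  open ≤-Reasoning
  e₁ : ∀ l → nat 100 * l * (nat 100 * l) ≡ nat 5000 * (2ℚ * (l * l))
  e₁ = solve-∀ ringℚ
  e₂ : ∀ p y → p * (p * (y * y)) ≡ p * y * (p * y)
  e₂ = solve-∀ ringℚ

-- Ratios of consecutive coefficients

-- 1 + `x n` is the ratio ℓ (n+1)/ℓ n, so `x` is the slope of log ℓ and `D` its decrement. `Q` is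
-- the additive quantity that controls squared differences of `x` through Cauchy-Schwarz.
x D Q : ℕ → ℚ
x n = y n * inv (ℓ n)
D n = x n - x (suc n)
Q n = sum n (λ i → D i * D i)

ℓx : ∀ n → ℓ n * x n ≡ y n
ℓx n = trans (eq (ℓ n) (y n) (inv (ℓ n))) (trans (cong (y n *_) (*-inv (0<ℓ n))) (*-identityʳ (y n)))
  where
  eq : ∀ a b c → a * (b * c) ≡ b * (a * c)
  eq = solve-∀ ringℚ

0≤x : ∀ n → 0ℚ ≤ x n
0≤x n = 0≤* (0≤y n) (0≤inv (0<ℓ n))

x≤1 : ∀ n → x n ≤ 1ℚ
x≤1 n = *-cancelˡ (0<ℓ n) (subst₂ _≤_ (sym (ℓx n)) (sym (*-identityʳ (ℓ n))) (y≤ℓ n))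

ℓℓD : ∀ n → ℓ n * ℓ (suc n) * D n ≡ T n
ℓℓD n = trans (eq₁ (ℓ n) (ℓ (suc n)) (x n) (x (suc n))) (trans (cong₂ (λ s t → s * ℓ (suc n) - ℓ n * t) (ℓx n) (ℓx (suc n)))
  (eq₂ (ℓ n) (y n) (z n)))
  where
  eq₁ : ∀ l m u v → l * m * (u - v) ≡ l * u * m - l * (m * v)
  eq₁ = solve-∀ ringℚ
  eq₂ : ∀ l y z → y * (l + y) - l * (y + z) ≡ y * y - l * z
  eq₂ = solve-∀ ringℚ

0≤D : ∀ n → 0ℚ ≤ D n
0≤D n = *-cancelˡ (0<* (0<ℓ n) (0<ℓ (suc n)))
  (subst₂ _≤_ (sym (*-zeroʳ (ℓ n * ℓ (suc n)))) (sym (ℓℓD n)) (0≤T n))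

D≤1 : ∀ n → D n ≤ 1ℚ
D≤1 n = ≤-by (eq (x n) (x (suc n))) (0≤+ (p≤q⇒0≤q-p (x≤1 n)) (0≤x (suc n)))
  where
  eq : ∀ u v → 1ℚ - (u - v) ≡ 1ℚ - u + v
  eq = solve-∀ ringℚ

Q-suc : ∀ n → Q (suc n) ≡ Q n + D n * D n
Q-suc n = sum-last n (λ i → D i * D i)

x-Q : ∀ m v → Q (m ℕ.+ v) - Q v ≤ x v - x (m ℕ.+ v)
x-Q zero    v = ≤-reflexive (trans (+-inverseʳ (Q v)) (sym (+-inverseʳ (x v))))
x-Q (suc m) v = ≤-by (trans (cong (λ q → x v - x (suc m ℕ.+ v) - (q - Q v)) (Q-suc (m ℕ.+ v)))
    (eq (x v) (x (m ℕ.+ v)) (x (suc m ℕ.+ v)) (Q (m ℕ.+ v)) (Q v)))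
  (0≤+ (p≤q⇒0≤q-p (x-Q m v)) (0≤* (0≤D (m ℕ.+ v)) (p≤q⇒0≤q-p (D≤1 (m ℕ.+ v)))))
  where
  eq : ∀ a b c q r → a - c - (q + (b - c) * (b - c) - r) ≡ a - b - (q - r) + (b - c) * (1ℚ - (b - c))
  eq = solve-∀ ringℚ

Q-diff≤1 : ∀ m v → Q (m ℕ.+ v) - Q v ≤ 1ℚ
Q-diff≤1 m v = ≤-trans (x-Q m v) (≤-by (eq (x v) (x (m ℕ.+ v))) (0≤+ (p≤q⇒0≤q-p (x≤1 v)) (0≤x (m ℕ.+ v))))
  where
  eq : ∀ a b → 1ℚ - (a - b) ≡ 1ℚ - a + b
  eq = solve-∀ ringℚ

Q-mono : ∀ m v → 0ℚ ≤ Q (m ℕ.+ v) - Q v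
Q-mono zero    v = ≤-reflexive (sym (+-inverseʳ (Q v)))
Q-mono (suc m) v = subst (0ℚ ≤_) (sym (trans (cong (_- Q v) (Q-suc (m ℕ.+ v))) (eq (Q (m ℕ.+ v)) (D (m ℕ.+ v) * D (m ℕ.+ v)) (Q v))))
  (0≤+ (Q-mono m v) (0≤□ (D (m ℕ.+ v))))
  where
  eq : ∀ a b c → a + b - c ≡ a - c + b
  eq = solve-∀ ringℚ

-- Cauchy–Schwarz for the telescoping sum x v − x (v + m) = D v + … + D (v + m − 1).
cauchy-schwarz : ∀ m v → (x v - x (m ℕ.+ v)) * (x v - x (m ℕ.+ v)) ≤ ι m * (Q (m ℕ.+ v) - Q v)
cauchy-schwarz zero          v = ≤-reflexive (eq (x v) (Q v))
  where
  eq : ∀ a b → (a - a) * (a - a) ≡ 0ℚ * (b - b)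
  eq = solve-∀ ringℚ
cauchy-schwarz (suc zero)    v = ≤-reflexive (trans (eq (x v) (x (suc v)) (Q v)) (cong (λ q → (1ℚ + 0ℚ) * (q - Q v)) (sym (Q-suc v))))
  where
  eq : ∀ a b q → (a - b) * (a - b) ≡ (1ℚ + 0ℚ) * (q + (a - b) * (a - b) - q)
  eq = solve-∀ ringℚ
cauchy-schwarz (suc m@(suc k)) v = ≤-by
  (trans (cong (λ q → ι (suc m) * (q - Q v) - (x v - x₂) * (x v - x₂)) (Q-suc (m ℕ.+ v))) (eq (x v) x₁ x₂ (Q (m ℕ.+ v)) (Q v) (ι m)))
  (0≤+ (p≤q⇒0≤q-p (cauchy-schwarz m v)) (rest (cauchy-schwarz m v)))
  where
  x₁ x₂ q : ℚ
  x₁ = x (m ℕ.+ v)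
  x₂ = x (suc m ℕ.+ v)
  q = Q (m ℕ.+ v) - Q v
  eq : ∀ a b c q r m → (1ℚ + m) * (q + (b - c) * (b - c) - r) - (a - c) * (a - c) ≡
       m * (q - r) - (a - b) * (a - b) + ((q - r) + m * ((b - c) * (b - c)) - 2ℚ * ((a - b) * (b - c)))
  eq = solve-∀ ringℚ
  eq₂ : ∀ a b c q m → m * (q + m * ((b - c) * (b - c)) - 2ℚ * ((a - b) * (b - c))) ≡
        m * q - (a - b) * (a - b) + (a - b - m * (b - c)) * (a - b - m * (b - c))
  eq₂ = solve-∀ ringℚ
  -- Multiplied by m this is the induction hypothesis plus the square of (x v - x₁) - m (x₁ - x₂).
  -- Cancelling m needs m > 0, hence the separate case of a single step.
  rest : (x v - x₁) * (x v - x₁) ≤ ι m * q → 0ℚ ≤ q + ι m * ((x₁ - x₂) * (x₁ - x₂)) - 2ℚ * ((x v - x₁) * (x₁ - x₂))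
  rest ih = *-cancelˡ (0<ι k) (subst₂ _≤_ (sym (*-zeroʳ (ι m))) (sym (eq₂ (x v) x₁ x₂ q (ι m)))
    (0≤+ (p≤q⇒0≤q-p ih) (0≤□ (x v - x₁ - ι m * (x₁ - x₂)))))

-- Here (n + 2)³ (D n)² tends to 1/2; the constant 14/25 leaves room.
D-bound : ∀ {n} → Large n → nat 25 * (pp n * pp (1 ℕ.+ n) * pp (2 ℕ.+ n) * (D n * D n)) ≤ nat 14
D-bound {n} h = *-cancelˡ (0<* (0<ℓ n) (0<ℓ n)) (begin
  l * l * (nat 25 * (p * pp (1 ℕ.+ n) * pp (2 ℕ.+ n) * (d * d)))
    ≡⟨ e₁ l p d ⟩
  nat 25 * (l * l * (p * (d * d))) * ((1ℚ + p) * (1ℚ + (1ℚ + p)))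
    ≤⟨ *-monoˡ (0≤* (0≤nat 25) (0≤* (0≤□ l) (0≤* (0≤pp n) (0≤□ d)))) pp≤ ⟩
  nat 25 * (l * l * (p * (d * d))) * ((ℤ.+ 1001 / 1000) * (p * p))
    ≡⟨ e₂ l p d ⟩
  (ℤ.+ 1001 / 40) * (p * (p * (l * d) * (p * (l * d))))
    ≤⟨ *-monoˡ {ℤ.+ 1001 / 40} (≤ᵇ⇒≤ _) pss ⟩
  (ℤ.+ 1001 / 40) * ((ℤ.+ 11 / 20) * (l * l))
    ≤⟨ ≤-by (e₄ l) (0≤* {ℤ.+ 189 / 800} (≤ᵇ⇒≤ _) (0≤□ l)) ⟩
  l * l * nat 14 ∎)
  where
  open ≤-Reasoning
  l p d v s : ℚ
  l = ℓ n
  p = pp n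
  d = D n
  v = y n
  s = p * (l * d)
  e₁ : ∀ l p d → l * l * (nat 25 * (p * (1ℚ + p) * (1ℚ + (1ℚ + p)) * (d * d))) ≡
       nat 25 * (l * l * (p * (d * d))) * ((1ℚ + p) * (1ℚ + (1ℚ + p)))
  e₁ = solve-∀ ringℚ
  e₂ : ∀ l p d → nat 25 * (l * l * (p * (d * d))) * ((ℤ.+ 1001 / 1000) * (p * p)) ≡
       (ℤ.+ 1001 / 40) * (p * (p * (l * d) * (p * (l * d))))
  e₂ = solve-∀ ringℚ
  e₄ : ∀ l → l * l * nat 14 - (ℤ.+ 1001 / 40) * ((ℤ.+ 11 / 20) * (l * l)) ≡ (ℤ.+ 189 / 800) * (l * l)
  e₄ = solve-∀ ringℚ
  pp≤ : (1ℚ + p) * (1ℚ + (1ℚ + p)) ≤ (ℤ.+ 1001 / 1000) * (p * p)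
  pp≤ = ≤-by (e p) (0≤+ (0≤* (0≤* {ℤ.+ 1 / 1000} (≤ᵇ⇒≤ _) (0≤pp n)) (p≤q⇒0≤q-p h)) (0≤+ (0≤* (0≤nat 36) (0≤pp n)) (p≤q⇒0≤q-p (2≤pp n))))
    where
    e : ∀ p → (ℤ.+ 1001 / 1000) * (p * p) - (1ℚ + p) * (1ℚ + (1ℚ + p)) ≡
        (ℤ.+ 1 / 1000) * p * (p - nat 40000) + (nat 36 * p + (p - 2ℚ))
    e = solve-∀ ringℚ
  pT≤ : p * T n ≤ (ℤ.+ 13 / 25) * (v * l)
  pT≤ = *-cancelˡ {nat 4} (positive⁻¹ (nat 4)) (≤-by (e v l (p * T n)) (0≤+ (p≤q⇒0≤q-p (T-upper n)) (0≤* (0≤y n)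
    (0≤+ (0≤* {ℤ.+ 3 / 100} (≤ᵇ⇒≤ _) (p≤q⇒0≤q-p (100y≤ℓ {n} h))) (0≤* {ℤ.+ 1 / 20} (≤ᵇ⇒≤ _) (0≤ℓ n))))))
    where
    e : ∀ v l t → nat 4 * ((ℤ.+ 13 / 25) * (v * l)) - nat 4 * t ≡
        v * (2ℚ * l + 3ℚ * v) - nat 4 * t + v * ((ℤ.+ 3 / 100) * (l - nat 100 * v) + (ℤ.+ 1 / 20) * l)
    e = solve-∀ ringℚ
  s≤ : s ≤ (ℤ.+ 13 / 25) * v
  s≤ = *-cancelˡ (0<ℓ n) (begin
    l * s                               ≡⟨ f₁ l p d ⟩
    p * (l * d * l)                     ≤⟨ *-monoˡ (0≤pp n) (*-monoˡ (0≤* (0≤ℓ n) (0≤D n)) (p≤p+q {l} (0≤y n))) ⟩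
    p * (l * d * ℓ (suc n))             ≡⟨ cong (p *_) (trans (f₂ l d (ℓ (suc n))) (ℓℓD n)) ⟩
    p * T n                             ≤⟨ pT≤ ⟩
    (ℤ.+ 13 / 25) * (v * l)             ≡⟨ f₃ v l ⟩
    l * ((ℤ.+ 13 / 25) * v)             ∎)
    where
    f₁ : ∀ l p d → l * (p * (l * d)) ≡ p * (l * d * l)
    f₁ = solve-∀ ringℚ
    f₂ : ∀ l d m → l * d * m ≡ l * m * d
    f₂ = solve-∀ ringℚ
    f₃ : ∀ v l → (ℤ.+ 13 / 25) * (v * l) ≡ l * ((ℤ.+ 13 / 25) * v)
    f₃ = solve-∀ ringℚ
  pyy : p * (v * v) ≤ (ℤ.+ 201 / 100) * (l * l)
  pyy = ≤-by (modulo {c = 1ℚ} (e (p * (v * v)) v l (p * T n)) (pT n))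
    (0≤+ (p≤q⇒0≤q-p pT≤) (0≤* (0≤ℓ n) (0≤+ (0≤* {ℤ.+ 1 / 100} (≤ᵇ⇒≤ _) (p≤q⇒0≤q-p (100y≤ℓ {n} h))) (0≤* {ℤ.+ 12 / 25} (≤ᵇ⇒≤ _) (0≤y n)))))
    where
    e : ∀ w v l t → (ℤ.+ 201 / 100) * (l * l) - w ≡
        (ℤ.+ 13 / 25) * (v * l) - t + l * ((ℤ.+ 1 / 100) * (l - nat 100 * v) + (ℤ.+ 12 / 25) * v) + 1ℚ * (t - (w - 2ℚ * (l * l)))
    e = solve-∀ ringℚ
  0≤s : 0ℚ ≤ s
  0≤s = 0≤* (0≤pp n) (0≤* (0≤ℓ n) (0≤D n))
  -- 0.52² · 2.01 < 0.55, and then 25 · 1.001 · 0.55 < 14.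
  pss : p * (s * s) ≤ (ℤ.+ 11 / 20) * (l * l)
  pss = begin
    p * (s * s)                                            ≤⟨ *-monoˡ (0≤pp n) (*-mono 0≤s (≤-trans 0≤s s≤) s≤ s≤) ⟩
    p * ((ℤ.+ 13 / 25) * v * ((ℤ.+ 13 / 25) * v))          ≡⟨ f₁ p v ⟩
    (ℤ.+ 169 / 625) * (p * (v * v))                        ≤⟨ *-monoˡ {ℤ.+ 169 / 625} (≤ᵇ⇒≤ _) pyy ⟩
    (ℤ.+ 169 / 625) * ((ℤ.+ 201 / 100) * (l * l))          ≡⟨ sym (*-assoc (ℤ.+ 169 / 625) (ℤ.+ 201 / 100) (l * l)) ⟩
    (ℤ.+ 169 / 625) * (ℤ.+ 201 / 100) * (l * l)            ≤⟨ *-monoʳ {l * l} {(ℤ.+ 169 / 625) * (ℤ.+ 201 / 100)} {ℤ.+ 11 / 20} (0≤□ l) (≤ᵇ⇒≤ _) ⟩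
    (ℤ.+ 11 / 20) * (l * l)                                ∎
    where
    f₁ : ∀ p v → p * ((ℤ.+ 13 / 25) * v * ((ℤ.+ 13 / 25) * v)) ≡ (ℤ.+ 169 / 625) * (p * (v * v))
    f₁ = solve-∀ ringℚ

-- Supersolutions for three-fold partial sums of ℓ / ((n + 2) (n + 3) (n + 4))

ip : ℕ → ℚ
ip n = inv (pp n)

p*ip : ∀ n → pp n * ip n ≡ 1ℚ
p*ip n = *-inv (0<pp n)

0≤ip : ∀ n → 0ℚ ≤ ip n
0≤ip n = 0≤inv (0<pp n)

-- Since y′ ≈ 2 ℓ/n and ℓ′ ≈ y, summing 100 ℓ/n³ three times gives asymptotically 50 y/n², 50 ℓ/n²
-- and 25 y/n. The constants 51, 53, 27 are raised just enough for exact inequalities between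
-- differences.
γ sup₁ sup₂ sup₃ : ℕ → ℚ
γ v    = ℓ v * (ip v * ip (1 ℕ.+ v) * ip (2 ℕ.+ v))
sup₁ v = nat 51 * y v * (ip v * ip (1 ℕ.+ v))
sup₂ v = nat 53 * ℓ v * (ip v * ip (1 ℕ.+ v))
sup₃ v = nat 27 * y v * ip v

0≤γ : ∀ v → 0ℚ ≤ γ v
0≤γ v = 0≤* (0≤ℓ v) (0≤* (0≤* (0≤ip v) (0≤ip (1 ℕ.+ v))) (0≤ip (2 ℕ.+ v)))

0≤sup₁ : ∀ v → 0ℚ ≤ sup₁ v
0≤sup₁ v = 0≤* (0≤* (0≤nat 51) (0≤y v)) (0≤* (0≤ip v) (0≤ip (1 ℕ.+ v)))

0≤sup₂ : ∀ v → 0ℚ ≤ sup₂ v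
0≤sup₂ v = 0≤* (0≤* (0≤nat 53) (0≤ℓ v)) (0≤* (0≤ip v) (0≤ip (1 ℕ.+ v)))

0≤sup₃ : ∀ v → 0ℚ ≤ sup₃ v
0≤sup₃ v = 0≤* (0≤* (0≤nat 27) (0≤y v)) (0≤ip v)

modulo₃ : ∀ {X p₁ q₁ p₂ q₂ p₃ q₃ : ℚ} Y c₁ c₂ c₃ → X ≡ Y + c₁ * (p₁ - q₁) + c₂ * (p₂ - q₂) + c₃ * (p₃ - q₃) →
          p₁ ≡ q₁ → p₂ ≡ q₂ → p₃ ≡ q₃ → X ≡ Y
modulo₃ {q₁ = q₁} {q₂ = q₂} {q₃ = q₃} Y c₁ c₂ c₃ h refl refl refl = trans h (eq Y c₁ c₂ c₃ q₁ q₂ q₃)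
  where
  eq : ∀ Y a b c p q r → Y + a * (p - p) + b * (q - q) + c * (r - r) ≡ Y
  eq = solve-∀ ringℚ

module _ {v : ℕ} (h : Large v) where
  private
    i₀ i₁ i₂ i₃ : ℚ
    i₀ = ip v
    i₁ = ip (1 ℕ.+ v)
    i₂ = ip (2 ℕ.+ v)
    i₃ = ip (3 ℕ.+ v)
    0≤W : 0ℚ ≤ i₀ * i₁ * i₂
    0≤W = 0≤* (0≤* (0≤ip v) (0≤ip (1 ℕ.+ v))) (0≤ip (2 ℕ.+ v))
    0≤s : 0ℚ ≤ ℓ v - nat 100 * y v
    0≤s = p≤q⇒0≤q-p (100y≤ℓ {v} h)
    0≤t : 0ℚ ≤ pp v * y v - nat 100 * ℓ v
    0≤t = p≤q⇒0≤q-p (100ℓ≤py {v} h)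

  -- Reciprocals enter as variables i, j, k tied to p by p i = 1 and (p + 2) k = 1. What remains is
  -- i j k times a form that 100 y ≤ ℓ makes nonnegative; the other steps use the same scheme.
  step₁ : nat 100 * γ v ≤ sup₁ (suc v) - sup₁ v
  step₁ = ≤-by (modulo₃ (i₀ * i₁ * i₂ * (2ℚ * (ℓ v - nat 100 * y v) + nat 98 * y v))
      (nat 51 * (y v + z v) * i₁ * i₂) (nat 51 * y v * i₀ * i₁) (nat 51 * (i₀ * i₁ * i₂))
      (e (pp v) (ℓ v) (y v) (z v) i₀ i₁ i₂) (sym (p*ip v)) (p*ip (2 ℕ.+ v)) (pz v))
    (0≤* 0≤W (0≤+ (0≤* (0≤nat 2) 0≤s) (0≤* (0≤nat 98) (0≤y v))))
    where
    e : ∀ p l y z i j k → nat 51 * (y + z) * (j * k) - nat 51 * y * (i * j) - nat 100 * (l * (i * j * k)) ≡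
        i * j * k * (2ℚ * (l - nat 100 * y) + nat 98 * y)
        + nat 51 * (y + z) * j * k * (1ℚ - p * i)
        + nat 51 * y * i * j * ((1ℚ + (1ℚ + p)) * k - 1ℚ)
        + nat 51 * (i * j * k) * (p * z - 2ℚ * l)
    e = solve-∀ ringℚ

  step₂ : sup₁ v ≤ sup₂ (suc v) - sup₂ v
  step₂ = ≤-by (modulo₃ (i₀ * i₁ * i₂ * (2ℚ * (pp v * y v - nat 100 * ℓ v) + 3ℚ * (ℓ v - nat 100 * y v) + (nat 91 * ℓ v + nat 198 * y v)))
      (nat 53 * (ℓ v + y v) * i₁ * i₂) (nat 53 * ℓ v * i₀ * i₁ + nat 51 * y v * i₀ * i₁) 0ℚ
      (e (pp v) (ℓ v) (y v) i₀ i₁ i₂) (sym (p*ip v)) (p*ip (2 ℕ.+ v)) (refl {x = 0ℚ}))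
    (0≤* 0≤W (0≤+ (0≤+ (0≤* (0≤nat 2) 0≤t) (0≤* (0≤nat 3) 0≤s)) (0≤+ (0≤* (0≤nat 91) (0≤ℓ v)) (0≤* (0≤nat 198) (0≤y v)))))
    where
    e : ∀ p l y i j k → nat 53 * (l + y) * (j * k) - nat 53 * l * (i * j) - nat 51 * y * (i * j) ≡
        i * j * k * (2ℚ * (p * y - nat 100 * l) + 3ℚ * (l - nat 100 * y) + (nat 91 * l + nat 198 * y))
        + nat 53 * (l + y) * j * k * (1ℚ - p * i)
        + (nat 53 * l * i * j + nat 51 * y * i * j) * ((1ℚ + (1ℚ + p)) * k - 1ℚ)
        + 0ℚ * (0ℚ - 0ℚ)
    e = solve-∀ ringℚ

  step₃ : sup₂ v ≤ sup₃ (suc v) - sup₃ v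
  step₃ = ≤-by (modulo₃ (i₀ * i₁ * ((ℓ v - nat 100 * y v) + nat 73 * y v))
      (nat 27 * (y v + z v) * i₁) (nat 27 * y v * i₀) (nat 27 * (i₀ * i₁))
      (e (pp v) (ℓ v) (y v) (z v) i₀ i₁) (sym (p*ip v)) (p*ip (1 ℕ.+ v)) (pz v))
    (0≤* (0≤* (0≤ip v) (0≤ip (1 ℕ.+ v))) (0≤+ 0≤s (0≤* (0≤nat 73) (0≤y v))))
    where
    e : ∀ p l y z i j → nat 27 * (y + z) * j - nat 27 * y * i - nat 53 * l * (i * j) ≡
        i * j * ((l - nat 100 * y) + nat 73 * y)
        + nat 27 * (y + z) * j * (1ℚ - p * i)
        + nat 27 * y * i * ((1ℚ + p) * j - 1ℚ)
        + nat 27 * (i * j) * (p * z - 2ℚ * l)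
    e = solve-∀ ringℚ

  γ-mono : γ v ≤ γ (suc v)
  γ-mono = ≤-by (modulo₃ (i₀ * i₁ * i₂ * i₃ * ((pp v * y v - nat 100 * ℓ v) + nat 97 * ℓ v))
      ((ℓ v + y v) * i₁ * i₂ * i₃) (ℓ v * i₀ * i₁ * i₂) 0ℚ
      (e (pp v) (ℓ v) (y v) i₀ i₁ i₂ i₃) (sym (p*ip v)) (p*ip (3 ℕ.+ v)) (refl {x = 0ℚ}))
    (0≤* (0≤* 0≤W (0≤ip (3 ℕ.+ v))) (0≤+ 0≤t (0≤* (0≤nat 97) (0≤ℓ v))))
    where
    e : ∀ p l y i j k m → (l + y) * (j * k * m) - l * (i * j * k) ≡
        i * j * k * m * ((p * y - nat 100 * l) + nat 97 * l)
        + (l + y) * j * k * m * (1ℚ - p * i)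
        + l * i * j * k * ((1ℚ + (1ℚ + (1ℚ + p))) * m - 1ℚ)
        + 0ℚ * (0ℚ - 0ℚ)
    e = solve-∀ ringℚ

-- Growth of ℓ

θℓ-step : ∀ n → ι (suc n) * ℓ (suc n) - ι n * ℓ n ≡ 2ℚ * (I ⊛ ℓ) n
θℓ-step zero    = refl
θℓ-step (suc n) = trans (modulo {c = 1ℚ} (eq (ι n) (ℓ n) (y n) (z n)) (pz n))
  (trans (cong (2ℚ * ℓ (suc n) +_) (θℓ-step n)) (trans (sym (*-distribˡ-+ 2ℚ (ℓ (suc n)) ((I ⊛ ℓ) n))) (cong (2ℚ *_) (sym (I⊛-suc ℓ n)))))
  where
  eq : ∀ n l y z → (1ℚ + (1ℚ + n)) * (l + y + (y + z)) - (1ℚ + n) * (l + y) ≡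
       2ℚ * (l + y) + ((1ℚ + n) * (l + y) - n * l) + 1ℚ * ((1ℚ + (1ℚ + n)) * z - 2ℚ * l)
  eq = solve-∀ ringℚ

θℓ-suc : ∀ n → ι (suc n) * ℓ (suc n) ≡ 2ℚ * (I ⊛ (I ⊛ ℓ)) n
θℓ-suc zero    = refl
θℓ-suc (suc n) = trans (eq (ι (2 ℕ.+ n) * ℓ (2 ℕ.+ n)) (ι (suc n) * ℓ (suc n)))
  (trans (cong₂ _+_ (θℓ-step (suc n)) (θℓ-suc n))
    (trans (sym (*-distribˡ-+ 2ℚ ((I ⊛ ℓ) (suc n)) ((I ⊛ (I ⊛ ℓ)) n))) (cong (2ℚ *_) (sym (I⊛-suc (I ⊛ ℓ) n)))))
  where
  eq : ∀ a b → a ≡ a - b + b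
  eq = solve-∀ ringℚ

-- Identifies `ℓ` as the exponential: 2 q/(1 - q)² is q d/dq of 2 q/(1 - q).
θℓ : θ ℓ ≗ (2ℚ · ι) ⊛ ℓ
θℓ n = trans (lem n) (trans (cong (2ℚ *_) (sym (ι⊛ ℓ n))) (sym (·-⊛ 2ℚ ι ℓ n)))
  where
  lem : ∀ n → θ ℓ n ≡ 2ℚ * sh 1 (I ⊛ (I ⊛ ℓ)) n
  lem zero    = refl
  lem (suc n) = θℓ-suc n

θI^ : ∀ j → θ (I^ j one) ≗ ι j · (qI ⊛ I^ j one)
θI^ zero    n = trans (θ-one n) (sym (*-zeroˡ ((qI ⊛ one) n)))
θI^ (suc j) n = begin
  θ (I ⊛ J) n                          ≡⟨ θ-⊛ I J n ⟩
  (θ I ⊛ J) n + (I ⊛ θ J) n            ≡⟨ cong₂ _+_ (⊛-congʳ J θI≗ n) (⊛-congˡ I (θI^ j) n) ⟩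
  ((qI ⊛ I) ⊛ J) n + (I ⊛ (ι j · (qI ⊛ J))) n
    ≡⟨ cong₂ _+_ (⊛-assoc qI I J n) (trans (⊛-comm I (ι j · (qI ⊛ J)) n) (trans (·-⊛ (ι j) (qI ⊛ J) I n)
         (cong (ι j *_) (trans (⊛-assoc qI J I n) (⊛-congˡ qI (⊛-comm J I) n))))) ⟩
  (qI ⊛ (I ⊛ J)) n + ι j * (qI ⊛ (I ⊛ J)) n ≡⟨ eq ((qI ⊛ (I ⊛ J)) n) (ι j) ⟩
  (1ℚ + ι j) * (qI ⊛ (I ⊛ J)) n         ∎
  where
  open ≡-Reasoning
  J : Series
  J = I^ j one
  eq : ∀ a b → a + b * a ≡ (1ℚ + b) * a
  eq = solve-∀ ringℚ
  θI≗ : θ I ≗ qI ⊛ I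
  θI≗ n = trans (*-identityʳ (ι n)) (trans (ι≗ n) (sym (sh-⊛ 1 I I n)))

θI^-sh : ∀ j n → ι n * I^ (suc j) one n ≡ ι (suc j) * sh 1 (I^ (2 ℕ.+ j) one) n
θI^-sh j n = trans (θI^ (suc j) n) (cong (ι (suc j) *_) (sh-⊛ 1 I (I^ (suc j) one) n))

sh1≤ : ∀ {a} → 0̂ ⊑ a → sh 1 (I ⊛ a) ⊑ I ⊛ a
sh1≤ {a} 0≤a zero    = 0⊑⊛ {I} {a} 0⊑I 0≤a 0
sh1≤ {a} 0≤a (suc n) = I⊛-mono 0≤a (ℕₚ.n≤1+n n)

0⊑ℓ : 0̂ ⊑ ℓ
0⊑ℓ = 0≤ℓ

-- `ℓ` outgrows every polynomial. Multiplying (1 - q)^(-j-1) by n gives j + 1 times a shift of (1 -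
-- q)^(-j-2), two partial sums of the previous case; two partial sums of `ℓ` amount to n ℓ/2 by
-- `θℓ-suc`.
I^≤ℓ : ∀ j → ∃ λ C → 0ℚ ≤ C × I^ j one ⊑ C · ℓ
I^≤ℓ zero    = 1ℚ , 0≤1 , λ { zero → ≤-refl ; (suc n) → subst (0ℚ ≤_) (sym (*-identityˡ (ℓ (suc n)))) (0≤ℓ (suc n)) }
I^≤ℓ (suc j) with I^≤ℓ j
... | C , 0≤C , h = ι (suc j) * C + 1ℚ , 0≤+ (0≤* (0≤ι (suc j)) 0≤C) 0≤1 , bound
  where
  I⁰ : ∀ j → I^ j one 0 ≡ 1ℚ
  I⁰ zero    = refl
  I⁰ (suc j) = trans (+-identityʳ (1ℚ * I^ j one 0)) (trans (*-identityˡ (I^ j one 0)) (I⁰ j))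
  J≤ : I^ (2 ℕ.+ j) one ⊑ C · (I ⊛ (I ⊛ ℓ))
  J≤ = ⊑-trans (⊛-monoˡ {I} {I^ (suc j) one} 0⊑I (⊑-trans (⊛-monoˡ {I} {I^ j one} 0⊑I h) (⊑-reflexive (pull ℓ)))) (⊑-reflexive (pull (I ⊛ ℓ)))
    where
    pull : ∀ a → I ⊛ (C · a) ≗ C · (I ⊛ a)
    pull a n = trans (⊛-comm I (C · a) n) (trans (·-⊛ C a I n) (cong (C *_) (⊛-comm a I n)))
  bound : I^ (suc j) one ⊑ (ι (suc j) * C + 1ℚ) · ℓ
  bound zero    = subst (_≤ (ι (suc j) * C + 1ℚ) * 1ℚ) (sym (I⁰ (suc j)))
    (subst (1ℚ ≤_) (sym (*-identityʳ (ι (suc j) * C + 1ℚ))) (p≤q+p (0≤* (0≤ι (suc j)) 0≤C)))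
  bound (suc n) = *-cancelˡ (0<ι n) (begin
    ι (suc n) * I^ (suc j) one (suc n)        ≡⟨ θI^-sh j (suc n) ⟩
    ι (suc j) * I^ (2 ℕ.+ j) one n            ≤⟨ *-monoˡ (0≤ι (suc j)) (J≤ n) ⟩
    ι (suc j) * (C * (I ⊛ (I ⊛ ℓ)) n)         ≤⟨ ≤-by (eq (ι (suc j)) C ((I ⊛ (I ⊛ ℓ)) n)) (0≤+ (0≤* (0≤* (0≤ι (suc j)) 0≤C) 0≤w) (0≤* (0≤nat 2) 0≤w)) ⟩
    (ι (suc j) * C + 1ℚ) * (2ℚ * (I ⊛ (I ⊛ ℓ)) n) ≡⟨ cong ((ι (suc j) * C + 1ℚ) *_) (sym (θℓ-suc n)) ⟩
    (ι (suc j) * C + 1ℚ) * (ι (suc n) * ℓ (suc n)) ≡⟨ eq₂ (ι (suc j) * C + 1ℚ) (ι (suc n)) (ℓ (suc n)) ⟩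
    ι (suc n) * ((ι (suc j) * C + 1ℚ) * ℓ (suc n)) ∎)
    where
    open ≤-Reasoning
    0≤w : 0ℚ ≤ (I ⊛ (I ⊛ ℓ)) n
    0≤w = 0⊑⊛ {I} {I ⊛ ℓ} 0⊑I (0⊑⊛ {I} {ℓ} 0⊑I 0⊑ℓ) n
    eq : ∀ a c w → (a * c + 1ℚ) * (2ℚ * w) - a * (c * w) ≡ a * c * w + 2ℚ * w
    eq = solve-∀ ringℚ
    eq₂ : ∀ a b c → a * (b * c) ≡ b * (a * c)
    eq₂ = solve-∀ ringℚ

pow : ℕ → ℚ → ℚ
pow zero    q = 1ℚ
pow (suc j) q = q * pow j q

pow≤I^ : ∀ j → ∃ λ K → 0ℚ ≤ K × (∀ n → pow j (ι n) ≤ K * I^ (suc j) one n)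
pow≤I^ zero    = 1ℚ , 0≤1 , λ n → ≤-reflexive (sym (trans (*-identityˡ ((I ⊛ one) n)) (trans (⊛-comm I one n) (⊛-identityˡ I n))))
pow≤I^ (suc j) with pow≤I^ j
... | K , 0≤K , h = K * ι (suc j) , 0≤* 0≤K (0≤ι (suc j)) , λ n → begin
    ι n * pow j (ι n)                             ≤⟨ *-monoˡ (0≤ι n) (h n) ⟩
    ι n * (K * I^ (suc j) one n)                  ≡⟨ eq (ι n) K (I^ (suc j) one n) ⟩
    K * (ι n * I^ (suc j) one n)                  ≡⟨ cong (K *_) (θI^-sh j n) ⟩
    K * (ι (suc j) * sh 1 (I^ (2 ℕ.+ j) one) n)   ≤⟨ *-monoˡ 0≤K (*-monoˡ (0≤ι (suc j)) (sh1≤ (0⊑I^ (suc j) 0⊑one) n)) ⟩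
    K * (ι (suc j) * I^ (2 ℕ.+ j) one n)          ≡⟨ sym (*-assoc K (ι (suc j)) (I^ (2 ℕ.+ j) one n)) ⟩
    K * ι (suc j) * I^ (2 ℕ.+ j) one n            ∎
  where
  open ≤-Reasoning
  eq : ∀ a b c → a * (b * c) ≡ b * (a * c)
  eq = solve-∀ ringℚ

nat≡ι : ∀ k → nat k ≡ ι k
nat≡ι zero    = refl
nat≡ι (suc k) = trans (toℚᵘ-injective (ℚᵘₚ.≃-trans (toℚᵘ-fromℚᵘ (ℚᵘ.mkℚᵘ (ℤ.+ suc k) 0))
  (ℚᵘₚ.≃-sym (ℚᵘₚ.≃-trans (toℚᵘ-homo-+ 1ℚ (nat k)) (ℚᵘₚ.≃-trans (ℚᵘₚ.+-congʳ (toℚᵘ 1ℚ) (toℚᵘ-fromℚᵘ (ℚᵘ.mkℚᵘ (ℤ.+ k) 0)))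
    (ℚᵘ.*≡* (arith k))))))) (cong (1ℚ +_) (nat≡ι k))
  where
  arith : ∀ k → (ℤ.+ 1 ℤ.+ ℤ.+ k ℤ.* ℤ.+ 1) ℤ.* ℤ.+ 1 ≡ ℤ.+ suc k ℤ.* ℤ.+ 1
  arith k = trans (ℤₚ.*-identityʳ (ℤ.+ 1 ℤ.+ ℤ.+ k ℤ.* ℤ.+ 1))
    (trans (cong (ℤ._+_ (ℤ.+ 1)) (ℤₚ.*-identityʳ (ℤ.+ k))) (sym (ℤₚ.*-identityʳ (ℤ.+ suc k))))

archimedean : ∀ q → ∃ λ n → q ≤ ι n
archimedean q = ℤ.∣ ↥ q ∣ , subst (q ≤_) (nat≡ι ℤ.∣ ↥ q ∣) (toℚᵘ-cancel-≤
  (ℚᵘₚ.≤-respʳ-≃ (ℚᵘₚ.≃-sym (toℚᵘ-fromℚᵘ (ℚᵘ.mkℚᵘ (ℤ.+ ℤ.∣ ↥ q ∣) 0))) (le q)))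
  where
  abs : ∀ n d → n ℤ.* ℤ.+ 1 ℤ.≤ ℤ.+ ℤ.∣ n ∣ ℤ.* ℤ.+ suc d
  abs (ℤ.+ n)    d = subst₂ ℤ._≤_ (sym (ℤₚ.*-identityʳ (ℤ.+ n))) (ℤₚ.pos-* n (suc d)) (ℤ.+≤+ (ℕₚ.m≤m*n n (suc d)))
  abs ℤ.-[1+ n ] d = subst₂ ℤ._≤_ (sym (ℤₚ.*-identityʳ ℤ.-[1+ n ])) (ℤₚ.pos-* (suc n) (suc d)) ℤ.-≤+
  le : ∀ q → toℚᵘ q ℚᵘ.≤ ℚᵘ.mkℚᵘ (ℤ.+ ℤ.∣ ↥ q ∣) 0
  le q@record{} = ℚᵘ.*≤* (abs (↥ q) (ℚ.denominator-1 q))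

ppι≤ : ∀ n → pp (suc n) ≤ 3ℚ * ι (suc n)
ppι≤ n = ≤-by (eq (ι n)) (0≤* (0≤nat 2) (0≤ι n))
  where
  eq : ∀ n → 3ℚ * (1ℚ + n) - (1ℚ + (1ℚ + (1ℚ + n))) ≡ 2ℚ * n
  eq = solve-∀ ringℚ

private
  growth-step : ∀ {n K C q J l v p} → 0ℚ < n → 0ℚ ≤ K → 0ℚ ≤ C → 0ℚ ≤ l → 0ℚ ≤ v → 3ℚ * (1ℚ + K * C) * q ≤ n →
                pow 5 n ≤ K * J → J ≤ C * l → 2ℚ * l ≤ p * v → p ≤ 3ℚ * n → q * cube n ≤ v
  growth-step {n} {K} {C} {q} {J} {l} {v} {p} 0<n 0≤K 0≤C 0≤l 0≤v hq hJ hl hv hp =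
    *-cancelˡ {3ℚ * (1ℚ + K * C)} (0<* (positive⁻¹ 3ℚ) (0<+ (positive⁻¹ 1ℚ) (0≤* 0≤K 0≤C))) (*-cancelˡ 0<n (begin
      n * (3ℚ * (1ℚ + K * C) * (q * cube n))  ≡⟨ e₁ (1ℚ + K * C) n q ⟩
      n * cube n * (3ℚ * (1ℚ + K * C) * q)    ≤⟨ *-monoˡ (0≤* 0≤n (0≤cube 0≤n)) hq ⟩
      n * cube n * n                          ≡⟨ e₂ n ⟩
      pow 5 n                                 ≤⟨ hJ ⟩
      K * J                                   ≤⟨ *-monoˡ 0≤K hl ⟩
      K * (C * l)                             ≤⟨ ≤-by (e₃ K C l) (0≤+ 0≤l (0≤* 0≤c 0≤l)) ⟩
      (1ℚ + K * C) * (2ℚ * l)                 ≤⟨ *-monoˡ 0≤c hv ⟩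
      (1ℚ + K * C) * (p * v)                  ≤⟨ *-monoˡ 0≤c (*-monoʳ 0≤v hp) ⟩
      (1ℚ + K * C) * (3ℚ * n * v)             ≡⟨ e₄ (1ℚ + K * C) n v ⟩
      n * (3ℚ * (1ℚ + K * C) * v)             ∎))
    where
    open ≤-Reasoning
    0≤n : 0ℚ ≤ n
    0≤n = <⇒≤ 0<n
    0≤c : 0ℚ ≤ 1ℚ + K * C
    0≤c = 0≤+ 0≤1 (0≤* 0≤K 0≤C)
    e₁ : ∀ c n q → n * (3ℚ * c * (q * (n * n * n))) ≡ n * (n * n * n) * (3ℚ * c * q)
    e₁ = solve-∀ ringℚ
    e₂ : ∀ n → n * (n * n * n) * n ≡ n * (n * (n * (n * (n * 1ℚ))))
    e₂ = solve-∀ ringℚ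
    e₃ : ∀ a b l → (1ℚ + a * b) * (2ℚ * l) - a * (b * l) ≡ l + (1ℚ + a * b) * l
    e₃ = solve-∀ ringℚ
    e₄ : ∀ c n y → c * (3ℚ * n * y) ≡ n * (3ℚ * c * y)
    e₄ = solve-∀ ringℚ

  growth-from : ∀ (J : Series) → (∃ λ K → 0ℚ ≤ K × (∀ n → pow 5 (ι n) ≤ K * J n)) → (∃ λ C → 0ℚ ≤ C × J ⊑ C · ℓ) →
                ∀ q → Eventually λ n → q * cube (ι n) ≤ y n
  growth-from J (K , 0≤K , h) (C , 0≤C , k) q = suc u₀ , bound
    where
    u₀ : ℕ
    u₀ = proj₁ (archimedean (3ℚ * (1ℚ + K * C) * q))
    bound : ∀ n → suc u₀ ℕ.≤ n → q * cube (ι n) ≤ y n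
    bound (suc m) U<n = growth-step {ι (suc m)} {K} {C} {q} {J (suc m)} {ℓ (suc m)} {y (suc m)} {pp (suc m)}
      (0<ι m) 0≤K 0≤C (0≤ℓ (suc m)) (0≤y (suc m))
      (≤-trans (proj₂ (archimedean (3ℚ * (1ℚ + K * C) * q))) (ι-mono (ℕₚ.<⇒≤ U<n))) (h (suc m)) (k (suc m)) (py≥2ℓ (suc m)) (ppι≤ m)

-- n⁵ = O(ℓ) and ℓ = O(n y) give n⁴ = O(y); the spare factor n absorbs the arbitrary constant.
y-growth : ∀ q → Eventually λ n → q * cube (ι n) ≤ y n
y-growth = growth-from (I^ 6 one) (pow≤I^ 5) (I^≤ℓ 6)

-- The part of b coming from odd cofactors at least 3

cc : Series
cc n = sum n (λ i → sum n (λ j → bTerm (suc i) j n))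

0⊑cc : 0̂ ⊑ cc
0⊑cc n = 0≤sum n (λ i → 0≤sum n (λ j → 0≤bTerm (suc i) j n))

cc-range : ∀ {n} N → n ℕ.≤ N → cc n ≡ sum N (λ i → sum N (λ j → bTerm (suc i) j n))
cc-range {n} N n≤N = sym (trans
  (sum-congˡ N (λ i → sum-stable n≤N (λ j n≤j → bTerm-j (suc i) j n≤j)))
  (sum-stable n≤N (λ i n≤i → sum-zero n (λ j _ → bTerm-i (suc i) j (ℕₚ.m≤n⇒m≤1+n n≤i)))))

first-row : ∀ n → sum n (λ j → bTerm 0 j n) ≡ 2ℚ * ι n
first-row zero        = refl
first-row n@(suc n-1) = begin
  sum n (λ j → bTerm 0 j n)                      ≡⟨ sum-congˡ n term ⟩
  sum n (λ j → 2ℚ * ι n * δ (suc j ℕ.* 1) n)     ≡⟨ sum-* n (2ℚ * ι n) (λ j → δ (suc j ℕ.* 1) n) ⟩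
  2ℚ * ι n * sum n (λ j → δ (suc j ℕ.* 1) n)     ≡⟨ cong (2ℚ * ι n *_) total ⟩
  2ℚ * ι n * 1ℚ                                  ≡⟨ *-identityʳ (2ℚ * ι n) ⟩
  2ℚ * ι n                                       ∎
  where
  open ≡-Reasoning
  total : sum n (λ j → δ (suc j ℕ.* 1) n) ≡ 1ℚ
  total = trans (sym (+-identityˡ (sum n (λ j → δ (suc j ℕ.* 1) n)))) (g1≗I n)
  term : ∀ j → bTerm 0 j n ≡ 2ℚ * ι n * δ (suc j ℕ.* 1) n
  term j = trans (*-assoc 2ℚ (ι (suc j)) (δ (suc j ℕ.* 1) n))
    (trans (cong (2ℚ *_) (trans (cong (λ t → ι t * δ (suc j ℕ.* 1) n) (sym (ℕₚ.*-identityʳ (suc j)))) (ι-δ (suc j ℕ.* 1) n)))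
      (sym (*-assoc 2ℚ (ι n) (δ (suc j ℕ.* 1) n))))

b-split : b ≗ (2ℚ · ι) ⊞ cc
b-split n = trans (sym (sum-stable (ℕₚ.n≤1+n n) (λ i n≤i → sum-zero n (λ j _ → bTerm-i i j n≤i))))
  (cong (_+ cc n) (first-row n))

cc≤b : cc ⊑ b
cc≤b n = ≤-trans (p≤q+p (0≤* (0≤nat 2) (0≤ι n))) (≤-reflexive (sym (b-split n)))

harm≤ι : ∀ n → harm n ≤ ι n
harm≤ι zero    = ≤-refl
harm≤ι (suc n) = ≤-trans (≤-reflexive (sum-last n (λ i → inv (ι (suc i))))) (≤-trans (+-mono-≤ (harm≤ι n) (inv≤1 n)) (≤-reflexive (+-comm (ι n) 1ℚ)))

cc≤ : ∀ {m u} → m ℕ.≤ u → cc m ≤ 2ℚ * (ι u * ι u)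
cc≤ {m} {u} m≤u = ≤-trans (cc≤b m) (≤-trans (b≤harm m) (≤-trans (≤-reflexive (*-assoc 2ℚ (ι m) (harm m)))
  (*-monoˡ (0≤nat 2) (*-mono (0≤ι m) (0≤ι u) (ι-mono m≤u) (≤-trans (harm≤ι m) (ι-mono m≤u))))))

δ-pick : ∀ e u (φ : ℕ → ℚ) → (u ℕ.< e → φ e ≡ 0ℚ) → sum (suc u) (λ m → δ e m * φ m) ≡ φ e
δ-pick zero    u       φ h = trans (cong₂ _+_ (*-identityˡ (φ 0)) (sum-zero u (λ i _ → *-zeroˡ (φ (suc i))))) (+-identityʳ (φ 0))
δ-pick (suc e) zero    φ h = trans (trans (+-identityʳ (0ℚ * φ 0)) (*-zeroˡ (φ 0))) (sym (h (s≤s z≤n)))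
δ-pick (suc e) (suc u) φ h = trans (cong (_+ sum (suc u) (λ m → δ e m * φ (suc m))) (*-zeroˡ (φ 0)))
  (trans (+-identityˡ (sum (suc u) (λ m → δ e m * φ (suc m)))) (δ-pick e u (φ ∘ suc) (λ u<e → h (s≤s u<e))))

-- For antitone w the sum over multiples of d is compared, block by block, with the sum over all integers;
-- both sides of the block inequality agree for the first block, which fixes the constant 3 / ((d + 1) (d + 2)).

wsum : (ℕ → ℚ) → ℕ → ℚ
wsum w M = sum (suc M) (λ m → ι m * ι (suc m) * w m)

module Blocks (w : ℕ → ℚ) (0≤w : ∀ m → 0ℚ ≤ w m) (w-anti : ∀ {m n} → m ℕ.≤ n → w n ≤ w m) where

  private
    τ : ℚ → ℚ
    τ m = m * (1ℚ + m) * (1ℚ + (1ℚ + m))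

  -- τ m = m (m+1) (m+2) is three times the sum of k (k+1) for k ≤ m, and an antitone weight is
  -- least at the right end of the block.
  block≤ : ∀ d M → (τ (ι d + ι M) - τ (ι M)) * w (d ℕ.+ M) ≤ 3ℚ * (wsum w (d ℕ.+ M) - wsum w M)
  block≤ zero    M = ≤-reflexive (eq (ι M) (w M) (wsum w M))
    where
    eq : ∀ m w s → ((0ℚ + m) * (1ℚ + (0ℚ + m)) * (1ℚ + (1ℚ + (0ℚ + m))) - m * (1ℚ + m) * (1ℚ + (1ℚ + m))) * w ≡ 3ℚ * (s - s)
    eq = solve-∀ ringℚ
  block≤ (suc d) M = begin
    (τ (ι (suc d) + ι M) - τ (ι M)) * w₁               ≡⟨ eq (ι d) (ι M) w₁ ⟩
    (τ (ι d + ι M) - τ (ι M)) * w₁ + 3ℚ * ((1ℚ + (ι d + ι M)) * (1ℚ + (1ℚ + (ι d + ι M))) * w₁)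
      ≤⟨ +-monoˡ-≤ r (≤-trans (*-monoˡ (τ-mono (ι M) (0≤ι d) (0≤ι M)) (w-anti (ℕₚ.n≤1+n (d ℕ.+ M)))) (block≤ d M)) ⟩
    3ℚ * (wsum w (d ℕ.+ M) - wsum w M) + r              ≡⟨ eq₂ (wsum w (d ℕ.+ M)) (wsum w M) s ⟩
    3ℚ * (wsum w (d ℕ.+ M) + s - wsum w M)              ≡⟨ cong (λ t → 3ℚ * (wsum w (d ℕ.+ M) + t - wsum w M)) s≡ ⟩
    3ℚ * (wsum w (d ℕ.+ M) + ι (suc (d ℕ.+ M)) * ι (2 ℕ.+ (d ℕ.+ M)) * w₁ - wsum w M)
      ≡⟨ cong (λ t → 3ℚ * (t - wsum w M)) (sym (sum-last (suc (d ℕ.+ M)) (λ m → ι m * ι (suc m) * w m))) ⟩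
    3ℚ * (wsum w (suc d ℕ.+ M) - wsum w M)              ∎
    where
    open ≤-Reasoning
    w₁ s r : ℚ
    w₁ = w (suc d ℕ.+ M)
    s = (1ℚ + (ι d + ι M)) * (1ℚ + (1ℚ + (ι d + ι M))) * w₁
    r = 3ℚ * s
    s≡ : s ≡ ι (suc (d ℕ.+ M)) * ι (2 ℕ.+ (d ℕ.+ M)) * w₁
    s≡ = cong (λ t → (1ℚ + t) * (1ℚ + (1ℚ + t)) * w₁) (sym (ι-+ d M))
    eq : ∀ d m w → ((1ℚ + d + m) * (1ℚ + (1ℚ + d + m)) * (1ℚ + (1ℚ + (1ℚ + d + m))) - m * (1ℚ + m) * (1ℚ + (1ℚ + m))) * w ≡
         ((d + m) * (1ℚ + (d + m)) * (1ℚ + (1ℚ + (d + m))) - m * (1ℚ + m) * (1ℚ + (1ℚ + m))) * w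
         + 3ℚ * ((1ℚ + (d + m)) * (1ℚ + (1ℚ + (d + m))) * w)
    eq = solve-∀ ringℚ
    eq₂ : ∀ a b s → 3ℚ * (a - b) + 3ℚ * s ≡ 3ℚ * (a + s - b)
    eq₂ = solve-∀ ringℚ
    τ-mono : ∀ {d} m → 0ℚ ≤ d → 0ℚ ≤ m → 0ℚ ≤ τ (d + m) - τ m
    τ-mono {d} m 0≤d 0≤m = subst (0ℚ ≤_) (sym (e d m)) (0≤* 0≤d (0≤+ (0≤+ (0≤* (0≤nat 3) (0≤* 0≤m (0≤+ 0≤d 0≤m)))
        (0≤+ (0≤* 0≤d 0≤d) (0≤+ (0≤* (0≤nat 6) 0≤m) (0≤* (0≤nat 3) 0≤d)))) (0≤nat 2)))
      where
      e : ∀ d m → (d + m) * (1ℚ + (d + m)) * (1ℚ + (1ℚ + (d + m))) - m * (1ℚ + m) * (1ℚ + (1ℚ + m)) ≡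
          d * (3ℚ * (m * (d + m)) + (d * d + (nat 6 * m + 3ℚ * d)) + 2ℚ)
      e = solve-∀ ringℚ

  row : ∀ e J → let d = 3 ℕ.+ e in
        ι (suc d) * ι (2 ℕ.+ d) * sum J (λ j → ι (suc j) * (ι (suc j) * ι d) * w (suc j ℕ.* d)) ≤ 3ℚ * wsum w (J ℕ.* d)
  row e zero    = ≤-trans (≤-reflexive (*-zeroʳ (ι (4 ℕ.+ e) * ι (5 ℕ.+ e)))) (0≤* (0≤nat 3) (0≤sum 1 (λ m → 0≤* (0≤* (0≤ι m) (0≤ι (suc m))) (0≤w m))))
  row e (suc J) = begin
    A * sum (suc J) f                            ≡⟨ cong (A *_) (sum-last J f) ⟩
    A * (sum J f + f J)                          ≡⟨ *-distribˡ-+ A (sum J f) (f J) ⟩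
    A * sum J f + A * f J                        ≤⟨ +-mono-≤ (row e J) last ⟩
    3ℚ * wsum w (J ℕ.* d) + 3ℚ * (wsum w (d ℕ.+ J ℕ.* d) - wsum w (J ℕ.* d)) ≡⟨ eq (wsum w (J ℕ.* d)) (wsum w (d ℕ.+ J ℕ.* d)) ⟩
    3ℚ * wsum w (suc J ℕ.* d)                    ∎
    where
    open ≤-Reasoning
    d : ℕ
    d = 3 ℕ.+ e
    A : ℚ
    A = ι (suc d) * ι (2 ℕ.+ d)
    f : ℕ → ℚ
    f j = ι (suc j) * (ι (suc j) * ι d) * w (suc j ℕ.* d)
    eq : ∀ a b → 3ℚ * a + 3ℚ * (b - a) ≡ 3ℚ * b
    eq = solve-∀ ringℚ
    -- The difference vanishes at J = 0, the first block; writing d = 3 + e leaves only nonnegative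
    -- coefficients in the other factor.
    poly : ∀ e J w →
      let d = 1ℚ + (1ℚ + (1ℚ + e)) ; M = J * d in
      ((d + M) * (1ℚ + (d + M)) * (1ℚ + (1ℚ + (d + M))) - M * (1ℚ + M) * (1ℚ + (1ℚ + M))) * w
      - (1ℚ + d) * (1ℚ + (1ℚ + d)) * ((1ℚ + J) * ((1ℚ + J) * d) * w) ≡
      d * J * (nat 7 * J + nat 5 + (nat 9 * (e * J) + nat 6 * e) + (2ℚ * (e * e * J) + e * e)) * w
    poly = solve-∀ ringℚ
    last : A * f J ≤ 3ℚ * (wsum w (d ℕ.+ J ℕ.* d) - wsum w (J ℕ.* d))
    last = ≤-trans (≤-by (poly (ι e) (ι J) (w (d ℕ.+ J ℕ.* d)))
        (0≤* (0≤* (0≤* (0≤ι d) (0≤ι J)) (0≤+ (0≤+ (0≤+ (0≤* (0≤nat 7) (0≤ι J)) (0≤nat 5)) (0≤+ (0≤* (0≤nat 9) (0≤* (0≤ι e) (0≤ι J))) (0≤* (0≤nat 6) (0≤ι e))))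
          (0≤+ (0≤* (0≤nat 2) (0≤* (0≤* (0≤ι e) (0≤ι e)) (0≤ι J))) (0≤* (0≤ι e) (0≤ι e))))) (0≤w (d ℕ.+ J ℕ.* d))))
      (≤-trans (≤-reflexive (cong (λ t → (τ (ι d + t) - τ t) * w (d ℕ.+ J ℕ.* d)) (sym (ι-* J d)))) (block≤ d (J ℕ.* d)))

  wsum-mono : ∀ {m n} → m ℕ.≤ n → wsum w m ≤ wsum w n
  wsum-mono m≤n = sum-mono-range (λ m → 0≤* (0≤* (0≤ι m) (0≤ι (suc m))) (0≤w m)) (s≤s m≤n)

  coefRow : ℕ → ℚ
  coefRow i = nat 6 * (inv (ι (suc (od (suc i)))) * inv (ι (2 ℕ.+ od (suc i))))

  od-suc : ∀ i → od (suc i) ≡ 3 ℕ.+ (i ℕ.+ i)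
  od-suc i = cong (2 ℕ.+_) (ℕₚ.+-suc i i)

  od-suc² : ∀ i → od (2 ℕ.+ i) ≡ 2 ℕ.+ od (suc i)
  od-suc² i = cong (3 ℕ.+_) (ℕₚ.+-suc i (suc i))

  -- Telescopes by 6/((d+1)(d+2)) ≤ 6/(d (d+2)) = 3/d - 3/(d+2), starting from 3/3 at d = 3.
  coefs≤1 : ∀ N → sum N coefRow + 3ℚ * inv (ι (od (suc N))) ≤ 1ℚ
  coefs≤1 zero    = ≤ᵇ⇒≤ _
  coefs≤1 (suc N) = ≤-trans (≤-trans (≤-reflexive (cong₂ (λ s t → s + 3ℚ * inv (ι t)) (sum-last N coefRow) (od-suc² N)))
      (≤-trans (≤-reflexive (+-assoc (sum N coefRow) (coefRow N) (3ℚ * inv (ι (2 ℕ.+ d))))) (+-monoʳ-≤ (sum N coefRow) key))) (coefs≤1 N)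
    where
    d : ℕ
    d = od (suc N)
    i₀ i₁ i₂ : ℚ
    i₀ = inv (ι d)
    i₁ = inv (ι (suc d))
    i₂ = inv (ι (2 ℕ.+ d))
    0<d : 0ℚ < ι d
    0<d = 0<ι (suc N ℕ.+ suc N)
    key : coefRow N + 3ℚ * i₂ ≤ 3ℚ * i₀
    key = ≤-by (modulo₃ (nat 6 * (i₀ * i₁ * i₂)) (3ℚ * i₂ + nat 6 * i₁ * i₂) (3ℚ * i₀) (nat 6 * (i₀ * i₂))
        (e (ι d) i₀ i₁ i₂) (*-inv 0<d) (sym (*-inv (0<ι (suc d)))) (sym (*-inv (0<ι d))))
      (0≤* (0≤nat 6) (0≤* (0≤* (0≤inv 0<d) (0≤inv (0<ι d))) (0≤inv (0<ι (suc d)))))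
      where
      e : ∀ d i j k → 3ℚ * i - (nat 6 * (j * k) + 3ℚ * k) ≡ nat 6 * (i * j * k)
          + (3ℚ * k + nat 6 * j * k) * (d * i - 1ℚ) + 3ℚ * i * (1ℚ - (1ℚ + (1ℚ + d)) * k) + nat 6 * (i * k) * (1ℚ - (1ℚ + d) * j)
      e = solve-∀ ringℚ

module _ (u : ℕ) (w : ℕ → ℚ) (0≤w : ∀ m → 0ℚ ≤ w m) (w-anti : ∀ {m n} → m ℕ.≤ n → w n ≤ w m)
         (w-zero : ∀ {m} → u ℕ.< m → w m ≡ 0ℚ) where

  open Blocks w 0≤w w-anti

  private
    W : ℚ
    W = wsum w u

    0≤W : 0ℚ ≤ W
    0≤W = 0≤sum (suc u) (λ m → 0≤* (0≤* (0≤ι m) (0≤ι (suc m))) (0≤w m))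

    wsum≤W : ∀ M → wsum w M ≤ W
    wsum≤W M with ℕₚ.≤-total M u
    ... | inj₁ M≤u = wsum-mono M≤u
    ... | inj₂ u≤M = ≤-reflexive (sum-stable (s≤s u≤M) (λ m u<m → trans (cong (ι m * ι (suc m) *_) (w-zero u<m)) (*-zeroʳ (ι m * ι (suc m)))))

    rowTerm : ℕ → ℕ → ℚ
    rowTerm d j = ι (suc j) * (ι (suc j) * ι d) * w (suc j ℕ.* d)

    row-bound : ∀ i d → d ≡ 3 ℕ.+ (i ℕ.+ i) → 2ℚ * sum u (rowTerm d) ≤ nat 6 * (inv (ι (suc d)) * inv (ι (2 ℕ.+ d))) * W
    row-bound i d refl = *-cancelˡ (0<* (0<ι d) (0<ι (suc d))) (begin
      ι (suc d) * ι (2 ℕ.+ d) * (2ℚ * sum u (rowTerm d))   ≡⟨ e₁ (ι (suc d) * ι (2 ℕ.+ d)) (sum u (rowTerm d)) ⟩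
      2ℚ * (ι (suc d) * ι (2 ℕ.+ d) * sum u (rowTerm d))   ≤⟨ *-monoˡ (0≤nat 2) (row (i ℕ.+ i) u) ⟩
      2ℚ * (3ℚ * wsum w (u ℕ.* d))                         ≤⟨ *-monoˡ (0≤nat 2) (*-monoˡ (0≤nat 3) (wsum≤W (u ℕ.* d))) ⟩
      2ℚ * (3ℚ * W)                                        ≡⟨ modulo₃ (ι (suc d) * ι (2 ℕ.+ d) * (nat 6 * (inv (ι (suc d)) * inv (ι (2 ℕ.+ d))) * W)) (- (nat 6 * W)) (- (nat 6 * W * ι (suc d) * inv (ι (suc d)))) 0ℚ
                                                               (e₂ W (ι (suc d)) (ι (2 ℕ.+ d)) (inv (ι (suc d))) (inv (ι (2 ℕ.+ d)))) (*-inv (0<ι d)) (*-inv (0<ι (suc d))) (refl {x = 0ℚ}) ⟩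
      ι (suc d) * ι (2 ℕ.+ d) * (nat 6 * (inv (ι (suc d)) * inv (ι (2 ℕ.+ d))) * W) ∎)
      where
      open ≤-Reasoning
      e₁ : ∀ a s → a * (2ℚ * s) ≡ 2ℚ * (a * s)
      e₁ = solve-∀ ringℚ
      e₂ : ∀ W a b i j → 2ℚ * (3ℚ * W) ≡ a * b * (nat 6 * (i * j) * W)
           + (- (nat 6 * W)) * (a * i - 1ℚ) + (- (nat 6 * W * a * i)) * (b * j - 1ℚ) + 0ℚ * (0ℚ - 0ℚ)
      e₂ = solve-∀ ringℚ

    expand : sum (suc u) (λ m → cc m * (ι m * w m)) ≡ sum u (λ i → 2ℚ * sum u (rowTerm (od (suc i))))
    expand = begin
      sum (suc u) (λ m → cc m * (ι m * w m))
        ≡⟨ sum-cong (suc u) (λ { m (s≤s m≤u) → trans (cong (_* (ι m * w m)) (cc-range u m≤u))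
             (trans (sym (sum-*ʳ u (ι m * w m) (λ i → sum u (λ j → bTerm (suc i) j m))))
               (sum-congˡ u (λ i → sym (sum-*ʳ u (ι m * w m) (λ j → bTerm (suc i) j m))))) }) ⟩
      sum (suc u) (λ m → sum u (λ i → sum u (λ j → bTerm (suc i) j m * (ι m * w m))))
        ≡⟨ sum-swap (suc u) u (λ m i → sum u (λ j → bTerm (suc i) j m * (ι m * w m))) ⟩
      sum u (λ i → sum (suc u) (λ m → sum u (λ j → bTerm (suc i) j m * (ι m * w m))))
        ≡⟨ sum-congˡ u (λ i → trans (sum-swap (suc u) u (λ m j → bTerm (suc i) j m * (ι m * w m)))
             (trans (sum-congˡ u (λ j → cell i j)) (sum-* u 2ℚ (rowTerm (od (suc i)))))) ⟩
      sum u (λ i → 2ℚ * sum u (rowTerm (od (suc i)))) ∎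
      where
      open ≡-Reasoning
      e₁ : ∀ a d φ → 2ℚ * a * d * φ ≡ 2ℚ * a * (d * φ)
      e₁ = solve-∀ ringℚ
      e₂ : ∀ a d w → 2ℚ * a * (a * d * w) ≡ 2ℚ * (a * (a * d) * w)
      e₂ = solve-∀ ringℚ
      cell : ∀ i j → sum (suc u) (λ m → bTerm (suc i) j m * (ι m * w m)) ≡ 2ℚ * rowTerm (od (suc i)) j
      cell i j = trans (sum-congˡ (suc u) (λ m → e₁ (ι (suc j)) (δ (expo (suc i) j) m) (ι m * w m)))
        (trans (sum-* (suc u) (2ℚ * ι (suc j)) (λ m → δ (expo (suc i) j) m * (ι m * w m)))
          (trans (cong (2ℚ * ι (suc j) *_) (trans
            (δ-pick (expo (suc i) j) u (λ m → ι m * w m) (λ u<e → trans (cong (ι (expo (suc i) j) *_) (w-zero u<e)) (*-zeroʳ (ι (expo (suc i) j)))))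
            (cong (_* w (expo (suc i) j)) (ι-* (suc j) (od (suc i))))))
            (e₂ (ι (suc j)) (ι (od (suc i))) (w (expo (suc i) j)))))

  -- For w m = exp (-m s) with small s the left side is about 4/s³ times the sum of 1/d² over odd d
  -- ≥ 3, the right side about 2/s³; the true quotient is therefore below 1/2.
  cc-weighted : sum (suc u) (λ m → cc m * (ι m * w m)) ≤ wsum w u
  cc-weighted = begin
    sum (suc u) (λ m → cc m * (ι m * w m))             ≡⟨ expand ⟩
    sum u (λ i → 2ℚ * sum u (rowTerm (od (suc i))))    ≤⟨ sum-mono u (λ i _ → row-bound i (od (suc i)) (od-suc i)) ⟩
    sum u (λ i → coefRow i * W)                        ≡⟨ sum-*ʳ u W coefRow ⟩
    sum u coefRow * W                                  ≤⟨ *-monoʳ 0≤W (≤-trans (p≤p+q {sum u coefRow} (0≤* (0≤nat 3) (0≤inv (0<ι (suc u ℕ.+ suc u))))) (coefs≤1 u)) ⟩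
    1ℚ * W                                             ≡⟨ *-identityˡ W ⟩
    W                                                  ∎
    where open ≤-Reasoning

-- Truncation below V

from : ℕ → Series → Series
from V a = sh V (a ∘ (V ℕ.+_))

from-< : ∀ {V n} a → n ℕ.< V → from V a n ≡ 0ℚ
from-< {V} a = sh-< (a ∘ (V ℕ.+_))

from-≥ : ∀ {V n} a → V ℕ.≤ n → from V a n ≡ a n
from-≥ {V} a V≤n = trans (sh-≥ (a ∘ (V ℕ.+_)) V≤n) (cong a (ℕₚ.m+[n∸m]≡n V≤n))

below : ℕ → Series → Series
below V a v = a v - from V a v

below-< : ∀ {V v} a → v ℕ.< V → below V a v ≡ a v
below-< {V} {v} a v<V = trans (cong (λ s → a v - s) (from-< a v<V)) (+-identityʳ (a v))

below-≥ : ∀ {V v} a → V ℕ.≤ v → below V a v ≡ 0ℚ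
below-≥ {V} {v} a V≤v = trans (cong (λ s → a v - s) (from-≥ a V≤v)) (+-inverseʳ (a v))

0⊑below : ∀ V a → 0̂ ⊑ a → 0̂ ⊑ below V a
0⊑below V a 0≤a v with ℕₚ.<-≤-connex v V
... | inj₁ v<V = subst (0ℚ ≤_) (sym (below-< a v<V)) (0≤a v)
... | inj₂ V≤v = ≤-reflexive (sym (below-≥ a V≤v))

below-sum : ∀ V a → 0̂ ⊑ a → ∀ N → sum N (below V a) ≤ sum V a
below-sum V a 0≤a N = ≤-trans (sum-mono-range (0⊑below V a 0≤a) (ℕₚ.m≤n+m N V)) (≤-trans (≤-reflexive (sum-stable (ℕₚ.m≤m+n V N) (λ i → below-≥ {V} {i} a)))
    (≤-reflexive (sum-cong V (λ i → below-< {V} {i} a))))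

-- A discrete comparison principle. The vanishing below `V` is returned as well, so that the
-- principle can be iterated although the difference inequalities hold only from `V` on.
partial-sums≤ : ∀ V (h a : Series) → (∀ n → n ℕ.< V → h n ≡ 0ℚ) → (∀ n → 0ℚ ≤ a n) →
                (∀ n → V ℕ.≤ n → h n ≤ a (suc n) - a n) →
                (∀ n → n ℕ.< V → (I ⊛ h) n ≡ 0ℚ) × (∀ n → (I ⊛ h) n ≤ a (suc n))
partial-sums≤ V h a h-zero 0≤a step = zeros , bound
  where
  zeros : ∀ n → n ℕ.< V → (I ⊛ h) n ≡ 0ℚ
  zeros zero    n<V = trans (+-identityʳ (1ℚ * h 0)) (trans (*-identityˡ (h 0)) (h-zero 0 n<V))
  zeros (suc n) n<V = trans (I⊛-suc h n) (trans (cong₂ _+_ (h-zero (suc n) n<V) (zeros n (ℕₚ.<-trans (ℕₚ.n<1+n n) n<V))) (+-identityʳ 0ℚ))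
  eq : ∀ s t → s - t + t ≡ s
  eq = solve-∀ ringℚ
  bound : ∀ n → (I ⊛ h) n ≤ a (suc n)
  bound n with ℕₚ.<-≤-connex n V
  bound n       | inj₁ n<V = ≤-trans (≤-reflexive (zeros n n<V)) (0≤a (suc n))
  bound zero    | inj₂ V≤n = ≤-trans (≤-reflexive (trans (+-identityʳ (1ℚ * h 0)) (*-identityˡ (h 0))))
    (≤-trans (step 0 V≤n) (≤-by (e (a 1) (a 0)) (0≤a 0)))
    where
    e : ∀ s t → s - (s - t) ≡ t
    e = solve-∀ ringℚ
  bound (suc n) | inj₂ V≤n = ≤-trans (≤-reflexive (I⊛-suc h n)) (≤-trans (+-mono-≤ (step (suc n) V≤n) (bound n)) (≤-reflexive (eq (a (2 ℕ.+ n)) (a (suc n)))))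

triple-partial-sums≤ : ∀ V (h a₁ a₂ a₃ : Series) → (∀ n → n ℕ.< V → h n ≡ 0ℚ) →
  (∀ n → 0ℚ ≤ a₁ n) → (∀ n → 0ℚ ≤ a₂ n) → (∀ n → 0ℚ ≤ a₃ n) →
  (∀ n → V ℕ.≤ n → h n ≤ a₁ (suc n) - a₁ n) → (∀ n → V ℕ.≤ n → a₁ n ≤ a₂ (suc n) - a₂ n) →
  (∀ n → V ℕ.≤ n → a₂ n ≤ a₃ (suc n) - a₃ n) → ∀ n → (I ⊛ (I ⊛ (I ⊛ h))) n ≤ a₃ (3 ℕ.+ n)
triple-partial-sums≤ V h a₁ a₂ a₃ h-zero p₁ p₂ p₃ s₁ s₂ s₃ = proj₂ third
  where
  first  = partial-sums≤ V h a₁ h-zero p₁ s₁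
  second = partial-sums≤ V (I ⊛ h) (λ n → a₂ (suc n)) (proj₁ first) (λ n → p₂ (suc n))
    (λ n V≤n → ≤-trans (proj₂ first n) (s₂ (suc n) (ℕₚ.m≤n⇒m≤1+n V≤n)))
  third  = partial-sums≤ V (I ⊛ (I ⊛ h)) (λ n → a₃ (2 ℕ.+ n)) (proj₁ second) (λ n → p₃ (2 ℕ.+ n))
    (λ n V≤n → ≤-trans (proj₂ second n) (s₃ (2 ℕ.+ n) (ℕₚ.m≤n⇒m≤1+n (ℕₚ.m≤n⇒m≤1+n V≤n))))

Large-mono : ∀ {V n} → Large V → V ℕ.≤ n → Large n
Large-mono hV V≤n = ≤-trans hV (ι-mono (s≤s (s≤s V≤n)))

-- Extension by zero beyond `u` keeps the reversed weight antitone on all of ℕ, where the block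
-- comparison lives.
module Reversed (u : ℕ) (a : Series) (0≤a : 0̂ ⊑ a) (a-mono : ∀ {m n} → m ℕ.≤ n → a m ≤ a n) where

  w : ℕ → ℚ
  w m with m ℕₚ.≤? u
  ... | yes _ = a (u ∸ m)
  ... | no  _ = 0ℚ

  w-≤ : ∀ {m} → m ℕ.≤ u → w m ≡ a (u ∸ m)
  w-≤ {m} m≤u with m ℕₚ.≤? u
  ... | yes _   = refl
  ... | no  m≰u = ⊥-elim (m≰u m≤u)

  w-> : ∀ {m} → u ℕ.< m → w m ≡ 0ℚ
  w-> {m} u<m with m ℕₚ.≤? u
  ... | yes m≤u = ⊥-elim (ℕₚ.<⇒≱ u<m m≤u)
  ... | no  _   = refl

  0≤w : ∀ m → 0ℚ ≤ w m
  0≤w m with m ℕₚ.≤? u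
  ... | yes _ = 0≤a (u ∸ m)
  ... | no  _ = ≤-refl

  w-anti : ∀ {m n} → m ℕ.≤ n → w n ≤ w m
  w-anti {m} {n} m≤n with ℕₚ.<-≤-connex u n
  ... | inj₁ u<n = ≤-trans (≤-reflexive (w-> u<n)) (0≤w m)
  ... | inj₂ n≤u = subst₂ _≤_ (sym (w-≤ n≤u)) (sym (w-≤ (ℕₚ.≤-trans m≤n n≤u))) (a-mono (ℕₚ.∸-monoʳ-≤ u m≤n))

reversed-moment≤ : ∀ u (a : Series) → 0̂ ⊑ a → (∀ {m n} → m ℕ.≤ n → a m ≤ a n) →
                   sum (suc u) (λ m → cc m * (ι m * a (u ∸ m))) ≤ sum (suc u) (λ m → ι m * ι (suc m) * a (u ∸ m))
reversed-moment≤ u a 0≤a a-mono = subst₂ _≤_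
  (sum-cong (suc u) (λ { m (s≤s m≤u) → cong (λ t → cc m * (ι m * t)) (w-≤ m≤u) }))
  (sum-cong (suc u) (λ { m (s≤s m≤u) → cong (ι m * ι (suc m) *_) (w-≤ m≤u) }))
  (cc-weighted u w 0≤w w-anti (λ {m} → w-> {m}))
  where open Reversed u a 0≤a (λ {m} {n} → a-mono {m} {n})

module _ (V : ℕ) (hV : Large V) where

  -- `γ` increases only on large indices; replacing its beginning by zero makes it increase
  -- everywhere.
  γ̂ : Series
  γ̂ = from V γ

  0⊑γ̂ : 0̂ ⊑ γ̂
  0⊑γ̂ = 0⊑sh V (λ i → 0≤γ (V ℕ.+ i))

  γ̂-suc : ∀ n → γ̂ n ≤ γ̂ (suc n)
  γ̂-suc n = go (ℕₚ.<-≤-connex n V)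
    where
    go : n ℕ.< V ⊎ V ℕ.≤ n → γ̂ n ≤ γ̂ (suc n)
    go (inj₁ n<V) = ≤-trans (≤-reflexive (from-< γ n<V)) (0⊑γ̂ (suc n))
    go (inj₂ V≤n) = subst₂ _≤_ (sym (from-≥ γ V≤n)) (sym (from-≥ γ (ℕₚ.m≤n⇒m≤1+n V≤n))) (γ-mono {n} (Large-mono {V} {n} hV V≤n))

  γ̂-mono : ∀ {m n} → m ℕ.≤ n → γ̂ m ≤ γ̂ n
  γ̂-mono = Monotone-≤ {γ̂} γ̂-suc

  triple-sum : ∀ n → (I ⊛ (I ⊛ (I ⊛ (nat 100 · γ̂)))) n ≤ sup₃ (3 ℕ.+ n)
  triple-sum = triple-partial-sums≤ V (nat 100 · γ̂) sup₁ sup₂ sup₃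
    (λ n n<V → trans (cong (nat 100 *_) (from-< γ n<V)) (*-zeroʳ (nat 100))) 0≤sup₁ 0≤sup₂ 0≤sup₃
    (λ n V≤n → subst (λ t → nat 100 * t ≤ sup₁ (suc n) - sup₁ n) (sym (from-≥ γ V≤n)) (step₁ {n} (Large-mono {V} {n} hV V≤n)))
    (λ n V≤n → step₂ {n} (Large-mono {V} {n} hV V≤n))
    (λ n V≤n → step₃ {n} (Large-mono {V} {n} hV V≤n))

  private
    rising : Series
    rising m = ι m * ι (suc m)

    III : ∀ n → rising (suc n) ≡ 2ℚ * (I ⊛ (I ⊛ I)) n
    III zero    = refl
    III (suc n) = trans (eq (ι n)) (trans (cong₂ (λ s t → 2ℚ * s + t) (sym (II (suc n))) (III n))
      (trans (sym (*-distribˡ-+ 2ℚ ((I ⊛ I) (suc n)) ((I ⊛ (I ⊛ I)) n))) (cong (2ℚ *_) (sym (I⊛-suc (I ⊛ I) n)))))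
      where
      eq : ∀ n → (1ℚ + (1ℚ + n)) * (1ℚ + (1ℚ + (1ℚ + n))) ≡ 2ℚ * (1ℚ + (1ℚ + n)) + (1ℚ + n) * (1ℚ + (1ℚ + n))
      eq = solve-∀ ringℚ

    rising≗ : rising ≗ 2ℚ · sh 1 (I ⊛ (I ⊛ I))
    rising≗ zero    = refl
    rising≗ (suc n) = III n

    rising-⊛ : ∀ a u → (rising ⊛ a) u ≡ 2ℚ * sh 1 (I ⊛ (I ⊛ (I ⊛ a))) u
    rising-⊛ a u = trans (⊛-congʳ a rising≗ u) (trans (·-⊛ 2ℚ (sh 1 (I ⊛ (I ⊛ I))) a u) (cong (2ℚ *_)
      (trans (sh-⊛ 1 (I ⊛ (I ⊛ I)) a u) (sh-cong 1 (λ n → trans (⊛-assoc I (I ⊛ I) a n) (⊛-congˡ I (⊛-assoc I I a) n)) u))))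

  -- The numbers m (m+1) are the coefficients of 2 q/(1 - q)³, so this moment is a triple partial
  -- sum, bounded by the last supersolution.
  γ̂-wsum : ∀ u → nat 100 * (rising ⊛ γ̂) u ≤ 2ℚ * sup₃ (2 ℕ.+ u)
  γ̂-wsum u = ≤-trans (≤-reflexive (trans (sym (trans (⊛-comm rising (nat 100 · γ̂) u) (trans (·-⊛ (nat 100) γ̂ rising u) (cong (nat 100 *_) (⊛-comm γ̂ rising u)))))
      (rising-⊛ (nat 100 · γ̂) u))) (*-monoˡ (0≤nat 2) (lem u))
    where
    lem : ∀ u → sh 1 (I ⊛ (I ⊛ (I ⊛ (nat 100 · γ̂)))) u ≤ sup₃ (2 ℕ.+ u)
    lem zero    = 0≤sup₃ 2
    lem (suc n) = triple-sum n

  moment≤ : ∀ u → nat 100 * sum (suc u) (λ m → cc m * (ι m * γ̂ (u ∸ m))) ≤ 2ℚ * sup₃ (2 ℕ.+ u)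
  moment≤ u = ≤-trans (*-monoˡ (0≤nat 100) (reversed-moment≤ u γ̂ 0⊑γ̂ γ̂-mono)) (γ̂-wsum u)

-- The curvature lost by mixing, X, is at most 9/10 of the curvature t of log ℓ.

ℓQ : Series
ℓQ v = ℓ v * Q v

-- `t u` is the deficit ℓ (u+1)²/ℓ u - ℓ (u+2). `X u` weights the increments of `Q` with `cc` (see
-- `X-sum`); its average over the mixture bounds the variance of `x`.
X t : ℕ → ℚ
X u = (cc ⊛ ℓ) u * Q u - (cc ⊛ ℓQ) u
t u = T u * inv (ℓ u)

0≤t : ∀ u → 0ℚ ≤ t u
0≤t u = 0≤* (0≤T u) (0≤inv (0<ℓ u))

X-sum : ∀ u → X u ≡ sum (suc u) (λ m → cc m * (ℓ (u ∸ m) * (Q u - Q (u ∸ m))))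
X-sum u = sym (begin
  sum (suc u) (λ m → cc m * (ℓ (u ∸ m) * (Q u - Q (u ∸ m))))
    ≡⟨ sum-congˡ (suc u) (λ m → eq (cc m) (ℓ (u ∸ m)) (Q u) (Q (u ∸ m))) ⟩
  sum (suc u) (λ m → cc m * ℓ (u ∸ m) * Q u + - 1ℚ * (cc m * ℓQ (u ∸ m)))
    ≡⟨ sum-+ (suc u) (λ m → cc m * ℓ (u ∸ m) * Q u) (λ m → - 1ℚ * (cc m * ℓQ (u ∸ m))) ⟩
  sum (suc u) (λ m → cc m * ℓ (u ∸ m) * Q u) + sum (suc u) (λ m → - 1ℚ * (cc m * ℓQ (u ∸ m)))
    ≡⟨ cong₂ _+_ (sum-*ʳ (suc u) (Q u) (λ m → cc m * ℓ (u ∸ m))) (sum-* (suc u) (- 1ℚ) (λ m → cc m * ℓQ (u ∸ m))) ⟩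
  (cc ⊛ ℓ) u * Q u + - 1ℚ * (cc ⊛ ℓQ) u
    ≡⟨ eq₂ ((cc ⊛ ℓ) u * Q u) ((cc ⊛ ℓQ) u) ⟩
  X u ∎)
  where
  open ≡-Reasoning
  eq : ∀ c l q r → c * (l * (q - r)) ≡ c * l * q + - 1ℚ * (c * (l * r))
  eq = solve-∀ ringℚ
  eq₂ : ∀ a b → a + - 1ℚ * b ≡ a - b
  eq₂ = solve-∀ ringℚ

ip-anti : ∀ n → ip (suc n) ≤ ip n
ip-anti n = *-cancelˡ (0<* (0<pp n) (0<pp (suc n))) (subst₂ _≤_ (sym (trans (e₁ (pp n) (pp (suc n)) (ip (suc n))) (trans (cong (pp n *_) (p*ip (suc n))) (*-identityʳ (pp n)))))
  (sym (trans (e₂ (pp n) (pp (suc n)) (ip n)) (trans (cong (pp (suc n) *_) (p*ip n)) (*-identityʳ (pp (suc n)))))) (p≤q+p 0≤1))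
  where
  e₁ : ∀ a b c → a * b * c ≡ a * (b * c)
  e₁ = solve-∀ ringℚ
  e₂ : ∀ a b c → a * b * c ≡ b * (a * c)
  e₂ = solve-∀ ringℚ

W₃ : ℕ → ℚ
W₃ v = ip v * ip (1 ℕ.+ v) * ip (2 ℕ.+ v)

0≤W₃ : ∀ v → 0ℚ ≤ W₃ v
0≤W₃ v = 0≤* (0≤* (0≤ip v) (0≤ip (1 ℕ.+ v))) (0≤ip (2 ℕ.+ v))

W₃-anti : ∀ m v → W₃ (m ℕ.+ v) ≤ W₃ v
W₃-anti zero    v = ≤-refl
W₃-anti (suc m) v = ≤-trans (*-mono (0≤* (0≤ip (1 ℕ.+ k)) (0≤ip (2 ℕ.+ k))) (0≤ip (2 ℕ.+ k)) (*-mono (0≤ip (1 ℕ.+ k)) (0≤ip (1 ℕ.+ k)) (ip-anti k) (ip-anti (1 ℕ.+ k))) (ip-anti (2 ℕ.+ k))) (W₃-anti m v)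
  where
  k : ℕ
  k = m ℕ.+ v

D²≤ : ∀ n → Large n → nat 25 * (D n * D n) ≤ nat 14 * W₃ n
D²≤ n h = subst (_≤ nat 14 * W₃ n) eq (*-monoʳ (0≤W₃ n) (D-bound {n} h))
  where
  e : ∀ p q r i j k d → nat 25 * (p * q * r * d) * (i * j * k) ≡ nat 25 * d
      + nat 25 * (q * r * d * j * k) * (p * i - 1ℚ) + nat 25 * (r * d * k) * (q * j - 1ℚ) + nat 25 * d * (r * k - 1ℚ)
  e = solve-∀ ringℚ
  eq : nat 25 * (pp n * pp (1 ℕ.+ n) * pp (2 ℕ.+ n) * (D n * D n)) * W₃ n ≡ nat 25 * (D n * D n)
  eq = modulo₃ (nat 25 * (D n * D n)) (nat 25 * (pp (1 ℕ.+ n) * pp (2 ℕ.+ n) * (D n * D n) * ip (1 ℕ.+ n) * ip (2 ℕ.+ n)))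
    (nat 25 * (pp (2 ℕ.+ n) * (D n * D n) * ip (2 ℕ.+ n))) (nat 25 * (D n * D n))
    (e (pp n) (pp (1 ℕ.+ n)) (pp (2 ℕ.+ n)) (ip n) (ip (1 ℕ.+ n)) (ip (2 ℕ.+ n)) (D n * D n)) (p*ip n) (p*ip (1 ℕ.+ n)) (p*ip (2 ℕ.+ n))

Q-diff-large : ∀ m v → Large v → nat 25 * (Q (m ℕ.+ v) - Q v) ≤ nat 14 * (ι m * W₃ v)
Q-diff-large zero    v h = ≤-reflexive (eq (Q v) (W₃ v))
  where
  eq : ∀ q w → nat 25 * (q - q) ≡ nat 14 * (0ℚ * w)
  eq = solve-∀ ringℚ
Q-diff-large (suc m) v h = begin
  nat 25 * (Q (suc m ℕ.+ v) - Q v)                                ≡⟨ cong (λ q → nat 25 * (q - Q v)) (Q-suc (m ℕ.+ v)) ⟩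
  nat 25 * (Q (m ℕ.+ v) + D (m ℕ.+ v) * D (m ℕ.+ v) - Q v)         ≡⟨ e₁ (Q (m ℕ.+ v)) (D (m ℕ.+ v) * D (m ℕ.+ v)) (Q v) ⟩
  nat 25 * (Q (m ℕ.+ v) - Q v) + nat 25 * (D (m ℕ.+ v) * D (m ℕ.+ v)) ≤⟨ +-mono-≤ (Q-diff-large m v h)
      (≤-trans (D²≤ (m ℕ.+ v) (Large-mono {v} {m ℕ.+ v} h (ℕₚ.m≤n+m v m))) (*-monoˡ (0≤nat 14) (W₃-anti m v))) ⟩
  nat 14 * (ι m * W₃ v) + nat 14 * W₃ v                            ≡⟨ e₂ (ι m) (W₃ v) ⟩
  nat 14 * (ι (suc m) * W₃ v)                                      ∎
  where
  open ≤-Reasoning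
  e₁ : ∀ a b c → nat 25 * (a + b - c) ≡ nat 25 * (a - c) + nat 25 * b
  e₁ = solve-∀ ringℚ
  e₂ : ∀ m w → nat 14 * (m * w) + nat 14 * w ≡ nat 14 * ((1ℚ + m) * w)
  e₂ = solve-∀ ringℚ

y-two : ∀ u → Large u → nat 10 * y (2 ℕ.+ u) ≤ nat 11 * y u
y-two u h = ≤-by (e (y u) (z u) (z (suc u))) (0≤+ (0≤* (0≤nat 10) (0≤* {ℤ.+ 1 / 50} (≤ᵇ⇒≤ _) (p≤q⇒0≤q-p (50z≤ (suc u) (Large-mono {u} {suc u} h (ℕₚ.n≤1+n u))))))
    (0≤+ (0≤* {ℤ.+ 51 / 250} (≤ᵇ⇒≤ _) (p≤q⇒0≤q-p (50z≤ u h))) (0≤* {ℤ.+ 149 / 250} (≤ᵇ⇒≤ _) (0≤y u))))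
  where
  50z≤ : ∀ u → Large u → nat 50 * z u ≤ y u
  50z≤ u h = *-cancelˡ (0<pp u) (≤-trans (≤-reflexive (trans (e₁ (pp u) (z u)) (trans (cong (nat 50 *_) (pz u)) (e₂ (ℓ u))))) (100ℓ≤py {u} h))
    where
    e₁ : ∀ p z → p * (nat 50 * z) ≡ nat 50 * (p * z)
    e₁ = solve-∀ ringℚ
    e₂ : ∀ l → nat 50 * (2ℚ * l) ≡ nat 100 * l
    e₂ = solve-∀ ringℚ
  e : ∀ y z z′ → nat 11 * y - nat 10 * (y + z + z′) ≡
      nat 10 * ((ℤ.+ 1 / 50) * (y + z - nat 50 * z′)) + ((ℤ.+ 51 / 250) * (y - nat 50 * z) + (ℤ.+ 149 / 250) * y)
  e = solve-∀ ringℚ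

t-lower : ∀ n → y (suc n) * ip (suc n) ≤ 2ℚ * t (suc n)
t-lower m = subst₂ _≤_ eq₁ eq₂ (*-monoʳ (0≤* (0≤inv (0<ℓ n)) (0≤ip n)) (T-lower m))
  where
  n : ℕ
  n = suc m
  e₁ : ∀ a l j i → a * l * (j * i) ≡ a * i + a * i * (l * j - 1ℚ)
  e₁ = solve-∀ ringℚ
  eq₁ : y n * ℓ n * (inv (ℓ n) * ip n) ≡ y n * ip n
  eq₁ = modulo {c = y n * ip n} (e₁ (y n) (ℓ n) (inv (ℓ n)) (ip n)) (*-inv (0<ℓ n))
  e₂ : ∀ p t j i → 2ℚ * (p * t) * (j * i) ≡ 2ℚ * (t * j) + 2ℚ * (t * j) * (p * i - 1ℚ)
  e₂ = solve-∀ ringℚ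
  eq₂ : 2ℚ * (pp n * T n) * (inv (ℓ n) * ip n) ≡ 2ℚ * t n
  eq₂ = modulo {c = 2ℚ * t n} (e₂ (pp n) (T n) (inv (ℓ n)) (ip n)) (p*ip n)

private
  -- In units of y/(n+2) the main part is at most 14/25 · 60/100 = 0.336 and the initial part `L` at
  -- most 0.1, while `t` is at least 0.5; and 0.436 ≤ 0.9 · 0.5.
  X-final : ∀ {X M L t y y₂ i i₂ p n K : ℚ} → 0ℚ ≤ i → 0ℚ ≤ y → 0ℚ ≤ y₂ → 0ℚ ≤ K → 0ℚ ≤ n → p * i ≡ 1ℚ → p ≤ 3ℚ * n → i₂ ≤ i →
    nat 25 * X ≤ nat 14 * M + nat 25 * L → nat 100 * M ≤ 2ℚ * (nat 27 * y₂ * i₂) → nat 10 * y₂ ≤ nat 11 * y →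
    L ≤ 2ℚ * (n * n) * K → nat 60 * K * cube n ≤ y → y * i ≤ 2ℚ * t → nat 10 * X ≤ nat 9 * t
  X-final {X} {M} {L} {t} {y} {y₂} {i} {i₂} {p} {n} {K} 0≤i 0≤y 0≤y₂ 0≤K 0≤n pi p≤ i₂≤ h₁ h₂ h₃ h₄ h₅ h₆ =
    *-cancelˡ {nat 250} (positive⁻¹ (nat 250)) (begin
      nat 250 * (nat 10 * X)                          ≡⟨ e₁ X ⟩
      nat 100 * (nat 25 * X)                          ≤⟨ *-monoˡ (0≤nat 100) h₁ ⟩
      nat 100 * (nat 14 * M + nat 25 * L)             ≡⟨ e₂ M L ⟩
      nat 14 * (nat 100 * M) + nat 250 * (nat 10 * L) ≤⟨ +-mono-≤ (*-monoˡ (0≤nat 14) M≤) (*-monoˡ (0≤nat 250) L≤) ⟩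
      nat 14 * (nat 60 * (y * i)) + nat 250 * (y * i) ≤⟨ ≤-by (e₃ (y * i)) (0≤* (0≤nat 35) (0≤* 0≤y 0≤i)) ⟩
      nat 1125 * (y * i)                              ≤⟨ *-monoˡ (0≤nat 1125) h₆ ⟩
      nat 1125 * (2ℚ * t)                             ≡⟨ e₄ t ⟩
      nat 250 * (nat 9 * t)                           ∎)
    where
    open ≤-Reasoning
    e₁ : ∀ X → nat 250 * (nat 10 * X) ≡ nat 100 * (nat 25 * X)
    e₁ = solve-∀ ringℚ
    e₂ : ∀ M L → nat 100 * (nat 14 * M + nat 25 * L) ≡ nat 14 * (nat 100 * M) + nat 250 * (nat 10 * L)
    e₂ = solve-∀ ringℚ
    e₃ : ∀ a → nat 1125 * a - (nat 14 * (nat 60 * a) + nat 250 * a) ≡ nat 35 * a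
    e₃ = solve-∀ ringℚ
    e₄ : ∀ t → nat 1125 * (2ℚ * t) ≡ nat 250 * (nat 9 * t)
    e₄ = solve-∀ ringℚ
    M≤ : nat 100 * M ≤ nat 60 * (y * i)
    M≤ = begin
      nat 100 * M                              ≤⟨ h₂ ⟩
      2ℚ * (nat 27 * y₂ * i₂)                  ≤⟨ *-monoˡ (0≤nat 2) (*-monoˡ (0≤* (0≤nat 27) 0≤y₂) i₂≤) ⟩
      2ℚ * (nat 27 * y₂ * i)                   ≡⟨ f₁ y₂ i ⟩
      (ℤ.+ 27 / 5) * i * (nat 10 * y₂)         ≤⟨ *-monoˡ (0≤* {ℤ.+ 27 / 5} (≤ᵇ⇒≤ _) 0≤i) h₃ ⟩
      (ℤ.+ 27 / 5) * i * (nat 11 * y)          ≤⟨ ≤-by (f₂ y i) (0≤* {ℤ.+ 3 / 5} (≤ᵇ⇒≤ _) (0≤* 0≤y 0≤i)) ⟩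
      nat 60 * (y * i)                         ∎
      where
      f₁ : ∀ a b → 2ℚ * (nat 27 * a * b) ≡ (ℤ.+ 27 / 5) * b * (nat 10 * a)
      f₁ = solve-∀ ringℚ
      f₂ : ∀ y i → nat 60 * (y * i) - (ℤ.+ 27 / 5) * i * (nat 11 * y) ≡ (ℤ.+ 3 / 5) * (y * i)
      f₂ = solve-∀ ringℚ
    L≤ : nat 10 * L ≤ y * i
    L≤ = begin
      nat 10 * L                               ≤⟨ *-monoˡ (0≤nat 10) h₄ ⟩
      nat 10 * (2ℚ * (n * n) * K)              ≡⟨ modulo {Y = nat 20 * (n * n * K) * i * p} {c = - (nat 20 * (n * n * K))} (f₁ n K i p) pi ⟩
      nat 20 * (n * n * K) * i * p             ≤⟨ *-monoˡ (0≤* (0≤* (0≤nat 20) (0≤* (0≤* 0≤n 0≤n) 0≤K)) 0≤i) p≤ ⟩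
      nat 20 * (n * n * K) * i * (3ℚ * n)      ≡⟨ f₂ n K i ⟩
      nat 60 * K * cube n * i                  ≤⟨ *-monoʳ 0≤i h₅ ⟩
      y * i                                    ∎
      where
      f₁ : ∀ n K i p → nat 10 * (2ℚ * (n * n) * K) ≡ nat 20 * (n * n * K) * i * p + (- (nat 20 * (n * n * K))) * (p * i - 1ℚ)
      f₁ = solve-∀ ringℚ
      f₂ : ∀ n K i → nat 20 * (n * n * K) * i * (3ℚ * n) ≡ nat 60 * K * (n * n * n) * i
      f₂ = solve-∀ ringℚ

module _ (V : ℕ) (hV : Large V) where

  private
    low : Series
    low = below V ℓ

    0⊑low : 0̂ ⊑ low
    0⊑low = 0⊑below V ℓ 0⊑ℓ

  low-⊛ : ∀ u → (cc ⊛ low) u ≤ 2ℚ * (ι u * ι u) * sum V ℓ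
  low-⊛ u = ≤-trans (sum-mono (suc u) {g = λ m → 2ℚ * (ι u * ι u) * low (u ∸ m)} (λ { m (s≤s m≤u) → *-monoʳ (0⊑low (u ∸ m)) (cc≤ m≤u) }))
    (≤-trans (≤-reflexive (trans (sum-* (suc u) (2ℚ * (ι u * ι u)) (λ m → low (u ∸ m))) (cong (2ℚ * (ι u * ι u) *_) (sym (sum-rev u low)))))
      (*-monoˡ (0≤* (0≤nat 2) (0≤* (0≤ι u) (0≤ι u))) (below-sum V ℓ 0⊑ℓ (suc u))))

  X-term : ∀ m v → nat 25 * (ℓ v * (Q (m ℕ.+ v) - Q v)) ≤ nat 14 * (ι m * γ̂ V hV v) + nat 25 * low v
  X-term m v = go (ℕₚ.<-≤-connex v V)
    where
    open ≤-Reasoning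
    e₁ : ∀ m l → nat 25 * (l * 1ℚ) ≡ nat 14 * (m * 0ℚ) + nat 25 * l
    e₁ = solve-∀ ringℚ
    e₂ : ∀ l q → nat 25 * (l * q) ≡ l * (nat 25 * q)
    e₂ = solve-∀ ringℚ
    e₃ : ∀ l m w → l * (nat 14 * (m * w)) ≡ nat 14 * (m * (l * w)) + nat 25 * 0ℚ
    e₃ = solve-∀ ringℚ
    go : v ℕ.< V ⊎ V ℕ.≤ v → nat 25 * (ℓ v * (Q (m ℕ.+ v) - Q v)) ≤ nat 14 * (ι m * γ̂ V hV v) + nat 25 * low v
    go (inj₁ v<V) = ≤-trans (*-monoˡ (0≤nat 25) (*-monoˡ (0≤ℓ v) (Q-diff≤1 m v)))
      (≤-reflexive (trans (e₁ (ι m) (ℓ v)) (cong₂ (λ s r → nat 14 * (ι m * s) + nat 25 * r) (sym (from-< γ v<V)) (sym (below-< {V} ℓ v<V)))))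
    go (inj₂ V≤v) = ≤-trans (≤-reflexive (e₂ (ℓ v) (Q (m ℕ.+ v) - Q v))) (≤-trans (*-monoˡ (0≤ℓ v) (Q-diff-large m v (Large-mono {V} {v} hV V≤v)))
      (≤-reflexive (trans (e₃ (ℓ v) (ι m) (W₃ v)) (cong₂ (λ s r → nat 14 * (ι m * s) + nat 25 * r) (sym (from-≥ γ V≤v)) (sym (below-≥ {V} ℓ V≤v))))))

  X≤ : ∀ u → nat 25 * X u ≤ nat 14 * sum (suc u) (λ m → cc m * (ι m * γ̂ V hV (u ∸ m))) + nat 25 * (cc ⊛ low) u
  X≤ u = ≤-trans (≤-reflexive (trans (cong (nat 25 *_) (X-sum u)) (sym (sum-* (suc u) (nat 25) (λ m → cc m * (ℓ (u ∸ m) * (Q u - Q (u ∸ m))))))))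
    (≤-trans (sum-mono (suc u) {g = λ m → nat 14 * (cc m * (ι m * γ̂ V hV (u ∸ m))) + nat 25 * (cc m * low (u ∸ m))} (λ { m (s≤s m≤u) → cell m m≤u }))
      (≤-reflexive (trans (sum-+ (suc u) (λ m → nat 14 * (cc m * (ι m * γ̂ V hV (u ∸ m)))) (λ m → nat 25 * (cc m * low (u ∸ m))))
        (cong₂ _+_ (sum-* (suc u) (nat 14) (λ m → cc m * (ι m * γ̂ V hV (u ∸ m)))) (sum-* (suc u) (nat 25) (λ m → cc m * low (u ∸ m)))))))
    where
    e₁ : ∀ c q → nat 25 * (c * q) ≡ c * (nat 25 * q)
    e₁ = solve-∀ ringℚ
    e₂ : ∀ c a r → c * (nat 14 * a + nat 25 * r) ≡ nat 14 * (c * a) + nat 25 * (c * r)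
    e₂ = solve-∀ ringℚ
    cell : ∀ m → m ℕ.≤ u → nat 25 * (cc m * (ℓ (u ∸ m) * (Q u - Q (u ∸ m)))) ≤ nat 14 * (cc m * (ι m * γ̂ V hV (u ∸ m))) + nat 25 * (cc m * low (u ∸ m))
    cell m m≤u = ≤-trans (≤-reflexive (e₁ (cc m) (ℓ (u ∸ m) * (Q u - Q (u ∸ m)))))
      (≤-trans (*-monoˡ (0⊑cc m) (subst (λ k → nat 25 * (ℓ (u ∸ m) * (Q k - Q (u ∸ m))) ≤ nat 14 * (ι m * γ̂ V hV (u ∸ m)) + nat 25 * low (u ∸ m))
          (ℕₚ.m+[n∸m]≡n m≤u) (X-term m (u ∸ m))))
        (≤-reflexive (e₂ (cc m) (ι m * γ̂ V hV (u ∸ m)) (low (u ∸ m)))))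

  X-bound-from : Eventually (λ n → nat 60 * sum V ℓ * cube (ι n) ≤ y n) → Eventually λ u → nat 10 * X u ≤ nat 9 * t u
  X-bound-from (U₀ , hU) = suc (U₀ ℕ.+ V) , bound
    where
    bound : ∀ u → suc (U₀ ℕ.+ V) ℕ.≤ u → nat 10 * X u ≤ nat 9 * t u
    bound (suc u) (s≤s U≤u) = X-final {X (suc u)} {sum (2 ℕ.+ u) (λ m → cc m * (ι m * γ̂ V hV (suc u ∸ m)))} {(cc ⊛ low) (suc u)} {t (suc u)}
        {y (suc u)} {y (3 ℕ.+ u)} {ip (suc u)} {ip (3 ℕ.+ u)} {pp (suc u)} {ι (suc u)} {sum V ℓ}
      (0≤ip (suc u)) (0≤y (suc u)) (0≤y (3 ℕ.+ u)) (0≤sum V 0≤ℓ) (0≤ι (suc u)) (p*ip (suc u)) (ppι≤ u)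
      (≤-trans (ip-anti (2 ℕ.+ u)) (ip-anti (suc u))) (X≤ (suc u)) (moment≤ V hV (suc u))
      (y-two (suc u) (Large-mono {V} {suc u} hV (ℕₚ.≤-trans (ℕₚ.m≤n+m V U₀) (ℕₚ.m≤n⇒m≤1+n U≤u)))) (low-⊛ (suc u))
      (hU (suc u) (ℕₚ.≤-trans (ℕₚ.m≤m+n U₀ V) (ℕₚ.m≤n⇒m≤1+n U≤u))) (t-lower u)

X-bound : Eventually λ u → nat 10 * X u ≤ nat 9 * t u
X-bound = go (archimedean (nat 40000))
  where
  go : (∃ λ V → nat 40000 ≤ ι V) → Eventually λ u → nat 10 * X u ≤ nat 9 * t u
  go (V , h) = X-bound-from V (≤-trans h (ι-mono (ℕₚ.m≤n+m V 2))) (y-growth (nat 60 * sum V ℓ))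

-- Exponentials: the series with a prescribed logarithmic derivative

module Exp (β : Series) (β₀ : β 0 ≡ 0ℚ) (0⊑β : 0̂ ⊑ β) where

  private
    next : Series → ℕ → ℚ
    next a n = inv (ι (suc n)) * ((β ∘ suc) ⊛ a) n

    -- Course-of-values recursion: `tab n` is final on the indices up to n, and its later entries
    -- are fillers that are never read.
    tab : ℕ → Series
    tab zero    i = 1ℚ
    tab (suc n) i with i ℕₚ.≤? n
    ... | yes _ = tab n i
    ... | no  _ = next (tab n) n

    tab-≤ : ∀ {n i} → i ℕ.≤ n → tab (suc n) i ≡ tab n i
    tab-≤ {n} {i} i≤n with i ℕₚ.≤? n
    ... | yes _   = refl
    ... | no  i≰n = ⊥-elim (i≰n i≤n)

    tab-suc : ∀ n → tab (suc n) (suc n) ≡ next (tab n) n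
    tab-suc n with suc n ℕₚ.≤? n
    ... | yes n<n = ⊥-elim (ℕₚ.<-irrefl refl n<n)
    ... | no  _   = refl

  exp : Series
  exp n = tab n n

  private
    tab-stable : ∀ k i → tab (k ℕ.+ i) i ≡ exp i
    tab-stable zero    i = refl
    tab-stable (suc k) i = trans (tab-≤ (ℕₚ.m≤n+m i k)) (tab-stable k i)

    tab-exp : ∀ {n i} → i ℕ.≤ n → tab n i ≡ exp i
    tab-exp {n} {i} i≤n = subst (λ k → tab k i ≡ exp i) (ℕₚ.m∸n+n≡m i≤n) (tab-stable (n ∸ i) i)

    0≤tab : ∀ n i → 0ℚ ≤ tab n i
    0≤tab zero    i = 0≤1
    0≤tab (suc n) i with i ℕₚ.≤? n
    ... | yes _ = 0≤tab n i
    ... | no  _ = 0≤* (0≤inv (0<ι n)) (0⊑⊛ {β ∘ suc} {tab n} (0⊑β ∘ suc) (0≤tab n) n)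

  exp-suc : ∀ n → ι (suc n) * exp (suc n) ≡ ((β ∘ suc) ⊛ exp) n
  exp-suc n = trans (cong (ι (suc n) *_) (tab-suc n)) (trans (sym (*-assoc (ι (suc n)) (inv (ι (suc n))) (((β ∘ suc) ⊛ tab n) n)))
    (trans (cong (_* ((β ∘ suc) ⊛ tab n) n) (*-inv (0<ι n))) (trans (*-identityˡ (((β ∘ suc) ⊛ tab n) n))
      (⊛-cong≤ {β ∘ suc} {β ∘ suc} {tab n} {exp} n (λ _ _ → refl) (λ i i≤n → tab-exp i≤n)))))

  θexp : θ exp ≗ β ⊛ exp
  θexp zero    = trans (*-zeroˡ (exp 0)) (sym (trans (+-identityʳ (β 0 * exp 0)) (trans (cong (_* exp 0) β₀) (*-zeroˡ (exp 0)))))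
  θexp (suc n) = trans (exp-suc n) (sym (trans (cong (λ s → s * exp (suc n) + ((β ∘ suc) ⊛ exp) n) β₀) (eq (exp (suc n)) (((β ∘ suc) ⊛ exp) n))))
    where
    eq : ∀ a c → 0ℚ * a + c ≡ c
    eq = solve-∀ ringℚ

  0⊑exp : 0̂ ⊑ exp
  0⊑exp n = 0≤tab n n

-- The overpartition series as the product of r and ℓ

module R = Exp cc refl 0⊑cc

r : Series
r = R.exp

0⊑r : 0̂ ⊑ r
0⊑r = R.0⊑exp

θr : θ r ≗ cc ⊛ r
θr = R.θexp

f : Series
f = r ⊛ ℓ

0⊑f : 0̂ ⊑ f
0⊑f = 0⊑⊛ {r} {ℓ} 0⊑r 0⊑ℓ

θf : θ f ≗ b ⊛ f
θf n = begin
  θ f n                                   ≡⟨ θ-⊛ r ℓ n ⟩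
  (θ r ⊛ ℓ) n + (r ⊛ θ ℓ) n               ≡⟨ cong₂ _+_ (trans (⊛-congʳ ℓ θr n) (⊛-assoc cc r ℓ n)) (trans (⊛-congˡ r θℓ n) (⊛-swap r (2ℚ · ι) ℓ n)) ⟩
  (cc ⊛ f) n + ((2ℚ · ι) ⊛ f) n           ≡⟨ +-comm ((cc ⊛ f) n) (((2ℚ · ι) ⊛ f) n) ⟩
  ((2ℚ · ι) ⊛ f) n + (cc ⊛ f) n           ≡⟨ sym (⊛-distribʳ (2ℚ · ι) cc f n) ⟩
  (((2ℚ · ι) ⊞ cc) ⊛ f) n                 ≡⟨ ⊛-congʳ f (λ m → sym (b-split m)) n ⟩
  (b ⊛ f) n                               ∎
  where open ≡-Reasoning

I^-⊛ : ∀ s a → I^ s a ≗ I^ s one ⊛ a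
I^-⊛ zero    a n = sym (⊛-identityˡ a n)
I^-⊛ (suc s) a n = trans (⊛-congˡ I (I^-⊛ s a) n) (sym (⊛-assoc I (I^ s one) a n))

-- Relative size O(n^(-3)), the precision at which an error vanishes against a gap of relative size
-- n^(-2).
Negligible : Series → Set
Negligible a = ∃ λ C → 0ℚ ≤ C × (∀ n → cube (ι n) * a n ≤ C * f n)

private
  tail-from : ∀ J → J ≗ I^ 12 r → (∃ λ C → 0ℚ ≤ C × J ⊑ C · f) → Negligible r
  tail-from J hJ (C , 0≤C , h) = cube 312ℚ * C , 0≤* (0≤cube (0≤nat 312)) 0≤C , λ n →
    ≤-trans (smoothing {r} 0⊑r (SubLog-mono {cc} {b} {r} 0⊑r cc≤b (⊑-reflexive θr)) n)
      (≤-trans (*-monoˡ (0≤cube (0≤nat 312)) (≤-trans (≤-reflexive (sym (hJ n))) (h n))) (≤-reflexive (sym (*-assoc (cube 312ℚ) C (f n)))))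

-- The logarithmic derivative `cc` is at most `b`, so `smoothing` bounds n³ r by r/(1 - q)¹²; and (1
-- - q)^(-12) is dominated by a multiple of `ℓ`, which turns the product into a multiple of `f`.
r-tail : Negligible r
r-tail = tail-from (I^ 12 one ⊛ r) (λ n → sym (I^-⊛ 12 r n)) (go (I^ 12 one) (I^≤ℓ 12))
  where
  go : ∀ J → (∃ λ C → 0ℚ ≤ C × J ⊑ C · ℓ) → ∃ λ C → 0ℚ ≤ C × J ⊛ r ⊑ C · f
  go J (C , 0≤C , h) = C , 0≤C , ⊑-trans (⊛-monoʳ {J} {C · ℓ} {r} 0⊑r h) (⊑-reflexive (λ n → trans (·-⊛ C ℓ r n) (cong (C *_) (⊛-comm ℓ r n))))

-- Log-concavity of ℓ in the form needed for convolutions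

x-anti : ∀ m v → x (m ℕ.+ v) ≤ x v
x-anti zero    v = ≤-refl
x-anti (suc m) v = ≤-trans (0≤q-p⇒p≤q (0≤D (m ℕ.+ v))) (x-anti m v)

ℓ-suc : ∀ n → ℓ (suc n) ≡ ℓ n * (1ℚ + x n)
ℓ-suc n = trans (cong (ℓ n +_) (sym (ℓx n))) (eq (ℓ n) (x n))
  where
  eq : ∀ l x → l + l * x ≡ l * (1ℚ + x)
  eq = solve-∀ ringℚ

ℓ-log-concave : ∀ d m w → ℓ w * ℓ (d ℕ.+ (m ℕ.+ w)) ≤ ℓ (d ℕ.+ w) * ℓ (m ℕ.+ w)
ℓ-log-concave zero    m w = ≤-refl
ℓ-log-concave (suc d) m w = begin
  ℓ w * ℓ (suc (d ℕ.+ (m ℕ.+ w)))                           ≡⟨ trans (cong (ℓ w *_) (ℓ-suc (d ℕ.+ (m ℕ.+ w)))) (sym (*-assoc (ℓ w) (ℓ (d ℕ.+ (m ℕ.+ w))) (1ℚ + x (d ℕ.+ (m ℕ.+ w))))) ⟩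
  ℓ w * ℓ (d ℕ.+ (m ℕ.+ w)) * (1ℚ + x (d ℕ.+ (m ℕ.+ w)))     ≤⟨ *-mono (0≤* (0≤ℓ w) (0≤ℓ (d ℕ.+ (m ℕ.+ w)))) (0≤+ 0≤1 (0≤x (d ℕ.+ w))) (ℓ-log-concave d m w) (+-monoʳ-≤ 1ℚ x≤) ⟩
  ℓ (d ℕ.+ w) * ℓ (m ℕ.+ w) * (1ℚ + x (d ℕ.+ w))             ≡⟨ eq (ℓ (d ℕ.+ w)) (ℓ (m ℕ.+ w)) (1ℚ + x (d ℕ.+ w)) ⟩
  ℓ (d ℕ.+ w) * (1ℚ + x (d ℕ.+ w)) * ℓ (m ℕ.+ w)             ≡⟨ cong (_* ℓ (m ℕ.+ w)) (sym (ℓ-suc (d ℕ.+ w))) ⟩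
  ℓ (suc d ℕ.+ w) * ℓ (m ℕ.+ w)                              ∎
  where
  open ≤-Reasoning
  eq : ∀ a c e → a * c * e ≡ a * e * c
  eq = solve-∀ ringℚ
  x≤ : x (d ℕ.+ (m ℕ.+ w)) ≤ x (d ℕ.+ w)
  x≤ = subst (λ k → x k ≤ x (d ℕ.+ w)) (trans (sym (ℕₚ.+-assoc m d w)) (trans (cong (ℕ._+ w) (ℕₚ.+-comm m d)) (ℕₚ.+-assoc d m w))) (x-anti m (d ℕ.+ w))

e : Series
e = cc ⊛ ℓ

0⊑e : 0̂ ⊑ e
0⊑e = 0⊑⊛ {cc} {ℓ} 0⊑cc 0⊑ℓ

-- Each quotient ℓ (u - m)/ℓ u increases with u by log-concavity, and so does their `cc`-weighted
-- sum e u/ℓ u. It fixes the sign of the last term in `Ω-sym`.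
e/ℓ-mono : ∀ d u → e u * ℓ (d ℕ.+ u) ≤ e (d ℕ.+ u) * ℓ u
e/ℓ-mono d u = begin
  e u * ℓ (d ℕ.+ u)                                           ≡⟨ sym (sum-*ʳ (suc u) (ℓ (d ℕ.+ u)) (λ m → cc m * ℓ (u ∸ m))) ⟩
  sum (suc u) (λ m → cc m * ℓ (u ∸ m) * ℓ (d ℕ.+ u))          ≤⟨ sum-mono (suc u) (λ { m (s≤s m≤u) → cell m m≤u }) ⟩
  sum (suc u) (λ m → cc m * ℓ (d ℕ.+ u ∸ m) * ℓ u)            ≤⟨ sum-mono-range {suc u} {suc (d ℕ.+ u)} (λ m → 0≤* (0≤* (0⊑cc m) (0≤ℓ (d ℕ.+ u ∸ m))) (0≤ℓ u)) (s≤s (ℕₚ.m≤n+m u d)) ⟩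
  sum (suc (d ℕ.+ u)) (λ m → cc m * ℓ (d ℕ.+ u ∸ m) * ℓ u)    ≡⟨ sum-*ʳ (suc (d ℕ.+ u)) (ℓ u) (λ m → cc m * ℓ (d ℕ.+ u ∸ m)) ⟩
  e (d ℕ.+ u) * ℓ u                                           ∎
  where
  open ≤-Reasoning
  cell : ∀ m → m ℕ.≤ u → cc m * ℓ (u ∸ m) * ℓ (d ℕ.+ u) ≤ cc m * ℓ (d ℕ.+ u ∸ m) * ℓ u
  cell m m≤u = subst₂ _≤_ (sym (*-assoc (cc m) (ℓ (u ∸ m)) (ℓ (d ℕ.+ u)))) (sym (*-assoc (cc m) (ℓ (d ℕ.+ u ∸ m)) (ℓ u)))
    (*-monoˡ (0⊑cc m) (subst₂ (λ s k → ℓ (u ∸ m) * ℓ (d ℕ.+ s) ≤ ℓ k * ℓ s) (ℕₚ.m+[n∸m]≡n m≤u) (sym (ℕₚ.+-∸-assoc d m≤u)) (ℓ-log-concave d m (u ∸ m))))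

-- Quadratic forms

module _ (N : ℕ) (weight : ℕ → ℚ) (0≤weight : ∀ i → 0ℚ ≤ weight i) (point : ℕ → ℕ) where

  form : (ℕ → ℕ → ℚ) → ℚ
  form Ω = sum N (λ i → sum N (λ j → weight i * weight j * Ω (point i) (point j)))

  single : (ℕ → ℚ) → ℚ
  single α = sum N (λ i → weight i * α (point i))

  form-product : ∀ α β → form (λ u v → α u * β v) ≡ single α * single β
  form-product α β = trans (sum-congˡ N (λ i → trans (sum-congˡ N (λ j → eq (weight i) (weight j) (α (point i)) (β (point j))))
      (sum-* N (weight i * α (point i)) (λ j → weight j * β (point j))))) (sum-*ʳ N (single β) (λ i → weight i * α (point i)))
    where
    eq : ∀ a c p q → a * c * (p * q) ≡ a * p * (c * q)
    eq = solve-∀ ringℚ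

  form-+ : ∀ Ω Ω′ → form (λ u v → Ω u v + Ω′ u v) ≡ form Ω + form Ω′
  form-+ Ω Ω′ = trans (sum-congˡ N (λ i → trans (sum-congˡ N (λ j → *-distribˡ-+ (weight i * weight j) (Ω (point i) (point j)) (Ω′ (point i) (point j))))
    (sum-+ N (λ j → weight i * weight j * Ω (point i) (point j)) (λ j → weight i * weight j * Ω′ (point i) (point j)))))
    (sum-+ N (λ i → sum N (λ j → weight i * weight j * Ω (point i) (point j))) (λ i → sum N (λ j → weight i * weight j * Ω′ (point i) (point j))))

  form-neg : ∀ Ω → form (λ u v → - Ω u v) ≡ - form Ω
  form-neg Ω = trans (sum-congˡ N (λ i → trans (sum-congˡ N (λ j → eq (weight i * weight j) (Ω (point i) (point j))))
      (sum-* N (- 1ℚ) (λ j → weight i * weight j * Ω (point i) (point j)))))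
      (trans (sum-* N (- 1ℚ) (λ i → sum N (λ j → weight i * weight j * Ω (point i) (point j)))) (eq₂ (form Ω)))
    where
    eq : ∀ a w → a * - w ≡ - 1ℚ * (a * w)
    eq = solve-∀ ringℚ
    eq₂ : ∀ a → - 1ℚ * a ≡ - a
    eq₂ = solve-∀ ringℚ

  -- The weights are symmetric in i and j, so only the symmetric part of the kernel counts.
  form-nonneg : ∀ Ω → (∀ u v → 0ℚ ≤ Ω u v + Ω v u) → 0ℚ ≤ form Ω
  form-nonneg Ω h = *-cancelˡ {2ℚ} (positive⁻¹ 2ℚ) (subst (_≤ 2ℚ * form Ω) (sym (*-zeroʳ 2ℚ)) (subst (0ℚ ≤_) eq
      (0≤sum N (λ i → 0≤sum N (λ j → 0≤* (0≤* (0≤weight i) (0≤weight j)) (h (point i) (point j)))))))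
    where
    two : ∀ a → a + a ≡ 2ℚ * a
    two = solve-∀ ringℚ
    transpose : form (λ u v → Ω v u) ≡ form Ω
    transpose = trans (sum-swap N N (λ i j → weight i * weight j * Ω (point j) (point i)))
      (sum-congˡ N (λ j → sum-congˡ N (λ i → cong (_* Ω (point j) (point i)) (*-comm (weight i) (weight j)))))
    eq : form (λ u v → Ω u v + Ω v u) ≡ 2ℚ * form Ω
    eq = trans (form-+ Ω (λ u v → Ω v u)) (trans (cong (form Ω +_) transpose) (two (form Ω)))

ℓt : ∀ u → t u + ℓ (2 ℕ.+ u) ≡ ℓ u * ((1ℚ + x u) * (1ℚ + x u))
ℓt u = *-cancelˡ-≡ (0<ℓ u) (trans (e₁ (ℓ u) (T u) (inv (ℓ u)) (ℓ (2 ℕ.+ u))) (trans (cong (λ s → T u * s + ℓ u * ℓ (2 ℕ.+ u)) (*-inv (0<ℓ u)))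
  (trans (e₂ (ℓ u) (y u) (z u)) (trans (cong (λ s → (ℓ u + s) * (ℓ u + s)) (sym (ℓx u))) (e₃ (ℓ u) (x u))))))
  where
  e₁ : ∀ l t i m → l * (t * i + m) ≡ t * (l * i) + l * m
  e₁ = solve-∀ ringℚ
  e₂ : ∀ l y z → (y * y - l * z) * 1ℚ + l * (l + y + (y + z)) ≡ (l + y) * (l + y)
  e₂ = solve-∀ ringℚ
  e₃ : ∀ l x → (l + l * x) * (l + l * x) ≡ l * (l * ((1ℚ + x) * (1ℚ + x)))
  e₃ = solve-∀ ringℚ

Θℓ ℓQe ΘℓQ : Series
Θℓ = θ ℓ
ΘℓQ = θ ℓQ
ℓQe v = Q v * e v

-- Summed against the weights, the first two terms give (r ⊛ ℓ⁺)² - f (r ⊛ (ℓ⁺⁺ + t)). The remaining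
-- four add up to f (r ⊛ X): by `move` the series r ⊛ e equals k f - r ⊛ θ ℓ, so the products with r
-- ⊛ θ ℓ cancel. The split is chosen for the sign of the symmetrised kernel.
Ω : ℕ → ℕ → ℚ
Ω u v = ℓ (suc u) * ℓ (suc v) + - (ℓ u * (ℓ (2 ℕ.+ v) + t v)) + (- (Θℓ u * ℓQ v) + ℓ u * ΘℓQ v) + (- (e u * ℓQ v) + ℓ u * ℓQe v)

-- The square (x u - x v)² is the variance lost by mixing. Cauchy-Schwarz bounds it by (v - u)(Q v -
-- Q u), and in the last term `Q` and e/ℓ increase together, as in Chebyshev's sum inequality.
Ω-sym : ∀ u v → Ω u v + Ω v u ≡
        ℓ u * ℓ v * ((ι v - ι u) * (Q v - Q u) - (x u - x v) * (x u - x v)) + (Q v - Q u) * (e v * ℓ u - e u * ℓ v)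
Ω-sym u v = trans (cong₂ _+_ (Ω′ u v) (Ω′ v u)) (poly (ℓ u) (ℓ v) (x u) (x v) (ι u) (ι v) (Q u) (Q v) (e u) (e v))
  where
  Ω′ : ∀ u v → Ω u v ≡ ℓ u * (1ℚ + x u) * (ℓ v * (1ℚ + x v)) + - (ℓ u * (ℓ v * ((1ℚ + x v) * (1ℚ + x v))))
                 + (- (ι u * ℓ u * (ℓ v * Q v)) + ℓ u * (ι v * (ℓ v * Q v))) + (- (e u * (ℓ v * Q v)) + ℓ u * (Q v * e v))
  Ω′ u v = cong₂ (λ s r → s + - (ℓ u * r) + (- (Θℓ u * ℓQ v) + ℓ u * ΘℓQ v) + (- (e u * ℓQ v) + ℓ u * ℓQe v))
    (cong₂ _*_ (ℓ-suc u) (ℓ-suc v)) (trans (+-comm (ℓ (2 ℕ.+ v)) (t v)) (ℓt v))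
  poly : ∀ l m x y a c q s e f →
    (l * (1ℚ + x) * (m * (1ℚ + y)) + - (l * (m * ((1ℚ + y) * (1ℚ + y)))) + (- (a * l * (m * s)) + l * (c * (m * s))) + (- (e * (m * s)) + l * (s * f)))
    + (m * (1ℚ + y) * (l * (1ℚ + x)) + - (m * (l * ((1ℚ + x) * (1ℚ + x)))) + (- (c * m * (l * q)) + m * (a * (l * q))) + (- (f * (l * q)) + m * (q * e)))
    ≡ l * m * ((c - a) * (s - q) - (x - y) * (x - y)) + (s - q) * (f * l - e * m)
  poly = solve-∀ ringℚ

Ω-nonneg-≤ : ∀ d u → 0ℚ ≤ Ω u (d ℕ.+ u) + Ω (d ℕ.+ u) u
Ω-nonneg-≤ d u = subst (0ℚ ≤_) (sym (Ω-sym u (d ℕ.+ u))) (0≤+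
  (0≤* (0≤* (0≤ℓ u) (0≤ℓ (d ℕ.+ u))) (p≤q⇒0≤q-p (subst (λ s → (x u - x (d ℕ.+ u)) * (x u - x (d ℕ.+ u)) ≤ s * (Q (d ℕ.+ u) - Q u)) d≡ (cauchy-schwarz d u))))
  (0≤* (Q-mono d u) (p≤q⇒0≤q-p (e/ℓ-mono d u))))
  where
  eq : ∀ a c → a ≡ a + c - c
  eq = solve-∀ ringℚ
  d≡ : ι d ≡ ι (d ℕ.+ u) - ι u
  d≡ = trans (eq (ι d) (ι u)) (cong (_- ι u) (sym (ι-+ d u)))

Ω-nonneg : ∀ u v → 0ℚ ≤ Ω u v + Ω v u
Ω-nonneg u v = go (ℕₚ.≤-total u v)
  where
  go : u ℕ.≤ v ⊎ v ℕ.≤ u → 0ℚ ≤ Ω u v + Ω v u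
  go (inj₁ u≤v) = subst (λ k → 0ℚ ≤ Ω u k + Ω k u) (ℕₚ.m∸n+n≡m u≤v) (Ω-nonneg-≤ (v ∸ u) u)
  go (inj₂ v≤u) = subst (0ℚ ≤_) (+-comm (Ω v u) (Ω u v)) (subst (λ k → 0ℚ ≤ Ω v k + Ω k v) (ℕₚ.m∸n+n≡m v≤u) (Ω-nonneg-≤ (u ∸ v) v))

ℓ⁺ ℓ⁺⁺ : Series
ℓ⁺  = ℓ ∘ suc
ℓ⁺⁺ = ℓ ∘ suc ∘ suc

private
  -- r * (c * a) = (θ r) * a = θ (r * a) − r * θ a
  move : ∀ a k → (r ⊛ (cc ⊛ a)) k ≡ ι k * (r ⊛ a) k - (r ⊛ θ a) k
  move a k = begin
    (r ⊛ (cc ⊛ a)) k                        ≡⟨ trans (⊛-swap r cc a k) (sym (⊛-assoc cc r a k)) ⟩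
    ((cc ⊛ r) ⊛ a) k                        ≡⟨ ⊛-congʳ a (λ n → sym (θr n)) k ⟩
    (θ r ⊛ a) k                             ≡⟨ eq ((θ r ⊛ a) k) ((r ⊛ θ a) k) ⟩
    (θ r ⊛ a) k + (r ⊛ θ a) k - (r ⊛ θ a) k ≡⟨ cong (_- (r ⊛ θ a) k) (sym (θ-⊛ r a k)) ⟩
    ι k * (r ⊛ a) k - (r ⊛ θ a) k           ∎
    where
    open ≡-Reasoning
    eq : ∀ p q → p ≡ p + q - q
    eq = solve-∀ ringℚ

⊛-minus : ∀ a c d k → (a ⊛ λ n → c n - d n) k ≡ (a ⊛ c) k - (a ⊛ d) k
⊛-minus a c d k = trans (sum-congˡ (suc k) (λ i → eq (a i) (c (k ∸ i)) (d (k ∸ i))))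
  (trans (sum-+ (suc k) (λ i → a i * c (k ∸ i)) (λ i → - 1ℚ * (a i * d (k ∸ i)))) (trans (cong ((a ⊛ c) k +_) (sum-* (suc k) (- 1ℚ) (λ i → a i * d (k ∸ i)))) (eq₂ ((a ⊛ c) k) ((a ⊛ d) k))))
  where
  eq : ∀ a c d → a * (c - d) ≡ a * c + - 1ℚ * (a * d)
  eq = solve-∀ ringℚ
  eq₂ : ∀ c d → c + - 1ℚ * d ≡ c - d
  eq₂ = solve-∀ ringℚ

-- Mixing: E[t] − Var ≥ E[t] − E[X], where the expectation is over the weights r i ℓ (k − i).
mixing : ∀ k → f k * ((r ⊛ t) k - (r ⊛ X) k) ≤ (r ⊛ ℓ⁺) k * (r ⊛ ℓ⁺) k - f k * (r ⊛ ℓ⁺⁺) k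
mixing k = ≤-by eq (form-nonneg (suc k) r 0⊑r (k ∸_) Ω Ω-nonneg)
  where
  F : (ℕ → ℕ → ℚ) → ℚ
  F = form (suc k) r 0⊑r (k ∸_)
  prod : ∀ α β → F (λ u v → α u * β v) ≡ (r ⊛ α) k * (r ⊛ β) k
  prod = form-product (suc k) r 0⊑r (k ∸_)
  plus : ∀ Ω₁ Ω₂ → F (λ u v → Ω₁ u v + Ω₂ u v) ≡ F Ω₁ + F Ω₂
  plus = form-+ (suc k) r 0⊑r (k ∸_)
  neg : ∀ α β → F (λ u v → - (α u * β v)) ≡ - ((r ⊛ α) k * (r ⊛ β) k)
  neg α β = trans (form-neg (suc k) r 0⊑r (k ∸_) (λ u v → α u * β v)) (cong -_ (prod α β))
  expand : F Ω ≡ (r ⊛ ℓ⁺) k * (r ⊛ ℓ⁺) k + - (f k * (r ⊛ (ℓ⁺⁺ ⊞ t)) k) + (- ((r ⊛ Θℓ) k * (r ⊛ ℓQ) k) + f k * (r ⊛ ΘℓQ) k)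
             + (- ((r ⊛ e) k * (r ⊛ ℓQ) k) + f k * (r ⊛ ℓQe) k)
  expand = trans (plus (λ u v → ℓ (suc u) * ℓ (suc v) + - (ℓ u * (ℓ (2 ℕ.+ v) + t v)) + (- (Θℓ u * ℓQ v) + ℓ u * ΘℓQ v)) (λ u v → - (e u * ℓQ v) + ℓ u * ℓQe v))
    (cong₂ _+_ (trans (plus (λ u v → ℓ (suc u) * ℓ (suc v) + - (ℓ u * (ℓ (2 ℕ.+ v) + t v))) (λ u v → - (Θℓ u * ℓQ v) + ℓ u * ΘℓQ v))
        (cong₂ _+_ (trans (plus (λ u v → ℓ (suc u) * ℓ (suc v)) (λ u v → - (ℓ u * (ℓ (2 ℕ.+ v) + t v)))) (cong₂ _+_ (prod ℓ⁺ ℓ⁺) (neg ℓ (ℓ⁺⁺ ⊞ t))))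
          (trans (plus (λ u v → - (Θℓ u * ℓQ v)) (λ u v → ℓ u * ΘℓQ v)) (cong₂ _+_ (neg Θℓ ℓQ) (prod ℓ ΘℓQ)))))
      (trans (plus (λ u v → - (e u * ℓQ v)) (λ u v → ℓ u * ℓQe v)) (cong₂ _+_ (neg e ℓQ) (prod ℓ ℓQe))))
  rX : (r ⊛ X) k ≡ (r ⊛ ℓQe) k - (ι k * (r ⊛ ℓQ) k - (r ⊛ ΘℓQ) k)
  rX = trans (⊛-minus r (λ u → e u * Q u) (cc ⊛ ℓQ) k) (cong₂ _-_ (⊛-congˡ r (λ u → *-comm (e u) (Q u)) k) (move ℓQ k))
  poly : ∀ K g F g₂ t h θl θh q → g * g - F * g₂ - F * (t - (q - (K * h - θh))) ≡
         g * g + - (F * (g₂ + t)) + (- (θl * h) + F * θh) + (- ((K * F - θl) * h) + F * q)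
  poly = solve-∀ ringℚ
  eq : (r ⊛ ℓ⁺) k * (r ⊛ ℓ⁺) k - f k * (r ⊛ ℓ⁺⁺) k - f k * ((r ⊛ t) k - (r ⊛ X) k) ≡ F Ω
  eq = trans (cong (λ s → (r ⊛ ℓ⁺) k * (r ⊛ ℓ⁺) k - f k * (r ⊛ ℓ⁺⁺) k - f k * ((r ⊛ t) k - s)) rX)
    (trans (poly (ι k) ((r ⊛ ℓ⁺) k) (f k) ((r ⊛ ℓ⁺⁺) k) ((r ⊛ t) k) ((r ⊛ ℓQ) k) ((r ⊛ Θℓ) k) ((r ⊛ ΘℓQ) k) ((r ⊛ ℓQe) k))
      (sym (trans expand (cong₂ (λ s q → (r ⊛ ℓ⁺) k * (r ⊛ ℓ⁺) k + - (f k * s) + (- ((r ⊛ Θℓ) k * (r ⊛ ℓQ) k) + f k * (r ⊛ ΘℓQ) k)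
             + (- (q * (r ⊛ ℓQ) k) + f k * (r ⊛ ℓQe) k)) (⊛-distribˡ r ℓ⁺⁺ t k) (move ℓ k)))))

-- The log-concavity gap

f-suc : ∀ k → f (suc k) ≡ (r ⊛ ℓ⁺) k + r (suc k)
f-suc k = trans (⊛-sucʳ r ℓ k) (cong ((r ⊛ ℓ⁺) k +_) (*-identityʳ (r (suc k))))

f-suc² : ∀ k → f (2 ℕ.+ k) ≡ (r ⊛ ℓ⁺⁺) k + r (suc k) * 2ℚ + r (2 ℕ.+ k)
f-suc² k = trans (f-suc (suc k)) (cong (_+ r (2 ℕ.+ k)) (⊛-sucʳ r ℓ⁺ k))

f≤g : ∀ k → f k ≤ (r ⊛ ℓ⁺) k
f≤g = ⊛-monoˡ {r} {ℓ} {ℓ⁺} 0⊑r (λ n → p≤p+q (0≤y n))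

f-mono-suc : ∀ k → f k ≤ f (suc k)
f-mono-suc k = ≤-trans (f≤g k) (≤-trans (p≤p+q (0⊑r (suc k))) (≤-reflexive (sym (f-suc k))))

f-mono : ∀ {m n} → m ℕ.≤ n → f m ≤ f n
f-mono = Monotone-≤ {f} f-mono-suc

f₀ : f 0 ≡ 1ℚ
f₀ = refl

0<f : ∀ k → 0ℚ < f k
0<f k = <-≤-trans (subst (0ℚ <_) (sym f₀) (positive⁻¹ 1ℚ)) (f-mono {0} {k} z≤n)

cube≥ : ∀ {n} → 1ℚ ≤ n → n ≤ cube n
cube≥ {n} 1≤n = subst (_≤ cube n) (trans (*-identityˡ (1ℚ * n)) (*-identityˡ n)) (subst (1ℚ * (1ℚ * n) ≤_) (sym (*-assoc n n n))
  (*-mono {1ℚ} {n} {1ℚ * n} {n * n} 0≤1 (0≤* 0≤n 0≤n) 1≤n (*-monoʳ 0≤n 1≤n)))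
  where
  0≤n : 0ℚ ≤ n
  0≤n = ≤-trans 0≤1 1≤n

-- r ⊛ ℓ⁺ ≤ 2 f by `y≤ℓ`, and the boundary term r (k+1) is eventually at most half of f (k+1).
f-quadruple : Eventually λ k → f (suc k) ≤ nat 4 * f k
f-quadruple = go r-tail
  where
  go : Negligible r → Eventually λ k → f (suc k) ≤ nat 4 * f k
  go (C , 0≤C , h) = go′ (archimedean (2ℚ * (1ℚ + C)))
    where
    2g≤ : ∀ k → (r ⊛ ℓ⁺) k ≤ 2ℚ * f k
    2g≤ k = ≤-trans (⊛-monoˡ {r} {ℓ⁺} {2ℚ · ℓ} 0⊑r (λ n → ≤-trans (+-monoʳ-≤ (ℓ n) (y≤ℓ n)) (≤-reflexive (two (ℓ n)))) k)
      (≤-reflexive (trans (⊛-comm r (2ℚ · ℓ) k) (trans (·-⊛ 2ℚ ℓ r k) (cong (2ℚ *_) (⊛-comm ℓ r k)))))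
      where
      two : ∀ l → l + l ≡ 2ℚ * l
      two = solve-∀ ringℚ
    finish : ∀ {F₁ g r₁ F C n} → F₁ ≡ g + r₁ → g ≤ 2ℚ * F → 0ℚ ≤ C → 0ℚ ≤ r₁ → 0ℚ ≤ F₁ → 2ℚ * (1ℚ + C) ≤ n → 1ℚ ≤ n → cube n * r₁ ≤ C * F₁ → F₁ ≤ nat 4 * F
    finish {F₁} {g} {r₁} {F} {C} {n} eq g≤ 0≤C 0≤r 0≤F hn 1≤n hr = ≤-by (trans (e₁ F₁ g r₁ F) (cong (λ s → 2ℚ * (2ℚ * F - g) + (F₁ - 2ℚ * r₁) + s) (trans (cong (λ s → 2ℚ * (g + r₁ - s)) eq) (trans (cong (2ℚ *_) (+-inverseʳ (g + r₁))) (*-zeroʳ 2ℚ)))))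
        (0≤+ (0≤+ (0≤* (0≤nat 2) (p≤q⇒0≤q-p g≤)) (p≤q⇒0≤q-p 2r≤)) ≤-refl)
      where
      e₁ : ∀ F₁ g r F → nat 4 * F - F₁ ≡ 2ℚ * (2ℚ * F - g) + (F₁ - 2ℚ * r) + 2ℚ * (g + r - F₁)
      e₁ = solve-∀ ringℚ
      e₂ : ∀ C r → (1ℚ + C) * (2ℚ * r) ≡ 2ℚ * (1ℚ + C) * r
      e₂ = solve-∀ ringℚ
      2r≤ : 2ℚ * r₁ ≤ F₁
      2r≤ = *-cancelˡ {1ℚ + C} (0<+ (positive⁻¹ 1ℚ) 0≤C) (≤-trans (≤-reflexive (e₂ C r₁)) (≤-trans (*-monoʳ 0≤r (≤-trans hn (cube≥ 1≤n)))
        (≤-trans hr (*-monoʳ 0≤F (p≤q+p {C} 0≤1)))))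
    go′ : (∃ λ n → 2ℚ * (1ℚ + C) ≤ ι n) → Eventually λ k → f (suc k) ≤ nat 4 * f k
    go′ (n , hn) = n , λ k n≤k → finish {f (suc k)} {(r ⊛ ℓ⁺) k} {r (suc k)} {f k} {C} {ι (suc k)} (f-suc k) (2g≤ k) 0≤C (0⊑r (suc k)) (0⊑f (suc k))
      (≤-trans hn (ι-mono (ℕₚ.m≤n⇒m≤1+n n≤k))) (1≤ι k) (h (suc k))

-- The true order is ℓ/n^(3/2); this weaker bound is rational, and its factor decreases in n, so it
-- survives averaging over indices u ≤ k.
t≥ : ∀ n → ℓ (suc n) * (ip (suc n) * ip (suc n)) ≤ t (suc n)
t≥ m = *-cancelˡ {2ℚ} (positive⁻¹ 2ℚ) (≤-trans (≤-trans (≤-reflexive (modulo {Y = 2ℚ * ℓ n * ip n * ip n} {c = 0ℚ} {p = 0ℚ} {q = 0ℚ} (e₀ (ℓ n) (ip n)) refl))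
    (*-monoʳ (0≤ip n) (≤-trans (*-monoʳ (0≤ip n) (py≥2ℓ n)) (≤-reflexive (modulo {Y = y n} {c = y n} (e₁ (pp n) (y n) (ip n)) (p*ip n)))))) (t-lower m))
  where
  n : ℕ
  n = suc m
  e₀ : ∀ l i → 2ℚ * (l * (i * i)) ≡ 2ℚ * l * i * i + 0ℚ * (0ℚ - 0ℚ)
  e₀ = solve-∀ ringℚ
  e₁ : ∀ p y i → p * y * i ≡ y + y * (p * i - 1ℚ)
  e₁ = solve-∀ ringℚ

ip-mono : ∀ {u k} → u ℕ.≤ k → ip k ≤ ip u
ip-mono {u} {k} u≤k = subst (λ n → ip n ≤ ip u) (ℕₚ.m∸n+n≡m u≤k) (go (k ∸ u))
  where
  go : ∀ d → ip (d ℕ.+ u) ≤ ip u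
  go zero    = ≤-refl
  go (suc d) = ≤-trans (ip-anti (d ℕ.+ u)) (go d)

ip≤1 : ∀ n → ip n ≤ 1ℚ
ip≤1 n = inv≤1 (suc n)

0≤Q : ∀ u → 0ℚ ≤ Q u
0≤Q u = 0≤sum u (λ i → 0≤□ (D i))

X≤eQ : ∀ u → X u ≤ e u * Q u
X≤eQ u = ≤-by (eq (e u * Q u) ((cc ⊛ ℓQ) u)) (0⊑⊛ {cc} {ℓQ} 0⊑cc (λ v → 0≤* (0≤ℓ v) (0≤Q v)) u)
  where
  eq : ∀ a c → a - (a - c) ≡ c
  eq = solve-∀ ringℚ

module Gap (U₀ : ℕ) (hX : ∀ u → U₀ ℕ.≤ u → nat 10 * X u ≤ nat 9 * t u) where

  V : ℕ
  -- One more than `U₀`, so that an index u ≥ V is a successor, as `t≥` requires.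
  V = suc U₀

  -- A single constant above e u Q u + ℓ u for all u < V; it compensates for the finitely many u at
  -- which `X` is not controlled by `t`.
  Ξ : ℚ
  Ξ = sum V (λ u → e u * Q u + ℓ u)

  0≤Ξ : 0ℚ ≤ Ξ
  0≤Ξ = 0≤sum V (λ u → 0≤+ (0≤* (0⊑e u) (0≤Q u)) (0≤ℓ u))

  lw : Series
  lw = below V (λ _ → Ξ)

  0⊑lw : 0̂ ⊑ lw
  0⊑lw = 0⊑below V (λ _ → Ξ) (λ _ → 0≤Ξ)

  pointwise : ∀ {u k} → u ℕ.≤ k → ℓ u * (ip k * ip k) ≤ nat 10 * (t u - X u) + nat 10 * lw u
  pointwise {u} {k} u≤k = go (ℕₚ.<-≤-connex u V)
    where
    ip² : ip k * ip k ≤ 1ℚ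
    ip² = *-mono {s = 1ℚ} (0≤ip k) 0≤1 (ip≤1 k) (ip≤1 k)
    small : ∀ {l i t X q s} → 0ℚ ≤ l → i ≤ 1ℚ → 0ℚ ≤ t → X ≤ q → q + l ≤ s → l * i ≤ nat 10 * (t - X) + nat 10 * s
    small {l} {i} {t} {X} {q} {s} 0≤l i≤1 0≤t X≤q q≤s = ≤-by (eq l i t X q s)
        (0≤+ (0≤+ (0≤* 0≤l (p≤q⇒0≤q-p i≤1)) (0≤* (0≤nat 9) 0≤l)) (0≤+ (0≤* (0≤nat 10) 0≤t) (0≤+ (0≤* (0≤nat 10) (p≤q⇒0≤q-p X≤q)) (0≤* (0≤nat 10) (p≤q⇒0≤q-p q≤s)))))
      where
      eq : ∀ l i t X q s → nat 10 * (t - X) + nat 10 * s - l * i ≡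
           l * (1ℚ - i) + nat 9 * l + (nat 10 * t + (nat 10 * (q - X) + nat 10 * (s - (q + l))))
      eq = solve-∀ ringℚ
    large : ∀ {l i j t X} → 0ℚ ≤ l → i ≤ j → l * j ≤ t → nat 10 * X ≤ nat 9 * t → l * i ≤ nat 10 * (t - X) + nat 10 * 0ℚ
    large {l} {i} {j} {t} {X} 0≤l i≤j h₁ h₂ = ≤-by (eq l i j t X) (0≤+ (0≤* 0≤l (p≤q⇒0≤q-p i≤j)) (0≤+ (p≤q⇒0≤q-p h₁) (p≤q⇒0≤q-p h₂)))
      where
      eq : ∀ l i j t X → nat 10 * (t - X) + nat 10 * 0ℚ - l * i ≡ l * (j - i) + (t - l * j + (nat 9 * t - nat 10 * X))
      eq = solve-∀ ringℚ
    big : ∀ {u} → V ℕ.≤ u → u ℕ.≤ k → ℓ u * (ip k * ip k) ≤ nat 10 * (t u - X u) + nat 10 * 0ℚ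
    big {suc n} V≤u u≤k = large {ℓ (suc n)} {ip k * ip k} {ip (suc n) * ip (suc n)} {t (suc n)} {X (suc n)} (0≤ℓ (suc n))
      (*-mono (0≤ip k) (0≤ip (suc n)) (ip-mono u≤k) (ip-mono u≤k)) (t≥ n) (hX (suc n) (ℕₚ.≤-trans (ℕₚ.n≤1+n U₀) V≤u))
    go : u ℕ.< V ⊎ V ℕ.≤ u → ℓ u * (ip k * ip k) ≤ nat 10 * (t u - X u) + nat 10 * lw u
    go (inj₁ u<V) = subst (λ s → ℓ u * (ip k * ip k) ≤ nat 10 * (t u - X u) + nat 10 * s) (sym (below-< {V} (λ _ → Ξ) u<V))
      (small {ℓ u} {ip k * ip k} {t u} {X u} {e u * Q u} {Ξ} (0≤ℓ u) ip² (0≤t u) (X≤eQ u) (term≤sum {V} u (λ j → 0≤+ (0≤* (0⊑e j) (0≤Q j)) (0≤ℓ j)) u<V))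
    go (inj₂ V≤u) = subst (λ s → ℓ u * (ip k * ip k) ≤ nat 10 * (t u - X u) + nat 10 * s) (sym (below-≥ {V} (λ _ → Ξ) V≤u)) (big {u} V≤u u≤k)

  averaged : ∀ k → f k * (ip k * ip k) ≤ nat 10 * ((r ⊛ t) k - (r ⊛ X) k) + nat 10 * (r ⊛ lw) k
  averaged k = begin
    f k * (ip k * ip k)                                                     ≡⟨ sym (sum-*ʳ (suc k) (ip k * ip k) (λ i → r i * ℓ (k ∸ i))) ⟩
    sum (suc k) (λ i → r i * ℓ (k ∸ i) * (ip k * ip k))                     ≤⟨ sum-mono (suc k) (λ i _ → cell i) ⟩
    sum (suc k) (λ i → nat 10 * (r i * (t (k ∸ i) - X (k ∸ i))) + nat 10 * (r i * lw (k ∸ i)))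
      ≡⟨ trans (sum-+ (suc k) (λ i → nat 10 * (r i * (t (k ∸ i) - X (k ∸ i)))) (λ i → nat 10 * (r i * lw (k ∸ i))))
           (cong₂ _+_ (sum-* (suc k) (nat 10) (λ i → r i * (t (k ∸ i) - X (k ∸ i)))) (sum-* (suc k) (nat 10) (λ i → r i * lw (k ∸ i)))) ⟩
    nat 10 * (r ⊛ λ u → t u - X u) k + nat 10 * (r ⊛ lw) k                   ≡⟨ cong (λ s → nat 10 * s + nat 10 * (r ⊛ lw) k) (⊛-minus r t X k) ⟩
    nat 10 * ((r ⊛ t) k - (r ⊛ X) k) + nat 10 * (r ⊛ lw) k                   ∎
    where
    open ≤-Reasoning
    eq : ∀ r a c → r * (nat 10 * a + nat 10 * c) ≡ nat 10 * (r * a) + nat 10 * (r * c)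
    eq = solve-∀ ringℚ
    cell : ∀ i → r i * ℓ (k ∸ i) * (ip k * ip k) ≤ nat 10 * (r i * (t (k ∸ i) - X (k ∸ i))) + nat 10 * (r i * lw (k ∸ i))
    cell i = subst₂ _≤_ (sym (*-assoc (r i) (ℓ (k ∸ i)) (ip k * ip k))) (eq (r i) (t (k ∸ i) - X (k ∸ i)) (lw (k ∸ i)))
      (*-monoˡ (0⊑r i) (pointwise (ℕₚ.m∸n≤m k i)))

  module _ (C : ℚ) (0≤C : 0ℚ ≤ C) (hr : ∀ n → cube (ι n) * r n ≤ C * f n) where

    -- Only u < V contributes. There k - u ≥ k/2, so the tail bound of `r` applies at the cost of 2³
    -- = 8.
    lw-tail : ∀ k → V ℕ.+ V ℕ.≤ k → cube (ι k) * (r ⊛ lw) k ≤ nat 8 * C * sum V (λ _ → Ξ) * f k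
    lw-tail k 2V≤k = begin
      cube (ι k) * (r ⊛ lw) k                                ≡⟨ cong (cube (ι k) *_) (⊛-comm r lw k) ⟩
      cube (ι k) * (lw ⊛ r) k                                ≡⟨ sym (sum-* (suc k) (cube (ι k)) (λ u → lw u * r (k ∸ u))) ⟩
      sum (suc k) (λ u → cube (ι k) * (lw u * r (k ∸ u)))    ≤⟨ sum-mono (suc k) (λ u _ → cell u (ℕₚ.<-≤-connex u V)) ⟩
      sum (suc k) (λ u → lw u * (nat 8 * C * f k))           ≡⟨ sum-*ʳ (suc k) (nat 8 * C * f k) lw ⟩
      sum (suc k) lw * (nat 8 * C * f k)                     ≤⟨ *-monoʳ (0≤* (0≤* (0≤nat 8) 0≤C) (0⊑f k)) (below-sum V (λ _ → Ξ) (λ _ → 0≤Ξ) (suc k)) ⟩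
      sum V (λ _ → Ξ) * (nat 8 * C * f k)                    ≡⟨ eq (sum V (λ _ → Ξ)) C (f k) ⟩
      nat 8 * C * sum V (λ _ → Ξ) * f k                      ∎
      where
      open ≤-Reasoning
      eq : ∀ s c f → s * (nat 8 * c * f) ≡ nat 8 * c * s * f
      eq = solve-∀ ringℚ
      combine : ∀ {n m L r F C} → 0ℚ ≤ n → n ≤ 2ℚ * m → 0ℚ ≤ L → 0ℚ ≤ r → cube m * r ≤ C * F → cube n * (L * r) ≤ L * (nat 8 * C * F)
      combine {n} {m} {L} {r} {F} {C} 0≤n n≤ 0≤L 0≤r h = begin
        cube n * (L * r)          ≡⟨ e₁ (cube n) L r ⟩
        L * (cube n * r)          ≤⟨ *-monoˡ 0≤L (*-monoʳ 0≤r (cube-mono 0≤n n≤)) ⟩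
        L * (cube (2ℚ * m) * r)   ≡⟨ e₂ L m r ⟩
        nat 8 * L * (cube m * r)  ≤⟨ *-monoˡ (0≤* (0≤nat 8) 0≤L) h ⟩
        nat 8 * L * (C * F)       ≡⟨ e₃ L C F ⟩
        L * (nat 8 * C * F)       ∎
        where
        e₁ : ∀ a b c → a * (b * c) ≡ b * (a * c)
        e₁ = solve-∀ ringℚ
        e₂ : ∀ L m r → L * (2ℚ * m * (2ℚ * m) * (2ℚ * m) * r) ≡ nat 8 * L * (m * m * m * r)
        e₂ = solve-∀ ringℚ
        e₃ : ∀ L C F → nat 8 * L * (C * F) ≡ L * (nat 8 * C * F)
        e₃ = solve-∀ ringℚ
      half : ∀ {u} → u ℕ.≤ V → ι k ≤ 2ℚ * ι (k ∸ u)
      half {u} u≤V = ≤-trans (ι-mono {k} {(k ∸ u) ℕ.+ (k ∸ u)} k≤) (≤-reflexive (trans (ι-+ (k ∸ u) (k ∸ u)) (two (ι (k ∸ u)))))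
        where
        two : ∀ a → a + a ≡ 2ℚ * a
        two = solve-∀ ringℚ
        u≤k∸u : u ℕ.≤ k ∸ u
        u≤k∸u = ℕₚ.m+n≤o⇒m≤o∸n u (ℕₚ.≤-trans (ℕₚ.+-mono-≤ u≤V u≤V) 2V≤k)
        k≤ : k ℕ.≤ (k ∸ u) ℕ.+ (k ∸ u)
        k≤ = ℕₚ.≤-trans (ℕₚ.m≤n+m∸n k u) (ℕₚ.+-monoˡ-≤ (k ∸ u) u≤k∸u)
      cell : ∀ u → u ℕ.< V ⊎ V ℕ.≤ u → cube (ι k) * (lw u * r (k ∸ u)) ≤ lw u * (nat 8 * C * f k)
      cell u (inj₁ u<V) = combine {ι k} {ι (k ∸ u)} {lw u} {r (k ∸ u)} {f k} {C} (0≤ι k) (half (ℕₚ.<⇒≤ u<V)) (0⊑lw u) (0⊑r (k ∸ u))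
        (≤-trans (hr (k ∸ u)) (*-monoˡ 0≤C (f-mono (ℕₚ.m∸n≤m k u))))
      cell u (inj₂ V≤u) = ≤-reflexive (trans (cong (λ s → cube (ι k) * (s * r (k ∸ u))) lw≡0) (trans (e₁ (cube (ι k)) (r (k ∸ u)) (nat 8 * C * f k)) (cong (_* (nat 8 * C * f k)) (sym lw≡0))))
        where
        lw≡0 : lw u ≡ 0ℚ
        lw≡0 = below-≥ {V} (λ _ → Ξ) V≤u
        e₁ : ∀ a b c → a * (0ℚ * b) ≡ 0ℚ * c
        e₁ = solve-∀ ringℚ

Pgap : ℕ → ℚ
Pgap k = f (suc k) * f (suc k) - f k * f (2 ℕ.+ k)

n≤9n³i² : ∀ {n i p} → 0ℚ ≤ n → 0ℚ ≤ i → p * i ≡ 1ℚ → p ≤ 3ℚ * n → n ≤ nat 9 * (cube n * (i * i))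
n≤9n³i² {n} {i} {p} 0≤n 0≤i pi p≤ = ≤-trans
    (subst (_≤ n * (3ℚ * n * i * (3ℚ * n * i))) (*-identityʳ n) (*-monoˡ 0≤n (*-mono {1ℚ} {3ℚ * n * i} {1ℚ} {3ℚ * n * i} 0≤1 (≤-trans 0≤1 1≤3ni) 1≤3ni 1≤3ni)))
    (≤-reflexive (eq n i))
  where
  1≤3ni : 1ℚ ≤ 3ℚ * n * i
  1≤3ni = ≤-trans (≤-reflexive (sym pi)) (*-monoʳ 0≤i p≤)
  eq : ∀ n i → n * (3ℚ * n * i * (3ℚ * n * i)) ≡ nat 9 * (n * n * n * (i * i))
  eq = solve-∀ ringℚ

private
  -- The errors `S` and `r₂` are O(F/n³), whereas i² ≥ 1/(9 n²). Half of the main term absorbs them,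
  -- which doubles 10 to 20 and gives the threshold 9 · 2 · (10 K + 10 · 16 C).
  final-algebra : ∀ {F F₁ F₂ g g₂ r₁ r₂ M S i p n C K : ℚ} →
    F₁ ≡ g + r₁ → F₂ ≡ g₂ + r₁ * 2ℚ + r₂ → F * M ≤ g * g - F * g₂ → F ≤ g → 0ℚ ≤ F → 0ℚ ≤ r₁ → 0ℚ ≤ r₂ →
    F * (i * i) ≤ nat 10 * M + nat 10 * S → 0ℚ < n → cube n * S ≤ K * F → cube n * r₂ ≤ nat 16 * C * F →
    p * i ≡ 1ℚ → p ≤ 3ℚ * n → 0ℚ ≤ i → nat 18 * (nat 10 * K + nat 160 * C) ≤ n →
    F * F * (i * i) ≤ nat 20 * (F₁ * F₁ - F * F₂)
  final-algebra {F} {g = g} {g₂} {r₁} {r₂} {M} {S} {i} {p} {n} {C} {K} refl refl hM F≤g 0≤F 0≤r₁ 0≤r₂ hS 0<n hK hC pi p≤ 0≤i hn =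
    ≤-trans (*-cancelˡ {cube n} 0<n³ main) (≤-by (e₁ F g g₂ r₁ r₂ M) (0≤* (0≤nat 20) (0≤+ (p≤q⇒0≤q-p hM) (0≤+ (0≤* (0≤* (0≤nat 2) 0≤r₁) (p≤q⇒0≤q-p F≤g)) (0≤□ r₁)))))
    where
    0≤n : 0ℚ ≤ n
    0≤n = <⇒≤ 0<n
    0<n³ : 0ℚ < cube n
    0<n³ = 0<* (0<* 0<n 0<n) 0<n
    e₁ : ∀ F g g₂ r₁ r₂ M → nat 20 * ((g + r₁) * (g + r₁) - F * (g₂ + r₁ * 2ℚ + r₂)) - nat 20 * (F * M - F * r₂) ≡
         nat 20 * ((g * g - F * g₂) - F * M + (2ℚ * r₁ * (g - F) + r₁ * r₁))
    e₁ = solve-∀ ringℚ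
    2M≤ : 2ℚ * (nat 10 * K + nat 160 * C) ≤ cube n * (i * i)
    2M≤ = *-cancelˡ {nat 9} (positive⁻¹ (nat 9)) (≤-trans (≤-reflexive (eq (nat 10 * K + nat 160 * C))) (≤-trans hn (n≤9n³i² 0≤n 0≤i pi p≤)))
      where
      eq : ∀ a → nat 9 * (2ℚ * a) ≡ nat 18 * a
      eq = solve-∀ ringℚ
    main : cube n * (F * F * (i * i)) ≤ cube n * (nat 20 * (F * M - F * r₂))
    main = ≤-by (eq (cube n) F M S r₂ i K C) (0≤+ (0≤+ (0≤* (0≤* (0≤nat 2) (0≤* (<⇒≤ 0<n³) 0≤F)) (p≤q⇒0≤q-p hS)) (0≤* (0≤* (0≤nat 20) 0≤F) (p≤q⇒0≤q-p hK)))
        (0≤+ (0≤* (0≤* (0≤nat 20) 0≤F) (p≤q⇒0≤q-p hC)) (0≤* (0≤* 0≤F 0≤F) (p≤q⇒0≤q-p 2M≤))))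
      where
      eq : ∀ N F M S r i K C → N * (nat 20 * (F * M - F * r)) - N * (F * F * (i * i)) ≡
          2ℚ * (N * F) * (nat 10 * M + nat 10 * S - F * (i * i)) + nat 20 * F * (K * F - N * S)
          + (nat 20 * F * (nat 16 * C * F - N * r) + F * F * (N * (i * i) - 2ℚ * (nat 10 * K + nat 160 * C)))
      eq = solve-∀ ringℚ

gap : Eventually λ k → f k * f k * (ip k * ip k) ≤ nat 20 * Pgap k
gap = go X-bound r-tail f-quadruple
  where
  go : Eventually (λ u → nat 10 * X u ≤ nat 9 * t u) → Negligible r →
       Eventually (λ k → f (suc k) ≤ nat 4 * f k) → Eventually λ k → f k * f k * (ip k * ip k) ≤ nat 20 * Pgap k
  go (U₀ , hX) (C , 0≤C , hr) (K₁ , h4) = go′ (archimedean (nat 18 * (nat 10 * K + nat 160 * C)))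
    where
    open Gap U₀ hX
    K : ℚ
    K = nat 8 * C * sum V (λ _ → Ξ)
    r₂-tail : ∀ k → K₁ ℕ.≤ k → cube (ι k) * r (2 ℕ.+ k) ≤ nat 16 * C * f k
    r₂-tail k K₁≤k = ≤-trans (*-monoʳ (0⊑r (2 ℕ.+ k)) (cube-mono (0≤ι k) (ι-mono (ℕₚ.m≤n+m k 2)))) (≤-trans (hr (2 ℕ.+ k))
      (≤-trans (*-monoˡ 0≤C (≤-trans (h4 (suc k) (ℕₚ.m≤n⇒m≤1+n K₁≤k)) (*-monoˡ (0≤nat 4) (h4 k K₁≤k)))) (≤-reflexive (eq C (f k)))))
      where
      eq : ∀ c f → c * (nat 4 * (nat 4 * f)) ≡ nat 16 * c * f
      eq = solve-∀ ringℚ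
    go′ : (∃ λ n → nat 18 * (nat 10 * K + nat 160 * C) ≤ ι n) → Eventually λ k → f k * f k * (ip k * ip k) ≤ nat 20 * Pgap k
    go′ (n , hn) = suc (n ℕ.+ (K₁ ℕ.+ (V ℕ.+ V))) , bound
      where
      bound : ∀ k → suc (n ℕ.+ (K₁ ℕ.+ (V ℕ.+ V))) ℕ.≤ k → f k * f k * (ip k * ip k) ≤ nat 20 * Pgap k
      bound (suc j) (s≤s h) = final-algebra {f k} {f (suc k)} {f (2 ℕ.+ k)} {(r ⊛ ℓ⁺) k} {(r ⊛ ℓ⁺⁺) k} {r (suc k)} {r (2 ℕ.+ k)} {(r ⊛ t) k - (r ⊛ X) k} {(r ⊛ lw) k} {ip k} {pp k} {ι k} {C} {K}
        (f-suc k) (f-suc² k) (mixing k) (f≤g k) (0⊑f k) (0⊑r (suc k)) (0⊑r (2 ℕ.+ k)) (averaged k) (0<ι j)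
        (lw-tail C 0≤C hr k (le (ℕₚ.≤-trans (ℕₚ.m≤n+m (V ℕ.+ V) K₁) (ℕₚ.m≤n+m (K₁ ℕ.+ (V ℕ.+ V)) n)))) (r₂-tail k (le (ℕₚ.≤-trans (ℕₚ.m≤m+n K₁ (V ℕ.+ V)) (ℕₚ.m≤n+m (K₁ ℕ.+ (V ℕ.+ V)) n))))
        (p*ip k) (ppι≤ j) (0≤ip k) (≤-trans hn (ι-mono (le (ℕₚ.m≤m+n n (K₁ ℕ.+ (V ℕ.+ V))))))
        where
        k : ℕ
        k = suc j
        le : ∀ {m} → m ℕ.≤ n ℕ.+ (K₁ ℕ.+ (V ℕ.+ V)) → m ℕ.≤ suc j
        le m≤ = ℕₚ.m≤n⇒m≤1+n (ℕₚ.≤-trans m≤ h)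

-- Weighted counts of overpartitions

total : ∀ {A : Set} → (A → ℚ) → List A → ℚ
total g []       = 0ℚ
total g (x ∷ xs) = g x + total g xs

total-++ : ∀ {A : Set} (h : A → ℚ) xs ys → total h (xs ++ ys) ≡ total h xs + total h ys
total-++ h []       ys = sym (+-identityˡ (total h ys))
total-++ h (x ∷ xs) ys = trans (cong (h x +_) (total-++ h xs ys)) (sym (+-assoc (h x) (total h xs) (total h ys)))

total-map : ∀ {A B : Set} (h : B → ℚ) (k : A → B) xs → total h (map k xs) ≡ total (h ∘ k) xs
total-map h k []       = refl
total-map h k (x ∷ xs) = cong (h (k x) +_) (total-map h k xs)

total-cong : ∀ {A : Set} {h k : A → ℚ} → h ≗ k → ∀ xs → total h xs ≡ total k xs
total-cong e []       = refl
total-cong e (x ∷ xs) = cong₂ _+_ (e x) (total-cong e xs)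

total-concatMap : ∀ {B : Set} (h : B → ℚ) (k : ℕ → List B) (φ : ℕ → ℕ) N →
                  total h (concatMap k (applyUpTo φ N)) ≡ sum N (λ m → total h (k (φ m)))
total-concatMap h k φ zero    = refl
total-concatMap h k φ (suc N) = trans (total-++ h (k (φ 0)) (concatMap k (applyUpTo (φ ∘ suc) N)))
  (cong (total h (k (φ 0)) +_) (total-concatMap h k (φ ∘ suc) N))

total-sum : ∀ {A : Set} N (h : ℕ → A → ℚ) xs → total (λ x → sum N (λ i → h i x)) xs ≡ sum N (λ i → total (h i) xs)
total-sum N h []       = sym (sum-0 N)
total-sum N h (x ∷ xs) = trans (cong (sum N (λ i → h i x) +_) (total-sum N h xs)) (sym (sum-+ N (λ i → h i x) (λ i → total (h i) xs)))

0≤total : ∀ {A : Set} {h : A → ℚ} → (∀ x → 0ℚ ≤ h x) → ∀ xs → 0ℚ ≤ total h xs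
0≤total 0≤h []       = ≤-refl
0≤total 0≤h (x ∷ xs) = 0≤+ (0≤h x) (0≤total 0≤h xs)

ind : ∀ {A : Set} → Dec A → ℚ
ind d = if does d then 1ℚ else 0ℚ

ind-yes : ∀ {A : Set} (d : Dec A) → A → ind d ≡ 1ℚ
ind-yes (yes _) _ = refl
ind-yes (no ¬a) a = ⊥-elim (¬a a)

ind-no : ∀ {A : Set} (d : Dec A) → ¬ A → ind d ≡ 0ℚ
ind-no (yes a) ¬a = ⊥-elim (¬a a)
ind-no (no _)  _  = refl

ind-⇔ : ∀ {A B : Set} (d : Dec A) (d′ : Dec B) → (A → B) → (B → A) → ind d ≡ ind d′
ind-⇔ (yes a) d′ to from = sym (ind-yes d′ (to a))
ind-⇔ (no ¬a) d′ to from = sym (ind-no d′ (¬a ∘ from))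

0≤ind : ∀ {A : Set} (d : Dec A) → 0ℚ ≤ ind d
0≤ind (yes _) = 0≤1
0≤ind (no _)  = ≤-refl

length-filter : ∀ {A : Set} {P : A → Set} (P? : ∀ x → Dec (P x)) xs → ι (length (filter P? xs)) ≡ total (λ x → ind (P? x)) xs
length-filter P? []       = refl
length-filter P? (x ∷ xs) with does (P? x)
... | true  = cong (1ℚ +_) (length-filter P? xs)
... | false = trans (length-filter P? xs) (sym (+-identityˡ (total (λ x → ind (P? x)) xs)))

Tot : (OverPartition → ℚ) → ℕ → Series
Tot h k n = total h (gen k n)

private
  branch : (OverPartition → ℚ) → ℕ → ℕ → OverPartition → Series
  branch h k m p n = total h (if does (m ℕₚ.≤? n) then map (p ++_) (gen k (n ∸ m)) else [])

  branch-sh : ∀ h k m p n → branch h k m p n ≡ sh m (Tot (h ∘ (p ++_)) k) n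
  branch-sh h k m p n = go (ℕₚ.<-≤-connex n m)
    where
    branchᵇ : Bool → ℚ
    branchᵇ c = total h (if c then map (p ++_) (gen k (n ∸ m)) else [])
    go : n ℕ.< m ⊎ m ℕ.≤ n → branch h k m p n ≡ sh m (Tot (h ∘ (p ++_)) k) n
    go (inj₁ n<m) = trans (cong branchᵇ (dec-false (m ℕₚ.≤? n) (ℕₚ.<⇒≱ n<m))) (sym (sh-< (Tot (h ∘ (p ++_)) k) n<m))
    go (inj₂ m≤n) = trans (cong branchᵇ (dec-true (m ℕₚ.≤? n) m≤n))
      (trans (total-map h (p ++_) (gen k (n ∸ m))) (sym (sh-≥ (Tot (h ∘ (p ++_)) k) m≤n)))

Tot-suc : ∀ h k n → Tot h (suc k) n ≡
          sum (suc n) (λ m → sh (m ℕ.* suc k) (Tot (h ∘ (block (suc k) false m ++_)) k) n)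
          + sum (suc n) (λ m → sh (suc m ℕ.* suc k) (Tot (h ∘ (block (suc k) true m ++_)) k) n)
Tot-suc h k n = trans (total-++ h (row false) (row true ++ [])) (cong₂ _+_ (rows false)
    (trans (total-++ h (row true) []) (trans (+-identityʳ (total h (row true))) (rows true))))
  where
  cell : Bool → ℕ → List OverPartition
  cell ov m = if does (bsize ov m ℕ.* suc k ℕₚ.≤? n) then map (block (suc k) ov m ++_) (gen k (n ∸ bsize ov m ℕ.* suc k)) else []
  row : Bool → List OverPartition
  row ov = concatMap (cell ov) (upTo (suc n))
  rows : ∀ ov → total h (row ov) ≡ sum (suc n) (λ m → sh (bsize ov m ℕ.* suc k) (Tot (h ∘ (block (suc k) ov m ++_)) k) n)
  rows ov = trans (total-concatMap h (cell ov) id (suc n))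
    (sum-congˡ (suc n) (λ m → branch-sh h k (bsize ov m ℕ.* suc k) (block (suc k) ov m) n))

-- Each non-overlined copy of K contributes ε K to the statistic stat = number of parts + number of odd non-overlined parts.

oddBit ε : ℕ → ℕ
oddBit K = if isOdd K then 1 else 0
ε K      = suc (oddBit K)

stat : OverPartition → ℕ
stat μ = numParts μ ℕ.+ numOddNonOver μ

numOdd-++ : ∀ xs ys → numOddNonOver (xs ++ ys) ≡ numOddNonOver xs ℕ.+ numOddNonOver ys
numOdd-++ []                 ys = refl
numOdd-++ ((k , true)  ∷ xs) ys = numOdd-++ xs ys
numOdd-++ ((k , false) ∷ xs) ys = trans (cong (oddBit k ℕ.+_) (numOdd-++ xs ys)) (sym (ℕₚ.+-assoc (oddBit k) (numOddNonOver xs) (numOddNonOver ys)))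

+-interchange : ∀ a c d e → (a ℕ.+ c) ℕ.+ (d ℕ.+ e) ≡ (a ℕ.+ d) ℕ.+ (c ℕ.+ e)
+-interchange = ℕ-Solver.solve-∀

stat-++ : ∀ xs ys → stat (xs ++ ys) ≡ stat xs ℕ.+ stat ys
stat-++ xs ys = trans (cong₂ ℕ._+_ (length-++ xs) (numOdd-++ xs ys)) (+-interchange (length xs) (length ys) (numOddNonOver xs) (numOddNonOver ys))

stat-false : ∀ K m → stat (block K false m) ≡ m ℕ.* ε K
stat-false K zero    = refl
stat-false K (suc m) = trans (arith (length (replicate m (K , false))) (oddBit K) (numOddNonOver (replicate m (K , false)))) (cong (ε K ℕ.+_) (stat-false K m))
  where
  arith : ∀ a c d → suc a ℕ.+ (c ℕ.+ d) ≡ suc c ℕ.+ (a ℕ.+ d)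
  arith = ℕ-Solver.solve-∀

stat-true : ∀ K m → stat (block K true m) ≡ suc (m ℕ.* ε K)
stat-true K m = cong suc (stat-false K m)

-- The family index s is the statistic accumulated so far, so a family plays the role of a
-- two-variable generating function. `O` adds the optional overlined copy, which always counts one,
-- and `Geo` the non-overlined copies.
O step : ℕ → (ℕ → Series) → ℕ → Series
O K Φ s  = Φ s ⊞ sh K (Φ (s ℕ.+ 1))
step K Φ = O K (Geo K (ε K) Φ)

module Counts (χ : ℕ → ℚ) where

  Ψ : ℕ → ℕ → Series
  Ψ k s = Tot (λ μ → χ (s ℕ.+ stat μ)) k

  Tot-block : ∀ k s ov m d → stat (block (suc k) ov m) ≡ d →
              Tot ((λ μ → χ (s ℕ.+ stat μ)) ∘ (block (suc k) ov m ++_)) k ≗ Ψ k (s ℕ.+ d)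
  Tot-block k s ov m d refl n = total-cong (λ μ → cong χ (trans (cong (s ℕ.+_) (stat-++ (block (suc k) ov m) μ))
    (sym (ℕₚ.+-assoc s (stat (block (suc k) ov m)) (stat μ))))) (gen k n)

  Ψ-suc : ∀ k s → Ψ (suc k) s ≗ step (suc k) (Ψ k) s
  Ψ-suc k s n = trans (Tot-suc (λ μ → χ (s ℕ.+ stat μ)) k n) (cong₂ _+_ first second)
    where
    K : ℕ
    K = suc k
    first : sum (suc n) (λ m → sh (m ℕ.* K) (Tot ((λ μ → χ (s ℕ.+ stat μ)) ∘ (block K false m ++_)) k) n) ≡ Geo K (ε K) (Ψ k) s n
    first = sum-congˡ (suc n) (λ m → sh-cong (m ℕ.* K) (Tot-block k s false m (m ℕ.* ε K) (stat-false K m)) n)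
    second : sum (suc n) (λ m → sh (suc m ℕ.* K) (Tot ((λ μ → χ (s ℕ.+ stat μ)) ∘ (block K true m ++_)) k) n) ≡ sh K (Geo K (ε K) (Ψ k) (s ℕ.+ 1)) n
    second = trans (sum-congˡ (suc n) (λ m → trans (sh-cong (suc m ℕ.* K) (Tot-block k s true m (suc (m ℕ.* ε K)) (stat-true K m)) n)
        (trans (sym (sh-sh K (m ℕ.* K) (Ψ k (s ℕ.+ suc (m ℕ.* ε K))) n)) (cong (λ i → sh K (sh (m ℕ.* K) (Ψ k i)) n) (sym (ℕₚ.+-assoc s 1 (m ℕ.* ε K)))))))
      (trans (sym (sh-sum K (suc n) (geoTerm K (ε K) (Ψ k) (s ℕ.+ 1)) n))
        (sh-cong< k n (λ i i<n → Geo-range k (ε K) (Ψ k) (s ℕ.+ 1) i (suc n) (ℕₚ.m≤n⇒m≤1+n i<n))))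

-- Oscillation of families of series

infix 4 _≋_
_≋_ : (ℕ → Series) → (ℕ → Series) → Set
Φ ≋ Φ′ = ∀ s → Φ s ≗ Φ′ s

Osc : (ℕ → Series) → Series → Set
Osc Φ β = ∀ s s′ n → Φ s n ≤ Φ s′ n + β n

Periodic : ℕ → (ℕ → Series) → Set
Periodic c Φ = ∀ s n → Φ (c ℕ.+ s) n ≡ Φ s n

Osc-cong : ∀ {Φ Φ′ β β′} → Φ ≋ Φ′ → β ≗ β′ → Osc Φ β → Osc Φ′ β′
Osc-cong {Φ} {Φ′} {β} {β′} h k o s s′ n = subst₂ _≤_ (h s n) (cong₂ _+_ (h s′ n) (k n)) (o s s′ n)

sh-osc : ∀ k {Φ β} → Osc Φ β → ∀ s s′ n → sh k (Φ s) n ≤ sh k (Φ s′) n + sh k β n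
sh-osc k {Φ} {β} o s s′ n = ≤-trans (sh-mono k (o s s′) n) (≤-reflexive (sh-⊞ k (Φ s′) β n))

Osc-Geo : ∀ K e {Φ β} → Osc Φ β → Osc (Geo K e Φ) (geo K β)
Osc-Geo K e {Φ} {β} o s s′ n = ≤-trans (sum-mono (suc n) (λ m _ → sh-osc (m ℕ.* K) {Φ} {β} o (s ℕ.+ m ℕ.* e) (s′ ℕ.+ m ℕ.* e) n))
  (≤-reflexive (sum-+ (suc n) (λ m → geoTerm K e Φ s′ m n) (λ m → sh (m ℕ.* K) β n)))

Osc-O : ∀ K {Φ β} → Osc Φ β → Osc (O K Φ) (β ⊞ sh K β)
Osc-O K {Φ} {β} o s s′ n = ≤-trans (+-mono-≤ (o s s′ n) (sh-osc K {Φ} {β} o (s ℕ.+ 1) (s′ ℕ.+ 1) n))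
  (≤-reflexive (eq (Φ s′ n) (β n) (sh K (Φ (s′ ℕ.+ 1)) n) (sh K β n)))
  where
  eq : ∀ a b c d → a + b + (c + d) ≡ a + c + (b + d)
  eq = solve-∀ ringℚ

U-⊛ : ∀ k β → geo (suc k) β ⊞ sh (suc k) (geo (suc k) β) ≗ U (suc k) ⊛ β
U-⊛ k β n = sym (trans (⊛-distribʳ (g (suc k)) (sh (suc k) (g (suc k))) β n)
  (cong₂ _+_ (sym (geo-⊛ k β n)) (trans (sh-⊛ (suc k) (g (suc k)) β n) (sh-cong (suc k) (λ i → sym (geo-⊛ k β i)) n))))

Osc-step : ∀ k {Φ β} → Osc Φ β → Osc (step (suc k) Φ) (U (suc k) ⊛ β)
Osc-step k {Φ} {β} o = Osc-cong {step (suc k) Φ} (λ s n → refl) (U-⊛ k β)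
  (Osc-O (suc k) {Geo (suc k) (ε (suc k)) Φ} {geo (suc k) β} (Osc-Geo (suc k) (ε (suc k)) {Φ} {β} o))

Periodic-Geo : ∀ {c} K e {Φ} → Periodic c Φ → Periodic c (Geo K e Φ)
Periodic-Geo {c} K e {Φ} h s n = sum-congˡ (suc n) (λ m → sh-cong (m ℕ.* K)
  (λ i → trans (cong (λ j → Φ j i) (ℕₚ.+-assoc c s (m ℕ.* e))) (h (s ℕ.+ m ℕ.* e) i)) n)

window : ∀ c (A : ℕ → ℚ) → (∀ s → A (c ℕ.+ s) ≡ A s) → ∀ s → sum c (λ j → A (s ℕ.+ j)) ≡ sum c A
window c A h zero    = refl
window c A h (suc s) = trans shift (window c A h s)
  where
  B : ℕ → ℚ
  B j = A (s ℕ.+ j)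
  eq : ∀ p q → q ≡ p + q - p
  eq = solve-∀ ringℚ
  eq₂ : ∀ p q → q + p - p ≡ q
  eq₂ = solve-∀ ringℚ
  Bc : B c ≡ B 0
  Bc = trans (cong A (ℕₚ.+-comm s c)) (trans (h s) (cong A (sym (ℕₚ.+-identityʳ s))))
  shift : sum c (λ j → A (suc s ℕ.+ j)) ≡ sum c B
  shift = trans (sum-congˡ c (λ j → cong A (sym (ℕₚ.+-suc s j)))) (trans (eq (B 0) (sum c (B ∘ suc)))
    (trans (cong (_- B 0) (trans (sum-last c B) (cong (sum c B +_) Bc))) (eq₂ (B 0) (sum c B))))

Geo-unroll : ∀ k e Φ s M n → Geo (suc k) e Φ s n ≡
             sum M (λ m → geoTerm (suc k) e Φ s m n) + sh (M ℕ.* suc k) (Geo (suc k) e Φ (s ℕ.+ M ℕ.* e)) n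
Geo-unroll k e Φ s zero    n = trans (cong (λ i → Geo (suc k) e Φ i n) (sym (ℕₚ.+-identityʳ s))) (sym (+-identityˡ (Geo (suc k) e Φ (s ℕ.+ 0) n)))
Geo-unroll k e Φ s (suc M) n = begin
  Geo K e Φ s n                                                           ≡⟨ Geo-unroll k e Φ s M n ⟩
  S + sh (M ℕ.* K) (Geo K e Φ s₁) n                                       ≡⟨ cong (S +_) (trans (sh-cong (M ℕ.* K) (Geo-fix k e Φ s₁) n) (sh-⊞ (M ℕ.* K) (Φ s₁) (sh K (Geo K e Φ (s₁ ℕ.+ e))) n)) ⟩
  S + (sh (M ℕ.* K) (Φ s₁) n + sh (M ℕ.* K) (sh K (Geo K e Φ (s₁ ℕ.+ e))) n) ≡⟨ sym (+-assoc S (sh (M ℕ.* K) (Φ s₁) n) (sh (M ℕ.* K) (sh K (Geo K e Φ (s₁ ℕ.+ e))) n)) ⟩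
  S + sh (M ℕ.* K) (Φ s₁) n + sh (M ℕ.* K) (sh K (Geo K e Φ (s₁ ℕ.+ e))) n
    ≡⟨ cong₂ _+_ (sym (sum-last M (λ m → geoTerm K e Φ s m n)))
         (trans (sh-swap (M ℕ.* K) K (Geo K e Φ (s₁ ℕ.+ e)) n) (trans (sh-sh K (M ℕ.* K) (Geo K e Φ (s₁ ℕ.+ e)) n)
           (cong (λ i → sh (K ℕ.+ M ℕ.* K) (Geo K e Φ i) n) (trans (ℕₚ.+-assoc s (M ℕ.* e) e) (cong (s ℕ.+_) (ℕₚ.+-comm (M ℕ.* e) e)))))) ⟩
  sum (suc M) (λ m → geoTerm K e Φ s m n) + sh (suc M ℕ.* K) (Geo K e Φ (s ℕ.+ suc M ℕ.* e)) n ∎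
  where
  open ≡-Reasoning
  K s₁ : ℕ
  K = suc k
  s₁ = s ℕ.+ M ℕ.* e
  S : ℚ
  S = sum M (λ m → geoTerm K e Φ s m n)

trunc : ℕ → ℕ → Series → Series
trunc p M β n = sum M (λ m → sh (m ℕ.* p) β n)

sh-mono< : ∀ k {a c} n → (∀ i → i ℕ.< n → a i ≤ c i) → sh (suc k) a n ≤ sh (suc k) c n
sh-mono< k       zero    h = ≤-refl
sh-mono< zero    (suc n) h = h n ℕₚ.≤-refl
sh-mono< (suc k) (suc n) h = sh-mono< k n (λ i i<n → h i (ℕₚ.m≤n⇒m≤1+n i<n))

-- Trading two copies of p for one copy of 2 p changes the statistic by one.  The pairs of multiplicities
-- (m + 2 (c − 1 − j), j + c m′), 0 ≤ j < c, therefore run through all residues; only fewer than 2 c copies of p escape.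
module Pair (c′ : ℕ) (p′ : ℕ) (Y : ℕ → Series) (β : Series) (Y-per : Periodic (suc c′) Y) (o : Osc Y β) (0≤β : 0̂ ⊑ β) where

  private
    c p q : ℕ
    c = suc c′
    p = suc p′
    q = p ℕ.+ p

    A Θ : ℕ → Series
    A = Geo p 1 Y
    Θ = Geo q 1 A

    Mj : ℕ → ℕ
    Mj j = (c′ ∸ j) ℕ.+ (c′ ∸ j)

    bad : ℕ → ℕ → Series
    bad s j n = sum (Mj j) (λ m → sh (j ℕ.* q) (sh (m ℕ.* p) (Y (s ℕ.+ j ℕ.* 1 ℕ.+ m ℕ.* 1))) n)

    rest : Series
    rest = sh (c′ ℕ.* q) (λ n → sum c (λ j → A j n))

    Θ-per : Periodic c Θ
    Θ-per = Periodic-Geo q 1 {A} (Periodic-Geo p 1 {Y} Y-per)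

    A-per : Periodic c A
    A-per = Periodic-Geo p 1 {Y} Y-per

    split : ∀ s j n → j ℕ.≤ c′ → sh (j ℕ.* q) (A (s ℕ.+ j ℕ.* 1)) n ≡ bad s j n + sh (c′ ℕ.* q) (A (s ℕ.+ c′ ℕ.+ (c′ ∸ j))) n
    split s j n j≤c′ = begin
      sh (j ℕ.* q) (A s₁) n
        ≡⟨ sh-cong (j ℕ.* q) (Geo-unroll p′ 1 Y s₁ (Mj j)) n ⟩
      sh (j ℕ.* q) (λ i → sum (Mj j) (λ m → geoTerm p 1 Y s₁ m i) + sh (Mj j ℕ.* p) (A (s₁ ℕ.+ Mj j ℕ.* 1)) i) n
        ≡⟨ sh-⊞ (j ℕ.* q) (λ i → sum (Mj j) (λ m → geoTerm p 1 Y s₁ m i)) (sh (Mj j ℕ.* p) (A (s₁ ℕ.+ Mj j ℕ.* 1))) n ⟩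
      sh (j ℕ.* q) (λ i → sum (Mj j) (λ m → geoTerm p 1 Y s₁ m i)) n + sh (j ℕ.* q) (sh (Mj j ℕ.* p) (A (s₁ ℕ.+ Mj j ℕ.* 1))) n
        ≡⟨ cong₂ _+_ (sh-sum (j ℕ.* q) (Mj j) (geoTerm p 1 Y s₁) n)
             (trans (sh-sh (j ℕ.* q) (Mj j ℕ.* p) (A (s₁ ℕ.+ Mj j ℕ.* 1)) n)
               (cong₂ (λ a i → sh a (A i) n) (trans (arith₁ j (c′ ∸ j) p) (cong (ℕ._* q) j+)) (trans (arith₂ s j (c′ ∸ j)) (cong (λ a → s ℕ.+ a ℕ.+ (c′ ∸ j)) j+)))) ⟩
      bad s j n + sh (c′ ℕ.* q) (A (s ℕ.+ c′ ℕ.+ (c′ ∸ j))) n ∎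
      where
      open ≡-Reasoning
      s₁ : ℕ
      s₁ = s ℕ.+ j ℕ.* 1
      j+ : j ℕ.+ (c′ ∸ j) ≡ c′
      j+ = ℕₚ.m+[n∸m]≡n j≤c′
      arith₁ : ∀ j d p → j ℕ.* (p ℕ.+ p) ℕ.+ (d ℕ.+ d) ℕ.* p ≡ (j ℕ.+ d) ℕ.* (p ℕ.+ p)
      arith₁ = ℕ-Solver.solve-∀
      arith₂ : ∀ s j d → s ℕ.+ j ℕ.* 1 ℕ.+ (d ℕ.+ d) ℕ.* 1 ≡ s ℕ.+ (j ℕ.+ d) ℕ.+ d
      arith₂ = ℕ-Solver.solve-∀

    decompose : ∀ s n → Θ s n ≡ sum c (λ j → bad s j n) + rest n + sh (c ℕ.* q) (Θ s) n
    decompose s n = trans (Geo-unroll (p′ ℕ.+ p) 1 A s c n) (cong₂ _+_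
        (trans (sum-cong c (λ { j (s≤s j≤c′) → split s j n j≤c′ })) (trans (sum-+ c (λ j → bad s j n) (λ j → sh (c′ ℕ.* q) (A (s ℕ.+ c′ ℕ.+ (c′ ∸ j))) n))
          (cong (sum c (λ j → bad s j n) +_) (trans (sym (sh-sum (c′ ℕ.* q) c (λ j → A (s ℕ.+ c′ ℕ.+ (c′ ∸ j))) n)) (sh-cong (c′ ℕ.* q) slide n)))))
        (sh-cong (c ℕ.* q) (λ i → trans (cong (λ a → Θ a i) (trans (cong (s ℕ.+_) (ℕₚ.*-identityʳ c)) (ℕₚ.+-comm s c))) (Θ-per s i)) n))
      where
      slide : ∀ i → sum c (λ j → A (s ℕ.+ c′ ℕ.+ (c′ ∸ j)) i) ≡ sum c (λ j → A j i)
      slide i = trans (sym (sum-rev c′ (λ j → A (s ℕ.+ c′ ℕ.+ j) i))) (window c (λ j → A j i) (λ a → A-per a i) (s ℕ.+ c′))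

    Bd : Series
    Bd = geo q (trunc p (c ℕ.+ c) β)

    Bd-unroll : ∀ n → Bd n ≡ sum c (λ j → sh (j ℕ.* q) (trunc p (c ℕ.+ c) β) n) + sh (c ℕ.* q) Bd n
    Bd-unroll n = trans (Geo-unroll (p′ ℕ.+ p) 0 (λ _ → trunc p (c ℕ.+ c) β) 0 c n)
      (cong (λ a → sum c (λ j → sh (j ℕ.* q) (trunc p (c ℕ.+ c) β) n) + sh (c ℕ.* q) (Geo q 0 (λ _ → trunc p (c ℕ.+ c) β) a) n) (ℕₚ.*-zeroʳ c))

    bad-osc : ∀ s s′ j n → bad s j n ≤ bad s′ j n + sh (j ℕ.* q) (trunc p (c ℕ.+ c) β) n
    bad-osc s s′ j n = ≤-trans (sum-mono (Mj j) (λ m _ → ≤-trans (sh-mono (j ℕ.* q) (sh-osc (m ℕ.* p) {Y} {β} o (s ℕ.+ j ℕ.* 1 ℕ.+ m ℕ.* 1) (s′ ℕ.+ j ℕ.* 1 ℕ.+ m ℕ.* 1)) n)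
        (≤-reflexive (sh-⊞ (j ℕ.* q) (sh (m ℕ.* p) (Y (s′ ℕ.+ j ℕ.* 1 ℕ.+ m ℕ.* 1))) (sh (m ℕ.* p) β) n))))
      (≤-trans (≤-reflexive (sum-+ (Mj j) (λ m → sh (j ℕ.* q) (sh (m ℕ.* p) (Y (s′ ℕ.+ j ℕ.* 1 ℕ.+ m ℕ.* 1))) n) (λ m → sh (j ℕ.* q) (sh (m ℕ.* p) β) n)))
        (+-monoʳ-≤ (bad s′ j n) (≤-trans (sum-mono-range (λ m → 0⊑sh (j ℕ.* q) (0⊑sh (m ℕ.* p) 0≤β) n) (ℕₚ.+-mono-≤ c′∸j≤c c′∸j≤c))
          (≤-reflexive (sym (sh-sum (j ℕ.* q) (c ℕ.+ c) (λ m → sh (m ℕ.* p) β) n))))))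
      where
      c′∸j≤c : c′ ∸ j ℕ.≤ c
      c′∸j≤c = ℕₚ.≤-trans (ℕₚ.m∸n≤m c′ j) (ℕₚ.n≤1+n c′)

    go : ∀ N n → n ℕ.≤ N → ∀ s s′ → Θ s n ≤ Θ s′ n + Bd n
    below′ : ∀ N n → n ℕ.≤ N → ∀ s s′ → sh (c ℕ.* q) (Θ s) n ≤ sh (c ℕ.* q) (Θ s′) n + sh (c ℕ.* q) Bd n
    go N n n≤N s s′ = subst₂ _≤_ (sym (decompose s n)) (trans (eq (sum c (λ j → bad s′ j n)) (rest n) (sh (c ℕ.* q) (Θ s′) n)
          (sum c (λ j → sh (j ℕ.* q) (trunc p (c ℕ.+ c) β) n)) (sh (c ℕ.* q) Bd n)) (cong₂ _+_ (sym (decompose s′ n)) (sym (Bd-unroll n))))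
      (+-mono-≤ (+-monoˡ-≤ (rest n) (≤-trans (sum-mono c (λ j _ → bad-osc s s′ j n)) (≤-reflexive (sum-+ c (λ j → bad s′ j n) (λ j → sh (j ℕ.* q) (trunc p (c ℕ.+ c) β) n)))))
        (below′ N n n≤N s s′))
      where
      eq : ∀ a b c d e → a + d + b + (c + e) ≡ a + b + c + (d + e)
      eq = solve-∀ ringℚ
    below′ N       zero    n≤N       s s′ = ≤-refl
    below′ (suc N) n@(suc n′) (s≤s n≤N) s s′ = ≤-trans (sh-mono< (p′ ℕ.+ p ℕ.+ c′ ℕ.* q) {Θ s} {Θ s′ ⊞ Bd} n (λ i i<n → go N i (ℕₚ.≤-trans (ℕₚ.≤-pred i<n) n≤N) s s′))
      (≤-reflexive (sh-⊞ (c ℕ.* q) (Θ s′) Bd n))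

  pair-osc : Osc (Geo (p ℕ.+ p) 1 (Geo p 1 Y)) (geo (p ℕ.+ p) (trunc p (c ℕ.+ c) β))
  pair-osc s s′ n = go n n ℕₚ.≤-refl s s′

sh-cong≤ : ∀ k {a c} n → (∀ i → i ℕ.≤ n → a i ≡ c i) → sh k a n ≡ sh k c n
sh-cong≤ zero    n       h = h n ℕₚ.≤-refl
sh-cong≤ (suc k) zero    h = refl
sh-cong≤ (suc k) (suc n) h = sh-cong≤ k n (λ i i≤n → h i (ℕₚ.m≤n⇒m≤1+n i≤n))

Geo-cong : ∀ K e {Φ Φ′} → Φ ≋ Φ′ → Geo K e Φ ≋ Geo K e Φ′
Geo-cong K e h s n = sum-congˡ (suc n) (λ m → sh-cong (m ℕ.* K) (h (s ℕ.+ m ℕ.* e)) n)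

O-cong : ∀ K {Φ Φ′} → Φ ≋ Φ′ → O K Φ ≋ O K Φ′
O-cong K h s n = cong₂ _+_ (h s n) (sh-cong K (h (s ℕ.+ 1)) n)

+-swapʳ : ∀ s a c → s ℕ.+ a ℕ.+ c ≡ s ℕ.+ c ℕ.+ a
+-swapʳ = ℕ-Solver.solve-∀

Geo-double : ∀ K e l d Φ s n → Geo K e (Geo (suc l) d Φ) s n ≡
             sum (suc n) (λ m → sum (suc n) (λ j → sh (m ℕ.* K) (sh (j ℕ.* suc l) (Φ (s ℕ.+ m ℕ.* e ℕ.+ j ℕ.* d))) n))
Geo-double K e l d Φ s n = sum-congˡ (suc n) (λ m → trans
  (sh-cong≤ (m ℕ.* K) n (λ i i≤n → sym (Geo-range l d Φ (s ℕ.+ m ℕ.* e) i (suc n) (s≤s i≤n))))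
  (sh-sum (m ℕ.* K) (suc n) (geoTerm (suc l) d Φ (s ℕ.+ m ℕ.* e)) n))

Geo-comm : ∀ k e l d Φ → Geo (suc k) e (Geo (suc l) d Φ) ≋ Geo (suc l) d (Geo (suc k) e Φ)
Geo-comm k e l d Φ s n = trans (Geo-double (suc k) e l d Φ s n) (trans
  (sum-swap (suc n) (suc n) (λ m j → sh (m ℕ.* suc k) (sh (j ℕ.* suc l) (Φ (s ℕ.+ m ℕ.* e ℕ.+ j ℕ.* d))) n))
  (trans (sum-congˡ (suc n) (λ j → sum-congˡ (suc n) (λ m → trans (sh-swap (m ℕ.* suc k) (j ℕ.* suc l) (Φ (s ℕ.+ m ℕ.* e ℕ.+ j ℕ.* d)) n)
      (cong (λ i → sh (j ℕ.* suc l) (sh (m ℕ.* suc k) (Φ i)) n) (+-swapʳ s (m ℕ.* e) (j ℕ.* d))))))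
    (sym (Geo-double (suc l) d k e Φ s n))))

Geo-O : ∀ k e L Φ → Geo (suc k) e (O L Φ) ≋ O L (Geo (suc k) e Φ)
Geo-O k e L Φ s n = trans (sum-congˡ (suc n) (λ m → trans (sh-⊞ (m ℕ.* K) (Φ (s ℕ.+ m ℕ.* e)) (sh L (Φ (s ℕ.+ m ℕ.* e ℕ.+ 1))) n)
    (cong (sh (m ℕ.* K) (Φ (s ℕ.+ m ℕ.* e)) n +_) (trans (sh-swap (m ℕ.* K) L (Φ (s ℕ.+ m ℕ.* e ℕ.+ 1)) n)
      (cong (λ i → sh L (sh (m ℕ.* K) (Φ i)) n) (+-swapʳ s (m ℕ.* e) 1))))))
  (trans (sum-+ (suc n) (λ m → geoTerm K e Φ s m n) (λ m → sh L (geoTerm K e Φ (s ℕ.+ 1) m) n))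
    (cong (Geo K e Φ s n +_) (trans (sym (sh-sum L (suc n) (geoTerm K e Φ (s ℕ.+ 1)) n))
      (sh-cong≤ L n (λ i i≤n → Geo-range k e Φ (s ℕ.+ 1) i (suc n) (s≤s i≤n))))))
  where
  K : ℕ
  K = suc k

step-cong : ∀ K {Φ Φ′} → Φ ≋ Φ′ → step K Φ ≋ step K Φ′
step-cong K h = O-cong K (Geo-cong K (ε K) h)

Geo-step : ∀ k e l Φ → Geo (suc k) e (step (suc l) Φ) ≋ step (suc l) (Geo (suc k) e Φ)
Geo-step k e l Φ s n = trans (Geo-O k e (suc l) (Geo (suc l) (ε (suc l)) Φ) s n) (O-cong (suc l) (Geo-comm k e l (ε (suc l)) Φ) s n)

run : ℕ → ℕ → (ℕ → Series) → ℕ → Series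
run j zero    Φ = Φ
run j (suc d) Φ = step (suc (d ℕ.+ j)) (run j d Φ)

run-cong : ∀ j d {Φ Φ′} → Φ ≋ Φ′ → run j d Φ ≋ run j d Φ′
run-cong j zero    h = h
run-cong j (suc d) h = step-cong (suc (d ℕ.+ j)) (run-cong j d h)

Geo-run : ∀ k e j d Φ → Geo (suc k) e (run j d Φ) ≋ run j d (Geo (suc k) e Φ)
Geo-run k e j zero    Φ s n = refl
Geo-run k e j (suc d) Φ s n = trans (Geo-step k e (d ℕ.+ j) (run j d Φ) s n) (step-cong (suc (d ℕ.+ j)) (Geo-run k e j d Φ) s n)

-- Products of the factors (1 + q ^ K) / (1 − q ^ K)

Fp : ℕ → Series
Fp zero    = one
Fp (suc k) = U (suc k) ⊛ Fp k

0⊑Fp : ∀ k → 0̂ ⊑ Fp k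
0⊑Fp zero    = 0⊑one
0⊑Fp (suc k) = 0⊑⊛ {U (suc k)} {Fp k} (0⊑U (suc k)) (0⊑Fp k)

Tot-one : ∀ k → Tot (λ _ → 1ℚ) k ≗ Fp k
Tot-one zero    zero    = refl
Tot-one zero    (suc n) = refl
Tot-one (suc k) n = trans (Counts.Ψ-suc (λ _ → 1ℚ) k 0 n) (trans (U-⊛ k (Tot (λ _ → 1ℚ) k) n) (⊛-congˡ (U (suc k)) (Tot-one k) n))

θFp : ∀ k → θ (Fp k) ≗ beta k ⊛ Fp k
θFp zero    n = trans (θ-one n) (sym (⊛-zeroˡ one n))
θFp (suc k) n = trans (θ-⊛ (U (suc k)) (Fp k) n) (trans (cong₂ _+_
    (trans (⊛-congʳ (Fp k) (θU k) n) (⊛-assoc (lam (suc k)) (U (suc k)) (Fp k) n))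
    (trans (⊛-congˡ (U (suc k)) (θFp k) n) (⊛-swap (U (suc k)) (beta k) (Fp k) n)))
  (sym (⊛-distribʳ (lam (suc k)) (beta k) (Fp (suc k)) n)))

U-low : ∀ k i → i ℕ.< suc k → U (suc k) i ≡ one i
U-low k i i<K = trans (cong₂ _+_ (trans (geo-fix k one i) (cong (one i +_) (sh-< (g (suc k)) i<K))) (sh-< (g (suc k)) i<K))
  (trans (+-identityʳ (one i + 0ℚ)) (+-identityʳ (one i)))

Fp-low : ∀ k n → n ℕ.≤ k → Fp (suc k) n ≡ Fp k n
Fp-low k n n≤k = trans (⊛-cong≤ {U (suc k)} {one} {Fp k} {Fp k} n (λ i i≤n → U-low k i (s≤s (ℕₚ.≤-trans i≤n n≤k))) (λ _ _ → refl)) (⊛-identityˡ (Fp k) n)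

Fp-diag : ∀ d n → Fp (d ℕ.+ n) n ≡ Fp n n
Fp-diag zero    n = refl
Fp-diag (suc d) n = trans (Fp-low (d ℕ.+ n) n (ℕₚ.m≤n+m n d)) (Fp-diag d n)

Fp≡f : ∀ n → Fp n n ≡ f n
Fp≡f = logDeriv-unique b (λ n → Fp n n) f refl lem θf (sym f₀)
  where
  diag : ∀ {i n} → i ℕ.≤ n → Fp n i ≡ Fp i i
  diag {i} {n} i≤n = subst (λ k → Fp k i ≡ Fp i i) (ℕₚ.m∸n+n≡m i≤n) (Fp-diag (n ∸ i) i)
  lem : θ (λ n → Fp n n) ≗ b ⊛ (λ n → Fp n n)
  lem n = trans (θFp n n) (⊛-cong≤ {beta n} {b} {Fp n} {λ n → Fp n n} n (λ i i≤n → beta≥ i≤n) (λ i i≤n → diag i≤n))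

one⊑U : ∀ k → one ⊑ U (suc k)
one⊑U k n = ≤-trans (p≤p+q (0⊑sh (suc k) (0⊑geo (suc k) 0⊑one) n)) (≤-trans (≤-reflexive (sym (geo-fix k one n))) (p≤p+q (0⊑sh (suc k) (0⊑geo (suc k) 0⊑one) n)))

⊛-expand : ∀ {a c} → one ⊑ a → 0̂ ⊑ c → c ⊑ a ⊛ c
⊛-expand {a} {c} h 0≤c = ⊑-trans (⊑-reflexive (λ n → sym (⊛-identityˡ c n))) (⊛-monoʳ {one} {a} {c} 0≤c h)

Fp⊑f : ∀ k → Fp k ⊑ f
Fp⊑f k n = ≤-trans (up n) (≤-reflexive (trans (cong (λ i → Fp i n) (ℕₚ.+-comm n k)) (trans (Fp-diag k n) (Fp≡f n))))
  where
  up : ∀ d → Fp k n ≤ Fp (d ℕ.+ k) n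
  up zero    = ≤-refl
  up (suc d) = ≤-trans (up d) (⊛-expand {U (suc d ℕ.+ k)} {Fp (d ℕ.+ k)} (one⊑U (d ℕ.+ k)) (0⊑Fp (d ℕ.+ k)) n)

Fp-mono : ∀ k → Monotone (Fp (suc k))
Fp-mono zero    n = subst₂ _≤_ (sym (eq n)) (sym (eq (suc n))) (inc n)
  where
  eq : ∀ n → (U 1 ⊛ one) n ≡ 1ℚ + sh 1 I n
  eq n = trans (⊛-comm (U 1) one n) (trans (⊛-identityˡ (U 1) n) (cong₂ _+_ (g1≗I n) (sh-cong 1 g1≗I n)))
  inc : ∀ n → 1ℚ + sh 1 I n ≤ 1ℚ + sh 1 I (suc n)
  inc zero    = ≤ᵇ⇒≤ _
  inc (suc n) = ≤-refl
Fp-mono (suc k) n = ≤-trans (⊛-monoˡ {U (2 ℕ.+ k)} {Fp (suc k)} (0⊑U (2 ℕ.+ k)) (Fp-mono k) n)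
  (≤-trans (p≤p+q (0≤* (0⊑U (2 ℕ.+ k) (suc n)) (0⊑Fp (suc k) 0))) (≤-reflexive (sym (⊛-sucʳ (U (2 ℕ.+ k)) (Fp (suc k)) n))))

-- 1 + q + … + q ^ (K − 1)
poly : ℕ → Series
poly K = below K I

poly-⊛≤ : ∀ K {a} → 0̂ ⊑ a → Monotone a → poly K ⊛ a ⊑ ι K · a
poly-⊛≤ K {a} 0≤a mono n = ≤-trans (sum-mono (suc n) {g = λ i → poly K i * a n} (λ i _ → *-monoˡ (0⊑below K I 0⊑I i) (Monotone-≤ {a} mono (ℕₚ.m∸n≤m n i))))
  (≤-trans (≤-reflexive (sum-*ʳ (suc n) (a n) (poly K))) (*-monoʳ (0≤a n) (≤-trans (below-sum K I 0⊑I (suc n)) (≤-reflexive (sum-I K)))))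

I≗poly : ∀ k → I ≗ poly (suc k) ⊛ g (suc k)
I≗poly k n = trans (fixpoint-unique k (poly (suc k)) I (geo (suc k) (poly (suc k))) (λ n → eq (I n) (sh (suc k) I n)) (geo-fix k (poly (suc k))) n)
  (trans (geo-⊛ k (poly (suc k)) n) (⊛-comm (g (suc k)) (poly (suc k)) n))
  where
  eq : ∀ p q → p ≡ p - q + q
  eq = solve-∀ ringℚ

-- Vcut K M keeps only fewer than M non-overlined copies of K.

Ecut Vcut : ℕ → ℕ → Series
Ecut K M = trunc K M one
Vcut K M = Ecut K M ⊞ sh K (Ecut K M)

0⊑Ecut : ∀ K M → 0̂ ⊑ Ecut K M
0⊑Ecut K M n = 0≤sum M (λ m → 0⊑δ (m ℕ.* K) n)

0⊑Vcut : ∀ K M → 0̂ ⊑ Vcut K M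
0⊑Vcut K M n = 0≤+ (0⊑Ecut K M n) (0⊑sh K (0⊑Ecut K M) n)

trunc-⊛ : ∀ K M a → trunc K M a ≗ Ecut K M ⊛ a
trunc-⊛ K M a n = sym (trans (sum-congˡ (suc n) (λ i → sym (sum-*ʳ M (a (n ∸ i)) (λ m → δ (m ℕ.* K) i))))
  (trans (sum-swap (suc n) M (λ i m → δ (m ℕ.* K) i * a (n ∸ i)))
    (sum-congˡ M (λ m → trans (sh-⊛ (m ℕ.* K) one a n) (sh-cong (m ℕ.* K) (⊛-identityˡ a) n)))))

g-split : ∀ k M → g (suc k) ≗ Ecut (suc k) M ⊞ sh (M ℕ.* suc k) (g (suc k))
g-split k M n = trans (Geo-unroll k 0 (λ _ → one) 0 M n) (cong (λ i → Ecut (suc k) M n + sh (M ℕ.* suc k) (Geo (suc k) 0 (λ _ → one) i) n) (ℕₚ.*-zeroʳ M))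

U-split : ∀ k M → U (suc k) ≗ Vcut (suc k) M ⊞ sh (M ℕ.* suc k) (U (suc k))
U-split k M n = trans (cong₂ _+_ (g-split k M n) (trans (sh-cong K (g-split k M) n) (sh-⊞ K (Ecut K M) (sh N (g K)) n)))
  (trans (eq (Ecut K M n) (sh N (g K) n) (sh K (Ecut K M) n) (sh K (sh N (g K)) n))
    (cong (Vcut K M n +_) (trans (cong (sh N (g K) n +_) (sh-swap K N (g K) n)) (sym (sh-⊞ N (g K) (sh K (g K)) n)))))
  where
  K N : ℕ
  K = suc k
  N = M ℕ.* suc k
  eq : ∀ a b c d → a + b + (c + d) ≡ a + c + (b + d)
  eq = solve-∀ ringℚ

SubLog-Vcut : ∀ k M → SubLog (lam (suc k)) (Vcut (suc k) M)
SubLog-Vcut k M n = ≤-by (alg {ι n} {V n} {S n} {U K n} {(lam K ⊛ U K) n} {(lam K ⊛ V) n} {sh N (lam K ⊛ U K) n} {ι N} (θU k n) (U-split k M n) lamU (trans (θ-sh N (U K) n) (cong (ι N * S n +_) (sh-cong N (θU k) n)))) (0≤* (0≤ι N) (0⊑sh N (0⊑U K) n))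
  where
  K N : ℕ
  K = suc k
  N = M ℕ.* suc k
  V S : Series
  V = Vcut K M
  S = sh N (U K)
  lamU : (lam K ⊛ U K) n ≡ (lam K ⊛ V) n + sh N (lam K ⊛ U K) n
  lamU = trans (⊛-congˡ (lam K) (U-split k M) n) (trans (⊛-distribˡ (lam K) V S n) (cong ((lam K ⊛ V) n +_) (⊛-sh N (lam K) (U K) n)))
  alg : ∀ {m v s u lu lv ls i} → m * u ≡ lu → u ≡ v + s → lu ≡ lv + ls → m * s ≡ i * s + ls → lv - m * v ≡ i * s
  alg {m} {v} {s} {u} {lu} {lv} {ls} {i} h₁ refl h₃ h₄ = trans (eq m v s lv ls) (trans (cong₂ (λ p q → p - q - ls + m * s) (sym h₃) h₁) (trans (cong (λ p → lu - lu - ls + p) h₄) (eq₂ lu ls (i * s))))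
    where
    eq : ∀ m v s lv ls → lv - m * v ≡ lv + ls - m * (v + s) - ls + m * s
    eq = solve-∀ ringℚ
    eq₂ : ∀ a l s → a - a - l + (s + l) ≡ s
    eq₂ = solve-∀ ringℚ

I-Ecut : ∀ K M → I ⊛ Ecut K M ⊑ ι M · I
I-Ecut K M n = ≤-trans (≤-reflexive (trans (⊛-comm I (Ecut K M) n) (sym (trunc-⊛ K M I n))))
  (≤-trans (sum-mono M {g = λ _ → 1ℚ} (λ m _ → sh≤1 (m ℕ.* K) n)) (≤-reflexive (trans (sum-I M) (sym (*-identityʳ (ι M))))))
  where
  sh≤1 : ∀ k n → sh k I n ≤ 1ℚ
  sh≤1 zero    n       = ≤-refl
  sh≤1 (suc k) zero    = 0≤1
  sh≤1 (suc k) (suc n) = sh≤1 k n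

I-Vcut : ∀ k M → I ⊛ Vcut (suc k) M ⊑ ι M · (poly (suc k) ⊛ U (suc k))
I-Vcut k M n = ≤-trans (≤-reflexive (trans (⊛-distribˡ I (Ecut K M) (sh K (Ecut K M)) n) (cong ((I ⊛ Ecut K M) n +_) (⊛-sh K I (Ecut K M) n))))
  (≤-trans (+-mono-≤ (I-Ecut K M n) (≤-trans (sh-mono K (I-Ecut K M) n) (≤-reflexive (sh-· K (ι M) I n))))
    (≤-reflexive (trans (sym (*-distribˡ-+ (ι M) (I n) (sh K I n))) (cong (ι M *_) (trans (cong₂ _+_ (I≗poly k n) (trans (sh-cong K (I≗poly k) n) (sym (⊛-sh K (poly K) (g K) n))))
      (sym (⊛-distribˡ (poly K) (g K) (sh K (g K)) n)))))))
  where
  K : ℕ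
  K = suc k

I^-swap : ∀ s a c → I^ s (a ⊛ c) ≗ a ⊛ I^ s c
I^-swap zero    a c n = refl
I^-swap (suc s) a c n = trans (⊛-congˡ I (I^-swap s a c) n) (⊛-swap I a (I^ s c) n)

·-⊛ʳ : ∀ k a c → a ⊛ (k · c) ≗ k · (a ⊛ c)
·-⊛ʳ k a c n = trans (⊛-comm a (k · c) n) (trans (·-⊛ k c a n) (cong (k *_) (⊛-comm c a n)))

record Smooth (k s : ℕ) (C : ℚ) (β : Series) : Set where
  constructor smooth
  field
    nonneg : 0̂ ⊑ β
    sublog : SubLog (beta k) β
    0≤C    : 0ℚ ≤ C
    bound  : I^ s β ⊑ C · Fp k

open Smooth

Smooth-plain : ∀ {k s C β} → Smooth k s C β → Smooth (suc k) s C (U (suc k) ⊛ β)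
Smooth-plain {k} {s} {C} {β} h = smooth (0⊑⊛ {U (suc k)} {β} (0⊑U (suc k)) (nonneg h))
  (SubLog-⊛ {lam (suc k)} {beta k} {U (suc k)} {β} (0⊑U (suc k)) (nonneg h) (⊑-reflexive (θU k)) (sublog h)) (0≤C h)
  (⊑-trans (⊑-reflexive (I^-swap s (U (suc k)) β)) (⊑-trans (⊛-monoˡ {U (suc k)} {I^ s β} (0⊑U (suc k)) (bound h)) (⊑-reflexive (·-⊛ʳ C (U (suc k)) (Fp k)))))

Smooth-cut : ∀ {k s C β} M → Smooth k s C β → Smooth (suc k) (suc s) (ι M * C * ι (suc k)) (Vcut (suc k) M ⊛ β)
Smooth-cut {k} {s} {C} {β} M h = smooth (0⊑⊛ {V} {β} (0⊑Vcut K M) (nonneg h))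
  (SubLog-⊛ {lam K} {beta k} {V} {β} (0⊑Vcut K M) (nonneg h) (SubLog-Vcut k M) (sublog h)) (0≤* (0≤* (0≤ι M) (0≤C h)) (0≤ι K)) bnd
  where
  K : ℕ
  K = suc k
  V : Series
  V = Vcut K M
  eq : ∀ m c k a → m * (c * (k * a)) ≡ m * c * k * a
  eq = solve-∀ ringℚ
  bnd : I^ (suc s) (V ⊛ β) ⊑ (ι M * C * ι K) · Fp K
  bnd n = ≤-trans (≤-reflexive (trans (⊛-congˡ I (I^-swap s V β) n) (sym (⊛-assoc I V (I^ s β) n))))
    (≤-trans (⊛-monoʳ {I ⊛ V} {ι M · (poly K ⊛ U K)} {I^ s β} (0⊑I^ s (nonneg h)) (I-Vcut k M) n)
    (≤-trans (≤-reflexive (·-⊛ (ι M) (poly K ⊛ U K) (I^ s β) n))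
    (≤-trans (*-monoˡ (0≤ι M) (≤-trans (⊛-monoˡ {poly K ⊛ U K} {I^ s β} (0⊑⊛ {poly K} {U K} (0⊑below K I 0⊑I) (0⊑U K)) (bound h) n)
      (≤-trans (≤-reflexive (trans (·-⊛ʳ C (poly K ⊛ U K) (Fp k) n) (cong (C *_) (⊛-assoc (poly K) (U K) (Fp k) n))))
        (*-monoˡ (0≤C h) (poly-⊛≤ K {Fp K} (0⊑Fp K) (Fp-mono k) n)))))
    (≤-reflexive (eq (ι M) C (ι K) (Fp K n))))))

runU : ℕ → ℕ → Series → Series
runU j zero    β = β
runU j (suc d) β = U (suc (d ℕ.+ j)) ⊛ runU j d β

Smooth-run : ∀ {j s C β} d → Smooth j s C β → Smooth (d ℕ.+ j) s C (runU j d β)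
Smooth-run zero    h = h
Smooth-run (suc d) h = Smooth-plain (Smooth-run d h)

private
  tail-alg : ∀ {N A β J C F G : ℚ} → 0ℚ ≤ A → 0ℚ ≤ C → N * β ≤ A * J → J ≤ C * F → F ≤ G → N * β ≤ A * C * G
  tail-alg {N} {A} {β} {J} {C} {F} {G} 0≤A 0≤C h₁ h₂ h₃ = ≤-trans h₁ (≤-trans (*-monoˡ 0≤A (≤-trans h₂ (*-monoˡ 0≤C h₃))) (≤-reflexive (sym (*-assoc A C G))))

Smooth-tail : ∀ {k C β} → Smooth k 12 C β → ∀ n → cube (ι n) * β n ≤ cube 312ℚ * C * f n
Smooth-tail {k} {C} {β} h n = tail-alg {cube (ι n)} {cube 312ℚ} {β n} {I^ 12 β n} {C} {Fp k n} {f n} (0≤cube (0≤nat 312)) (0≤C h)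
  (smoothing {β} (nonneg h) (SubLog-mono {beta k} {b} {β} (nonneg h) (beta≤b k) (sublog h)) n) (bound h n) (Fp⊑f k n)

Fp-tail : ∀ h → Negligible (Fp h)
Fp-tail h = go (iterate 12)
  where
  base : Smooth h 0 1ℚ (Fp h)
  base = smooth (0⊑Fp h) (⊑-reflexive (θFp h)) 0≤1 (⊑-reflexive (λ n → sym (*-identityˡ (Fp h n))))
  one⊑Vcut : ∀ K → one ⊑ Vcut K 1
  one⊑Vcut K n = ≤-trans (≤-reflexive (sym (+-identityʳ (one n)))) (p≤p+q (0⊑sh K (0⊑Ecut K 1) n))
  iterate : ∀ s → ∃ λ k → ∃ λ C → ∃ λ β → Smooth k s C β × Fp h ⊑ β
  iterate zero    = h , 1ℚ , Fp h , base , ⊑-refl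
  iterate (suc s) = extend (iterate s)
    where
    extend : (∃ λ k → ∃ λ C → ∃ λ β → Smooth k s C β × Fp h ⊑ β) → ∃ λ k → ∃ λ C → ∃ λ β → Smooth k (suc s) C β × Fp h ⊑ β
    extend (k , C , β , sm , le) = suc k , ι 1 * C * ι (suc k) , Vcut (suc k) 1 ⊛ β , Smooth-cut 1 sm , ⊑-trans le (⊛-expand {Vcut (suc k) 1} {β} (one⊑Vcut (suc k)) (nonneg sm))
  go : (∃ λ k → ∃ λ C → ∃ λ β → Smooth k 12 C β × Fp h ⊑ β) → Negligible (Fp h)
  go (k , C , β , sm , le) = cube 312ℚ * C , 0≤* (0≤cube (0≤nat 312)) (0≤C sm) , λ n → ≤-trans (*-monoˡ (0≤cube (0≤ι n)) (le n)) (Smooth-tail sm n)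

-- Equidistribution of the M₂-rank modulo c

runU-⊛ : ∀ j d a β → runU j d (a ⊛ β) ≗ a ⊛ runU j d β
runU-⊛ j zero    a β n = refl
runU-⊛ j (suc d) a β n = trans (⊛-congˡ (U (suc (d ℕ.+ j))) (runU-⊛ j d a β) n) (⊛-swap (U (suc (d ℕ.+ j))) a (runU j d β) n)

runU-cong : ∀ j d {β β′} → β ≗ β′ → runU j d β ≗ runU j d β′
runU-cong j zero    h = h
runU-cong j (suc d) h = ⊛-congˡ (U (suc (d ℕ.+ j))) (runU-cong j d h)

Osc-run : ∀ j d {Φ β} → Osc Φ β → Osc (run j d Φ) (runU j d β)
Osc-run j zero    o = o
Osc-run j (suc d) {Φ} {β} o = Osc-step (d ℕ.+ j) {run j d Φ} {runU j d β} (Osc-run j d {Φ} {β} o)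

even-ε : ∀ m → ε (m ℕ.+ m) ≡ 1
even-ε m = cong (λ t → suc (if t ℕ.≡ᵇ 1 then 1 else 0)) (trans (cong (ℕ._% 2) (trans (cong (m ℕ.+_) (sym (ℕₚ.+-identityʳ m))) (ℕₚ.*-comm 2 m))) (m*n%n≡0 m 2))

module Equi (c′ : ℕ) where

  c : ℕ
  c = suc c′

  χ : ℕ → ℚ
  χ s = ind (c ∣? s)

  χ-periodic : ∀ s → χ (c ℕ.+ s) ≡ χ s
  χ-periodic s = ind-⇔ (c ∣? (c ℕ.+ s)) (c ∣? s) (λ d → ∣m+n∣m⇒∣n d ∣-refl) (∣m∣n⇒∣m+n ∣-refl)

  χ≤1 : ∀ s → χ s ≤ 1ℚ
  χ≤1 s = go (c ∣? s)
    where
    go : ∀ {A : Set} (d : Dec A) → ind d ≤ 1ℚ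
    go (yes _) = ≤-refl
    go (no _)  = 0≤1

  χ-total : ∀ s → sum c (λ j → χ (s ℕ.+ j)) ≡ 1ℚ
  χ-total s = trans (window c χ χ-periodic s) (trans (cong₂ _+_ (ind-yes (c ∣? 0) (c ∣0))
    (sum-zero c′ (λ j j<c′ → ind-no (c ∣? suc j) (λ d → ℕₚ.<-irrefl refl (ℕₚ.<-≤-trans (s≤s j<c′) (∣⇒≤ d)))))) (+-identityʳ 1ℚ))

  open Counts χ

  Ψ-periodic : ∀ k → Periodic c (Ψ k)
  Ψ-periodic k s n = total-cong (λ μ → trans (cong χ (ℕₚ.+-assoc c s (stat μ))) (χ-periodic (s ℕ.+ stat μ))) (gen k n)

  Ψ-run : ∀ j d → Ψ (d ℕ.+ j) ≋ run j d (Ψ j)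
  Ψ-run j zero    s n = refl
  Ψ-run j (suc d) s n = trans (Ψ-suc (d ℕ.+ j) s n) (step-cong (suc (d ℕ.+ j)) (Ψ-run j d) s n)

  pair-bound : ℕ → Series → Series
  pair-bound p′ β = U (suc p′ ℕ.+ suc p′) ⊛ runU (suc p′) p′ (Vcut (suc p′) (c ℕ.+ c) ⊛ β)

  Osc-pair : ∀ p′ {β} → ε (suc p′) ≡ 1 → 0̂ ⊑ β → Osc (Ψ p′) β → Osc (Ψ (suc p′ ℕ.+ suc p′)) (pair-bound p′ β)
  Osc-pair p′ {β} εp 0≤β o = Osc-cong {O q (run p p′ (O p (Geo q 1 (Geo p 1 (Ψ p′)))))} {Ψ q} (λ s n → sym (families s n)) bounds
      (Osc-O q {run p p′ (O p (Geo q 1 (Geo p 1 (Ψ p′))))} {runU p p′ γ₁} (Osc-run p p′ {O p (Geo q 1 (Geo p 1 (Ψ p′)))} {γ₁}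
        (Osc-O p {Geo q 1 (Geo p 1 (Ψ p′))} {γ₀} (Pair.pair-osc c′ p′ (Ψ p′) β (Ψ-periodic p′) o 0≤β))))
    where
    p q M : ℕ
    p = suc p′
    q = p ℕ.+ p
    M = c ℕ.+ c
    γ₀ γ₁ W : Series
    γ₀ = geo q (trunc p M β)
    γ₁ = γ₀ ⊞ sh p γ₀
    W = Vcut p M ⊛ β
    εq : ε q ≡ 1
    εq = even-ε p
    families : Ψ q ≋ O q (run p p′ (O p (Geo q 1 (Geo p 1 (Ψ p′)))))
    families s n = trans (Ψ-suc (p′ ℕ.+ p) s n) (trans (O-cong q {Geo q (ε q) (Ψ (p′ ℕ.+ p))} {Geo q 1 (run p p′ (O p (Geo p 1 (Ψ p′))))}
        (λ s n → trans (cong (λ i → Geo q i (Ψ (p′ ℕ.+ p)) s n) εq) (Geo-cong q 1 inner s n)) s n)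
      (O-cong q (λ s n → trans (Geo-run (p′ ℕ.+ p) 1 p p′ (O p (Geo p 1 (Ψ p′))) s n) (run-cong p p′ (Geo-O (p′ ℕ.+ p) 1 p (Geo p 1 (Ψ p′))) s n)) s n))
      where
      inner : Ψ (p′ ℕ.+ p) ≋ run p p′ (O p (Geo p 1 (Ψ p′)))
      inner s n = trans (Ψ-run p p′ s n) (run-cong p p′ (λ s n → trans (Ψ-suc p′ s n) (cong (λ i → O p (Geo p i (Ψ p′)) s n) εp)) s n)
    γ₁≗ : γ₁ ≗ g q ⊛ W
    γ₁≗ n = trans (cong₂ _+_ (γ₀≗ n) (trans (sh-cong p γ₀≗ n) (sym (⊛-sh p (g q) (Ecut p M ⊛ β) n))))
      (trans (sym (⊛-distribˡ (g q) (Ecut p M ⊛ β) (sh p (Ecut p M ⊛ β)) n))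
        (⊛-congˡ (g q) (λ i → sym (trans (⊛-distribʳ (Ecut p M) (sh p (Ecut p M)) β i) (cong ((Ecut p M ⊛ β) i +_) (sh-⊛ p (Ecut p M) β i)))) n))
      where
      γ₀≗ : γ₀ ≗ g q ⊛ (Ecut p M ⊛ β)
      γ₀≗ n = trans (geo-⊛ (p′ ℕ.+ p) (trunc p M β) n) (⊛-congˡ (g q) (trunc-⊛ p M β) n)
    γ₂≗ : runU p p′ γ₁ ≗ g q ⊛ runU p p′ W
    γ₂≗ n = trans (runU-cong p p′ γ₁≗ n) (runU-⊛ p p′ (g q) W n)
    bounds : runU p p′ γ₁ ⊞ sh q (runU p p′ γ₁) ≗ pair-bound p′ β
    bounds n = trans (cong₂ _+_ (γ₂≗ n) (trans (sh-cong q γ₂≗ n) (sym (sh-⊛ q (g q) (runU p p′ W) n)))) (sym (⊛-distribʳ (g q) (sh q (g q)) (runU p p′ W) n))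

  State : ℕ → Set
  State s = ∃ λ k → ∃ λ C → ∃ λ β → Smooth k s C β × Osc (Ψ k) β

  state-zero : State 0
  state-zero = 0 , 1ℚ , one , smooth 0⊑one (⊑-reflexive (θFp 0)) 0≤1 (⊑-reflexive (λ n → sym (*-identityˡ (one n)))) , osc
    where
    osc : Osc (Ψ 0) one
    osc s s′ zero    = ≤-trans (≤-reflexive (+-identityʳ (χ (s ℕ.+ 0)))) (≤-trans (χ≤1 (s ℕ.+ 0)) (p≤q+p (0≤+ (0≤ind (c ∣? (s′ ℕ.+ 0))) ≤-refl)))
    osc s s′ (suc n) = ≤-refl

  state-suc : ∀ {s} → State s → State (suc s)
  state-suc {s} (k , C , β , sm , o) = suc p′ ℕ.+ suc p′ , ι (c ℕ.+ c) * C * ι (suc p′) , pair-bound p′ (runU k (suc k) β) ,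
      Smooth-plain (Smooth-run p′ (Smooth-cut (c ℕ.+ c) (Smooth-run (suc k) sm))) ,
      Osc-pair p′ (trans (cong ε (sym (ℕₚ.+-suc (suc k) k))) (even-ε (suc k))) (nonneg (Smooth-run (suc k) sm))
        (Osc-cong {run k (suc k) (Ψ k)} {Ψ p′} (λ i n → sym (Ψ-run k (suc k) i n)) (λ _ → refl) (Osc-run k (suc k) {Ψ k} {β} o))
    where
    p′ : ℕ
    p′ = suc k ℕ.+ k

  state : ∀ s → State s
  state zero    = state-zero
  state (suc s) = state-suc (state s)

  -- idx λ ≡ − m2rank λ modulo c, as a natural number.

  half : OverPartition → ℕ
  half μ = suc (largest μ) ℕ./ 2

  idx : OverPartition → ℕ
  idx μ = c′ ℕ.* half μ ℕ.+ chi μ ℕ.+ stat μ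

  Full : ℕ → ℕ → Series
  Full k a = Tot (λ μ → χ (a ℕ.+ idx μ)) k

  offset : ℕ → Bool → ℕ → ℕ
  offset K true  m = c′ ℕ.* (suc K ℕ./ 2) ℕ.+ 0 ℕ.+ stat (block K true m)
  offset K false m = c′ ℕ.* (suc K ℕ./ 2) ℕ.+ oddBit K ℕ.+ stat (block K false (suc m))

  private
    arith : ∀ a h x {s t u} → s ≡ t ℕ.+ u → a ℕ.+ (h ℕ.+ x ℕ.+ s) ≡ a ℕ.+ (h ℕ.+ x ℕ.+ t) ℕ.+ u
    arith a h x {s} {t} {u} refl = eq a (h ℕ.+ x) t u
      where
      eq : ∀ a h t u → a ℕ.+ (h ℕ.+ (t ℕ.+ u)) ≡ a ℕ.+ (h ℕ.+ t) ℕ.+ u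
      eq = ℕ-Solver.solve-∀

  Full-true : ∀ k a m → Tot ((λ μ → χ (a ℕ.+ idx μ)) ∘ (block (suc k) true m ++_)) k ≗ Ψ k (a ℕ.+ offset (suc k) true m)
  Full-true k a m n = total-cong (λ μ → cong χ (arith a (c′ ℕ.* (suc (suc k) ℕ./ 2)) 0 (stat-++ (block (suc k) true m) μ))) (gen k n)

  Full-false : ∀ k a m → Tot ((λ μ → χ (a ℕ.+ idx μ)) ∘ (block (suc k) false (suc m) ++_)) k ≗ Ψ k (a ℕ.+ offset (suc k) false m)
  Full-false k a m n = total-cong (λ μ → cong χ (arith a (c′ ℕ.* (suc (suc k) ℕ./ 2)) (oddBit (suc k)) (stat-++ (block (suc k) false (suc m)) μ))) (gen k n)

  Full-suc : ∀ k a n → Full (suc k) a n ≡ Full k a n + sum n (λ m → sh (suc m ℕ.* suc k) (Ψ k (a ℕ.+ offset (suc k) false m)) n)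
                       + sum (suc n) (λ m → sh (suc m ℕ.* suc k) (Ψ k (a ℕ.+ offset (suc k) true m)) n)
  Full-suc k a n = trans (Tot-suc (λ μ → χ (a ℕ.+ idx μ)) k n) (cong₂ _+_
    (cong (Full k a n +_) (sum-congˡ n (λ m → sh-cong (suc m ℕ.* suc k) (Full-false k a m) n)))
    (sum-congˡ (suc n) (λ m → sh-cong (suc m ℕ.* suc k) (Full-true k a m) n)))

  U-⊛-sum : ∀ k β n → (U (suc k) ⊛ β) n ≡ β n + sum n (λ m → sh (suc m ℕ.* suc k) β n) + sum (suc n) (λ m → sh (suc m ℕ.* suc k) β n)
  U-⊛-sum k β n = trans (sym (U-⊛ k β n)) (cong (geo K β n +_) (sym (trans (sum-congˡ (suc n) (λ m → sym (sh-sh K (m ℕ.* K) β n)))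
      (trans (sym (sh-sum K (suc n) (geoTerm K 0 (λ _ → β) 0) n)) (sh-cong≤ K n (λ i i≤n → Geo-range k 0 (λ _ → β) 0 i (suc n) (s≤s i≤n)))))))
    where
    K : ℕ
    K = suc k

  module _ (h : ℕ) (β : Series) (o : Osc (Ψ h) β) where

    Full-osc : ∀ d a a′ n → Full (d ℕ.+ h) a n + β n ≤ Full (d ℕ.+ h) a′ n + (Fp h n + runU h d β n)
    Full-osc zero    a a′ n = ≤-trans (+-monoˡ-≤ (β n) (≤-trans (total≤ (gen h n)) (≤-reflexive (Tot-one h n))))
        (p≤q+p (0≤total (λ μ → 0≤ind (c ∣? (a′ ℕ.+ idx μ))) (gen h n)))
      where
      total≤ : ∀ xs → total (λ μ → χ (a ℕ.+ idx μ)) xs ≤ total (λ _ → 1ℚ) xs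
      total≤ []       = ≤-refl
      total≤ (μ ∷ xs) = +-mono-≤ (χ≤1 (a ℕ.+ idx μ)) (total≤ xs)
    Full-osc (suc d) a a′ n = subst₂ _≤_ (trans (eq₁ (Full k a n) S₁ S₂ (β n)) (cong (_+ β n) (sym (Full-suc k a n))))
        (trans (eq₂ (Full k a′ n) (Fp h n) (βd n) S₁′ B₁ S₂′ B₂) (cong₂ (λ p q → p + (Fp h n + q)) (sym (Full-suc k a′ n)) (sym (U-⊛-sum k βd n))))
        (+-mono-≤ (+-mono-≤ (Full-osc d a a′ n) le₁) le₂)
      where
      k : ℕ
      k = d ℕ.+ h
      βd : Series
      βd = runU h d β
      od′ : Osc (Ψ k) βd
      od′ = Osc-cong {run h d (Ψ h)} {Ψ k} (λ i n → sym (Ψ-run h d i n)) (λ _ → refl) (Osc-run h d {Ψ h} {β} o)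
      S₁ S₂ S₁′ S₂′ B₁ B₂ : ℚ
      S₁  = sum n (λ m → sh (suc m ℕ.* suc k) (Ψ k (a ℕ.+ offset (suc k) false m)) n)
      S₁′ = sum n (λ m → sh (suc m ℕ.* suc k) (Ψ k (a′ ℕ.+ offset (suc k) false m)) n)
      S₂  = sum (suc n) (λ m → sh (suc m ℕ.* suc k) (Ψ k (a ℕ.+ offset (suc k) true m)) n)
      S₂′ = sum (suc n) (λ m → sh (suc m ℕ.* suc k) (Ψ k (a′ ℕ.+ offset (suc k) true m)) n)
      B₁  = sum n (λ m → sh (suc m ℕ.* suc k) βd n)
      B₂  = sum (suc n) (λ m → sh (suc m ℕ.* suc k) βd n)
      le₁ : S₁ ≤ S₁′ + B₁
      le₁ = ≤-trans (sum-mono n (λ m _ → sh-osc (suc m ℕ.* suc k) {Ψ k} {βd} od′ (a ℕ.+ offset (suc k) false m) (a′ ℕ.+ offset (suc k) false m) n))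
        (≤-reflexive (sum-+ n (λ m → sh (suc m ℕ.* suc k) (Ψ k (a′ ℕ.+ offset (suc k) false m)) n) (λ m → sh (suc m ℕ.* suc k) βd n)))
      le₂ : S₂ ≤ S₂′ + B₂
      le₂ = ≤-trans (sum-mono (suc n) (λ m _ → sh-osc (suc m ℕ.* suc k) {Ψ k} {βd} od′ (a ℕ.+ offset (suc k) true m) (a′ ℕ.+ offset (suc k) true m) n))
        (≤-reflexive (sum-+ (suc n) (λ m → sh (suc m ℕ.* suc k) (Ψ k (a′ ℕ.+ offset (suc k) true m)) n) (λ m → sh (suc m ℕ.* suc k) βd n)))
      eq₁ : ∀ F s t b → F + b + s + t ≡ F + s + t + b
      eq₁ = solve-∀ ringℚ
      eq₂ : ∀ F p b s x t y → F + (p + b) + (s + x) + (t + y) ≡ F + s + t + (p + (b + x + y))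
      eq₂ = solve-∀ ringℚ

  Full-total : ∀ n → sum c (λ a → Full n a n) ≡ f n
  Full-total n = trans (sym (total-sum c (λ a μ → χ (a ℕ.+ idx μ)) (gen n n))) (trans
    (total-cong (λ μ → trans (sum-congˡ c (λ a → cong χ (ℕₚ.+-comm a (idx μ)))) (χ-total (idx μ))) (gen n n)) (trans (Tot-one n n) (Fp≡f n)))

  difference : ∃ λ C → ∃ λ h → 0ℚ ≤ C × (∀ n → h ℕ.≤ n → ∀ a a′ → cube (ι n) * (Full n a n - Full n a′ n) ≤ C * f n)
  difference = go (state 12)
    where
    alg : ∀ {N F F′ p q b C D G} → 0ℚ ≤ N → 0ℚ ≤ b → F + b ≤ F′ + (p + q) → N * p ≤ C * G → N * q ≤ D * G → N * (F - F′) ≤ (C + D) * G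
    alg {N} {F} {F′} {p} {q} {b} {C} {D} {G} 0≤N 0≤b h₁ h₂ h₃ = ≤-by (eq N F F′ p q b C D G)
        (0≤+ (0≤+ (0≤* 0≤N (p≤q⇒0≤q-p h₁)) (0≤* 0≤N 0≤b)) (0≤+ (p≤q⇒0≤q-p h₂) (p≤q⇒0≤q-p h₃)))
      where
      eq : ∀ N F F′ p q b C D G → (C + D) * G - N * (F - F′) ≡ N * (F′ + (p + q) - (F + b)) + N * b + (C * G - N * p + (D * G - N * q))
      eq = solve-∀ ringℚ
    go : State 12 → ∃ λ C → ∃ λ h → 0ℚ ≤ C × (∀ n → h ℕ.≤ n → ∀ a a′ → cube (ι n) * (Full n a n - Full n a′ n) ≤ C * f n)
    go (h , C , β , sm , o) = go′ (Fp-tail h)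
      where
      D′ : ℚ
      D′ = cube 312ℚ * C
      go′ : Negligible (Fp h) → ∃ λ C → ∃ λ h → 0ℚ ≤ C × (∀ n → h ℕ.≤ n → ∀ a a′ → cube (ι n) * (Full n a n - Full n a′ n) ≤ C * f n)
      go′ (C₁ , 0≤C₁ , h₁) = C₁ + D′ , h , 0≤+ 0≤C₁ (0≤* (0≤cube (0≤nat 312)) (0≤C sm)) , λ n h≤n a a′ →
        subst (λ k → cube (ι n) * (Full k a n - Full k a′ n) ≤ (C₁ + D′) * f n) (ℕₚ.m∸n+n≡m h≤n)
          (alg {cube (ι n)} {Full (n ∸ h ℕ.+ h) a n} {Full (n ∸ h ℕ.+ h) a′ n} {Fp h n} {runU h (n ∸ h) β n} {β n} {C₁} {D′} {f n} (0≤cube (0≤ι n)) (nonneg sm n)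
            (Full-osc h β o (n ∸ h) a a′ n) (h₁ n) (Smooth-tail (Smooth-run (n ∸ h) sm) n))

module Final (c′ : ℕ) where

  open Equi c′

  private
    nb : ℕ → ℕ → ℕ
    nb a n = N2bar (ℤ.+ a) c n

    rank-idx : ∀ a μ → m2rank μ ℤ.- ℤ.+ a ≡ ℤ.+ c ℤ.* ℤ.+ half μ ℤ.- ℤ.+ (a ℕ.+ idx μ)
    rank-idx a μ = trans (eq (ℤ.+ half μ) (ℤ.+ numParts μ) (ℤ.+ numOddNonOver μ) (ℤ.+ chi μ) (ℤ.+ a) (ℤ.+ c′))
      (cong (λ i → ℤ.+ c ℤ.* ℤ.+ half μ ℤ.- (ℤ.+ a ℤ.+ (i ℤ.+ ℤ.+ chi μ ℤ.+ (ℤ.+ numParts μ ℤ.+ ℤ.+ numOddNonOver μ)))) (sym (ℤₚ.pos-* c′ (half μ))))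
      where
      eq : ∀ h p o x a d → h ℤ.- (p ℤ.+ o ℤ.+ x) ℤ.- a ≡ (ℤ.+ 1 ℤ.+ d) ℤ.* h ℤ.- (a ℤ.+ (d ℤ.* h ℤ.+ x ℤ.+ (p ℤ.+ o)))
      eq = ℤ-Solver.solve-∀

    negate : ∀ i h s → i ≡ h ℤ.- s → s ≡ h ℤ.- i
    negate i h s refl = eq h s
      where
      eq : ∀ h s → s ≡ h ℤ.- (h ℤ.- s)
      eq = ℤ-Solver.solve-∀

    divides⇔ : ∀ a μ → (c ∣ ℤ.∣ m2rank μ ℤ.- ℤ.+ a ∣ → c ∣ a ℕ.+ idx μ) × (c ∣ a ℕ.+ idx μ → c ∣ ℤ.∣ m2rank μ ℤ.- ℤ.+ a ∣)
    divides⇔ a μ = (λ d → ℤ∣.∣⇒∣ᵤ (diff (negate i h s (rank-idx a μ)) (ℤ∣.∣ᵤ⇒∣ d))) , (λ d → ℤ∣.∣⇒∣ᵤ (diff (rank-idx a μ) (ℤ∣.∣ᵤ⇒∣ {ℤ.+ c} {s} d)))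
      where
      i h s : ℤ
      i = m2rank μ ℤ.- ℤ.+ a
      h = ℤ.+ c ℤ.* ℤ.+ half μ
      s = ℤ.+ (a ℕ.+ idx μ)
      diff : ∀ {u v} → u ≡ h ℤ.- v → ℤ.+ c ℤ∣.∣ v → ℤ.+ c ℤ∣.∣ u
      diff {u} {v} refl d = ℤ∣.∣m∣n⇒∣m-n {ℤ.+ c} {h} {v} (ℤ∣.∣m⇒∣m*n (ℤ.+ half μ) (ℤ∣.∣-refl {ℤ.+ c})) d

    nb-Full : ∀ a n → ι (nb a n) ≡ Full n a n
    nb-Full a n = trans (length-filter (λ μ → c ∣? ℤ.∣ m2rank μ ℤ.- ℤ.+ a ∣) (gen n n))
      (total-cong (λ μ → ind-⇔ (c ∣? ℤ.∣ m2rank μ ℤ.- ℤ.+ a ∣) (c ∣? (a ℕ.+ idx μ)) (proj₁ (divides⇔ a μ)) (proj₂ (divides⇔ a μ))) (gen n n))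

    sum-const : ∀ n q → sum n (λ _ → q) ≡ ι n * q
    sum-const zero    q = sym (*-zeroˡ q)
    sum-const (suc n) q = trans (cong (q +_) (sum-const n q)) (eq (ι n) q)
      where
      eq : ∀ n q → q + n * q ≡ (1ℚ + n) * q
      eq = solve-∀ ringℚ

    sum-diff : ∀ n N q (h : ℕ → ℚ) → sum n (λ i → N * (q - h i)) ≡ N * (ι n * q - sum n h)
    sum-diff n N q h = trans (sum-* n N (λ i → q - h i)) (cong (N *_) (trans (sum-+ n (λ _ → q) (λ i → - h i)) (cong₂ _+_ (sum-const n q)
      (trans (sum-congˡ n (λ i → eq (h i))) (trans (sum-* n (- 1ℚ) h) (sym (eq (sum n h))))))))
      where
      eq : ∀ a → - a ≡ - 1ℚ * a
      eq = solve-∀ ringℚ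

    sum-diff′ : ∀ n N q (h : ℕ → ℚ) → sum n (λ i → N * (h i - q)) ≡ N * (sum n h - ι n * q)
    sum-diff′ n N q h = trans (sum-congˡ n (λ i → eq N (h i) q)) (trans (sum-diff n (- N) q h) (sym (eq N (sum n h) (ι n * q))))
      where
      eq : ∀ N h q → N * (h - q) ≡ - N * (q - h)
      eq = solve-∀ ringℚ

  Close : ℕ → ℚ → ℕ → Set
  Close a κ n = cube (ι n) * (ι c * ι (nb a n) - f n) ≤ κ * f n × cube (ι n) * (f n - ι c * ι (nb a n)) ≤ κ * f n

  close : ∀ a → ∃ λ κ → ∃ λ h → 0ℚ ≤ κ × (∀ n → h ℕ.≤ n → Close a κ n)
  close a = go difference
    where
    go : (∃ λ C → ∃ λ h → 0ℚ ≤ C × (∀ n → h ℕ.≤ n → ∀ a a′ → cube (ι n) * (Full n a n - Full n a′ n) ≤ C * f n)) →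
         ∃ λ κ → ∃ λ h → 0ℚ ≤ κ × (∀ n → h ℕ.≤ n → Close a κ n)
    go (C , h , 0≤C , bound) = ι c * C , h , 0≤* (0≤ι c) 0≤C , λ n h≤n →
        subst₂ (λ s t → cube (ι n) * (ι c * s - t) ≤ ι c * C * f n) (sym (nb-Full a n)) (Full-total n)
          (subst₂ _≤_ (sum-diff c (cube (ι n)) (Full n a n) (λ a′ → Full n a′ n)) (total≡ n) (sum-mono c (λ a′ _ → bound n h≤n a a′))) ,
        subst₂ (λ s t → cube (ι n) * (t - ι c * s) ≤ ι c * C * f n) (sym (nb-Full a n)) (Full-total n)
          (subst₂ _≤_ (sum-diff′ c (cube (ι n)) (Full n a n) (λ a′ → Full n a′ n)) (total≡ n) (sum-mono c (λ a′ _ → bound n h≤n a′ a)))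
      where
      total≡ : ∀ n → sum c (λ _ → C * f n) ≡ ι c * C * f n
      total≡ n = trans (sum-const c (C * f n)) (sym (*-assoc (ι c) C (f n)))

  private
    weaken : ∀ {M N d q} → 0ℚ ≤ N → N ≤ M → 0ℚ ≤ q → M * d ≤ q → N * d ≤ q
    weaken {M} {N} {d} {q} 0≤N N≤M 0≤q h with ≤-total 0ℚ d
    ... | inj₁ 0≤d = ≤-trans (*-monoʳ 0≤d N≤M) h
    ... | inj₂ d≤0 = ≤-trans (*-monoˡ 0≤N d≤0) (≤-trans (≤-reflexive (*-zeroʳ N)) 0≤q)

    -- With N = k³ and relative errors κ / N, the gap i² / 20 survives.
    perturb : ∀ {N κ u₀ u₁ u₂ F₀ F₁ F₂ i p m : ℚ} → N ≡ cube m → 1ℚ ≤ m → 0ℚ ≤ κ → κ ≤ N →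
      0ℚ < F₀ → 0ℚ ≤ F₂ → 0ℚ ≤ u₀ → 0ℚ ≤ u₁ → 0ℚ ≤ u₂ → N * (u₀ - F₀) ≤ κ * F₀ → N * (u₂ - F₂) ≤ κ * F₂ → N * (F₁ - u₁) ≤ κ * F₁ →
      F₁ ≤ nat 4 * F₀ → F₀ ≤ F₁ → F₀ * F₀ * (i * i) ≤ nat 20 * (F₁ * F₁ - F₀ * F₂) → p * i ≡ 1ℚ → p ≤ 3ℚ * m → 0ℚ ≤ i → nat 11520 * κ < m →
      u₀ * u₂ < u₁ * u₁
    perturb {N} {κ} {u₀} {u₁} {u₂} {F₀} {F₁} {F₂} {i} {p} {m} N≡ 1≤m 0≤κ κ≤N 0<F₀ 0≤F₂ 0≤u₀ 0≤u₁ 0≤u₂ h₀ h₂ h₁ F₁≤ F₀≤ hg pi p≤ 0≤i hm =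
      0<q-p⇒p<q (*-cancelˡ-<-nonNeg (N * N) {{nonNegative (0≤* 0≤N 0≤N)}} (subst (_< N * N * (u₁ * u₁ - u₀ * u₂)) (sym (*-zeroʳ (N * N))) (<-≤-trans final main)))
      where
      0≤m : 0ℚ ≤ m
      0≤m = ≤-trans 0≤1 1≤m
      0<m : 0ℚ < m
      0<m = <-≤-trans (positive⁻¹ 1ℚ) 1≤m
      0<N : 0ℚ < N
      0<N = subst (0ℚ <_) (sym N≡) (0<* (0<* 0<m 0<m) 0<m)
      0≤N : 0ℚ ≤ N
      0≤N = <⇒≤ 0<N
      0≤F₀ : 0ℚ ≤ F₀
      0≤F₀ = <⇒≤ 0<F₀
      0≤F₁ : 0ℚ ≤ F₁
      0≤F₁ = ≤-trans 0≤F₀ F₀≤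
      P : ℚ
      P = F₁ * F₁ - F₀ * F₂
      0≤P : 0ℚ ≤ P
      0≤P = *-cancelˡ {nat 20} (positive⁻¹ (nat 20)) (≤-trans (≤-reflexive (*-zeroʳ (nat 20))) (≤-trans (0≤* (0≤□ F₀) (0≤□ i)) hg))
      a₀₂ : ∀ {u F} → N * (u - F) ≤ κ * F → N * u ≤ (N + κ) * F
      a₀₂ {u} {F} h = ≤-by (eq N κ u F) (p≤q⇒0≤q-p h)
        where
        eq : ∀ N κ u F → (N + κ) * F - N * u ≡ κ * F - N * (u - F)
        eq = solve-∀ ringℚ
      a₁ : (N - κ) * F₁ ≤ N * u₁
      a₁ = ≤-by (eq N κ u₁ F₁) (p≤q⇒0≤q-p h₁)
        where
        eq : ∀ N κ u F → N * u - (N - κ) * F ≡ κ * F - N * (F - u)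
        eq = solve-∀ ringℚ
      b₁ : (N - κ) * F₁ * ((N - κ) * F₁) ≤ N * u₁ * (N * u₁)
      b₁ = *-mono (0≤* (p≤q⇒0≤q-p κ≤N) 0≤F₁) (0≤* 0≤N 0≤u₁) a₁ a₁
      b₂ : N * u₀ * (N * u₂) ≤ (N + κ) * F₀ * ((N + κ) * F₂)
      b₂ = *-mono (0≤* 0≤N 0≤u₀) (0≤* (0≤+ 0≤N 0≤κ) 0≤F₂) (a₀₂ h₀) (a₀₂ h₂)
      b₃ : F₁ * F₁ ≤ nat 4 * F₀ * (nat 4 * F₀)
      b₃ = *-mono 0≤F₁ (0≤* (0≤nat 4) 0≤F₀) F₁≤ F₁≤
      lower : ℚ
      lower = N * (N * P - nat 64 * κ * (F₀ * F₀))
      main : lower ≤ N * N * (u₁ * u₁ - u₀ * u₂)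
      main = ≤-by (eq N κ u₀ u₁ u₂ F₀ F₁ F₂) (0≤+ (0≤+ (p≤q⇒0≤q-p b₁) (p≤q⇒0≤q-p b₂))
          (0≤+ (0≤* (0≤+ (0≤□ κ) (0≤* (0≤* (0≤nat 2) 0≤N) 0≤κ)) 0≤P) (0≤* (0≤* (0≤* (0≤nat 4) 0≤N) 0≤κ) (p≤q⇒0≤q-p b₃))))
        where
        eq : ∀ N κ u₀ u₁ u₂ F₀ F₁ F₂ → N * N * (u₁ * u₁ - u₀ * u₂) - N * (N * (F₁ * F₁ - F₀ * F₂) - nat 64 * κ * (F₀ * F₀)) ≡
             (N * u₁ * (N * u₁) - (N - κ) * F₁ * ((N - κ) * F₁)) + ((N + κ) * F₀ * ((N + κ) * F₂) - N * u₀ * (N * u₂))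
             + ((κ * κ + 2ℚ * N * κ) * (F₁ * F₁ - F₀ * F₂) + nat 4 * N * κ * (nat 4 * F₀ * (nat 4 * F₀) - F₁ * F₁))
        eq = solve-∀ ringℚ
      Ni² : m ≤ nat 9 * (N * (i * i))
      Ni² = subst (λ s → m ≤ nat 9 * (s * (i * i))) (sym N≡) (n≤9n³i² 0≤m 0≤i pi p≤)
      gap′ : 0ℚ < nat 180 * (N * P - nat 64 * κ * (F₀ * F₀))
      gap′ = subst (0ℚ <_) (sym (eq N κ P F₀ i m)) (0<+ (0<* (p<q⇒0<q-p hm) (0<* 0<F₀ 0<F₀)) (0≤+ (0≤* (0≤* (0≤nat 9) 0≤N) (p≤q⇒0≤q-p hg)) (0≤* (p≤q⇒0≤q-p Ni²) (0≤□ F₀))))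
        where
        eq : ∀ N κ P F i m → nat 180 * (N * P - nat 64 * κ * (F * F)) ≡
             (m - nat 11520 * κ) * (F * F) + (nat 9 * N * (nat 20 * P - F * F * (i * i)) + (nat 9 * (N * (i * i)) - m) * (F * F))
        eq = solve-∀ ringℚ
      final : 0ℚ < lower
      final = 0<* 0<N (*-cancelˡ-<-nonNeg (nat 180) {{nonNegative (0≤nat 180)}} (subst (_< nat 180 * (N * P - nat 64 * κ * (F₀ * F₀))) (sym (*-zeroʳ (nat 180))) gap′))

  consecutive : ∀ a → Eventually λ k → nb a k ℕ.* nb a (2 ℕ.+ k) ℕ.< nb a (suc k) ℕ.* nb a (suc k)
  consecutive a = go (close a) gap f-quadruple
    where
    go : (∃ λ κ → ∃ λ h → 0ℚ ≤ κ × (∀ n → h ℕ.≤ n → Close a κ n)) →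
         Eventually (λ k → f k * f k * (ip k * ip k) ≤ nat 20 * Pgap k) →
         Eventually (λ k → f (suc k) ≤ nat 4 * f k) →
         Eventually λ k → nb a k ℕ.* nb a (2 ℕ.+ k) ℕ.< nb a (suc k) ℕ.* nb a (suc k)
    go (κ , h , 0≤κ , hc) (K₁ , hg) (K₂ , h4) = go′ (archimedean (nat 11520 * κ))
      where
      go′ : (∃ λ n → nat 11520 * κ ≤ ι n) → Eventually λ k → nb a k ℕ.* nb a (2 ℕ.+ k) ℕ.< nb a (suc k) ℕ.* nb a (suc k)
      go′ (n , hn) = suc (n ℕ.+ (h ℕ.+ (K₁ ℕ.+ K₂))) , eventually
        where
        eventually : ∀ k → suc (n ℕ.+ (h ℕ.+ (K₁ ℕ.+ K₂))) ℕ.≤ k → nb a k ℕ.* nb a (2 ℕ.+ k) ℕ.< nb a (suc k) ℕ.* nb a (suc k)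
        eventually (suc j) (s≤s le) = ι-cancel-< (subst₂ _<_ (sym (ι-* (nb a k) (nb a (2 ℕ.+ k)))) (sym (ι-* (nb a (suc k)) (nb a (suc k))))
            (unscale {ι c} {ι (nb a k)} {ι (nb a (2 ℕ.+ k))} {ι (nb a (suc k))} (perturb {cube (ι k)} {κ} {ι c * ι (nb a k)} {ι c * ι (nb a (suc k))} {ι c * ι (nb a (2 ℕ.+ k))} {f k} {f (suc k)} {f (2 ℕ.+ k)} {ip k} {pp k} {ι k}
              refl (1≤ι j) 0≤κ κ≤N (0<f k) (0⊑f (2 ℕ.+ k)) (pos k) (pos (suc k)) (pos (2 ℕ.+ k))
              (proj₁ (hc k h≤k)) (weaken N≥0 (cube-mono (0≤ι k) (ι-mono (ℕₚ.m≤n+m k 2))) (0≤* 0≤κ (0⊑f (2 ℕ.+ k))) (proj₁ (hc (2 ℕ.+ k) (ℕₚ.m≤n⇒m≤1+n (ℕₚ.m≤n⇒m≤1+n h≤k)))))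
              (weaken N≥0 (cube-mono (0≤ι k) (ι-mono (ℕₚ.n≤1+n k))) (0≤* 0≤κ (0⊑f (suc k))) (proj₂ (hc (suc k) (ℕₚ.m≤n⇒m≤1+n h≤k))))
              (h4 k (big (ℕₚ.≤-trans (ℕₚ.m≤n+m K₂ K₁) (ℕₚ.≤-trans (ℕₚ.m≤n+m (K₁ ℕ.+ K₂) h) (ℕₚ.m≤n+m (h ℕ.+ (K₁ ℕ.+ K₂)) n)))))
              (f-mono-suc k)
              (hg k (big (ℕₚ.≤-trans (ℕₚ.m≤m+n K₁ K₂) (ℕₚ.≤-trans (ℕₚ.m≤n+m (K₁ ℕ.+ K₂) h) (ℕₚ.m≤n+m (h ℕ.+ (K₁ ℕ.+ K₂)) n)))))
              (p*ip k) (ppι≤ j) (0≤ip k) (≤-<-trans hn n<k))))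
          where
          k : ℕ
          k = suc j
          big : ∀ {m} → m ℕ.≤ n ℕ.+ (h ℕ.+ (K₁ ℕ.+ K₂)) → m ℕ.≤ k
          big m≤ = ℕₚ.m≤n⇒m≤1+n (ℕₚ.≤-trans m≤ le)
          h≤k : h ℕ.≤ k
          h≤k = big (ℕₚ.≤-trans (ℕₚ.m≤m+n h (K₁ ℕ.+ K₂)) (ℕₚ.m≤n+m (h ℕ.+ (K₁ ℕ.+ K₂)) n))
          n<k : ι n < ι k
          n<k = ι-mono-< (s≤s (ℕₚ.≤-trans (ℕₚ.m≤m+n n (h ℕ.+ (K₁ ℕ.+ K₂))) le))
          N≥0 : 0ℚ ≤ cube (ι k)
          N≥0 = 0≤cube (0≤ι k)
          pos : ∀ m → 0ℚ ≤ ι c * ι (nb a m)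
          pos m = 0≤* (0≤ι c) (0≤ι (nb a m))
          κ≤N : κ ≤ cube (ι k)
          κ≤N = ≤-trans (subst (_≤ nat 11520 * κ) (*-identityˡ κ) (*-monoʳ {κ} {1ℚ} {nat 11520} 0≤κ (≤ᵇ⇒≤ _))) (≤-trans (<⇒≤ (≤-<-trans hn n<k)) (cube≥ (1≤ι j)))
          unscale : ∀ {s u v w} → s * u * (s * v) < s * w * (s * w) → u * v < w * w
          unscale {s} {u} {v} {w} lt = *-cancelˡ-<-nonNeg (s * s) {{nonNegative (0≤□ s)}} (subst₂ _<_ (eq s u v) (eq s w w) lt)
            where
            eq : ∀ s u v → s * u * (s * v) ≡ s * s * (u * v)
            eq = solve-∀ ringℚ

log-concave-spread : ∀ (s : ℕ → ℕ) K → (∀ k → K ℕ.≤ k → s k ℕ.* s (2 ℕ.+ k) ℕ.< s (suc k) ℕ.* s (suc k)) →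
                     ∀ j d → K ℕ.≤ j → s j ℕ.* s (suc (d ℕ.+ suc j)) ℕ.< s (suc j) ℕ.* s (d ℕ.+ suc j)
log-concave-spread s K h j zero    K≤j = h j K≤j
log-concave-spread s K h j (suc d) K≤j = ℕₚ.≰⇒> λ le → ℕₚ.<-irrefl refl (begin-strict
  s (suc j) ℕ.* s (suc m) ℕ.* s m          ≤⟨ ℕₚ.*-monoˡ-≤ (s m) le ⟩
  s j ℕ.* s (2 ℕ.+ m) ℕ.* s m              ≡⟨ e₁ (s j) (s (2 ℕ.+ m)) (s m) ⟩
  s j ℕ.* (s m ℕ.* s (2 ℕ.+ m))            ≤⟨ ℕₚ.*-monoʳ-≤ (s j) (ℕₚ.<⇒≤ B) ⟩
  s j ℕ.* (s (suc m) ℕ.* s (suc m))        ≡⟨ sym (ℕₚ.*-assoc (s j) (s (suc m)) (s (suc m))) ⟩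
  s j ℕ.* s (suc m) ℕ.* s (suc m)          <⟨ ℕₚ.*-monoˡ-< (s (suc m)) {{pos}} (log-concave-spread s K h j d K≤j) ⟩
  s (suc j) ℕ.* s m ℕ.* s (suc m)          ≡⟨ e₂ (s (suc j)) (s m) (s (suc m)) ⟩
  s (suc j) ℕ.* s (suc m) ℕ.* s m          ∎)
  where
  open ℕₚ.≤-Reasoning
  m : ℕ
  m = d ℕ.+ suc j
  B : s m ℕ.* s (2 ℕ.+ m) ℕ.< s (suc m) ℕ.* s (suc m)
  B = h m (ℕₚ.≤-trans K≤j (ℕₚ.≤-trans (ℕₚ.n≤1+n j) (ℕₚ.m≤n+m (suc j) d)))
  e₁ : ∀ a b c → a ℕ.* b ℕ.* c ≡ a ℕ.* (c ℕ.* b)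
  e₁ = ℕ-Solver.solve-∀
  e₂ : ∀ a b c → a ℕ.* b ℕ.* c ≡ a ℕ.* c ℕ.* b
  e₂ = ℕ-Solver.solve-∀
  pos : ℕ.NonZero (s (suc m))
  pos = nz (s (suc m)) B
    where
    nz : ∀ x {y} → y ℕ.< x ℕ.* x → ℕ.NonZero x
    nz (suc x) _ = _

theorem1p3 : (a c : ℕ) → 2 ℕ.≤ c → c ℕ.% 2 ≡ 1 → a ℕ.< c →
    ∃ λ N → (n₁ n₂ : ℕ) → N ℕ.≤ n₁ → N ℕ.≤ n₂ → n₁ ℕ.< n₂ ℕ.+ 1 →
    N2bar (ℤ.+ a) c n₁ ℕ.* N2bar (ℤ.+ a) c n₂ ℕ.> N2bar (ℤ.+ a) c (n₁ ∸ 1) ℕ.* N2bar (ℤ.+ a) c (n₂ ℕ.+ 1)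
theorem1p3 a (suc c′) _ _ _ = go (Final.consecutive c′ a)
  where
  s : ℕ → ℕ
  s = N2bar (ℤ.+ a) (suc c′)
  go : Eventually (λ k → s k ℕ.* s (2 ℕ.+ k) ℕ.< s (suc k) ℕ.* s (suc k)) →
       ∃ λ N → (n₁ n₂ : ℕ) → N ℕ.≤ n₁ → N ℕ.≤ n₂ → n₁ ℕ.< n₂ ℕ.+ 1 → s n₁ ℕ.* s n₂ ℕ.> s (n₁ ∸ 1) ℕ.* s (n₂ ℕ.+ 1)
  go (K , h) = suc K , λ { (suc j) n₂ (s≤s K≤j) _ lt → main j n₂ K≤j (ℕₚ.≤-pred (subst (suc j ℕ.<_) (ℕₚ.+-comm n₂ 1) lt)) }
    where
    main : ∀ j n₂ → K ℕ.≤ j → suc j ℕ.≤ n₂ → s j ℕ.* s (n₂ ℕ.+ 1) ℕ.< s (suc j) ℕ.* s n₂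
    main j n₂ K≤j j<n₂ = subst (λ n → s j ℕ.* s n ℕ.< s (suc j) ℕ.* s n₂) (ℕₚ.+-comm 1 n₂)
      (subst (λ n → s j ℕ.* s (suc n) ℕ.< s (suc j) ℕ.* s n) (ℕₚ.m∸n+n≡m j<n₂) (log-concave-spread s K h j (n₂ ∸ suc j) K≤j))
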